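{- Let $w\in S_n$ be a Grassmannian permutation. Then: (i) for every $\alpha\in\mathrm{supp}(\mathfrak{G}_w)$ with $|\alpha|<\deg\mathfrak{G}_w$ there exists $\beta\in\mathrm{supp}(\mathfrak{G}_w)$ with $\alpha<\beta$ (componentwise) and $|\beta|=|\alpha|+1$; and (ii) $\mathfrak{G}_w$ has saturated Newton polytope, i.e. $\mathrm{Newton}(\mathfrak{G}_w)\cap\mathbb{Z}^n=\mathrm{supp}(\mathfrak{G}_w)$, and $\mathrm{Newton}(\mathfrak{G}_w)$ is a generalized polymatroid.
   Context: Permutations are written in one-line notation; $ws_j$ is $w$ with entries in positions $j,j+1$ swapped. With $\partial_j f=\frac{f-f(x_1,\ldots,x_{j+1},x_j,\ldots,x_n)}{x_j-x_{j+1}}$ and $\overline{\partial}_jf=\partial_j((1-x_{j+1})f)$, the Grothendieck polynomial is defined by $\mathfrak{G}_{w_0}=x_1^{n-1}x_2^{n-2}\cdots x_{n-1}$ for $w_0=n(n-1)\cdots1$ and $\mathfrak{G}_w=\overline{\partial}_j\mathfrak{G}_{ws_j}$ whenever $w(j)<w(j+1)$. A permutation is Grassmannian if it has exactly one descent (one $i$ with $w(i)>w(i+1)$). $\mathrm{supp}(f)$ is the set of exponent vectors of monomials with nonzero coefficient, $\mathrm{Newton}(f)$ its convex hull, $\deg$ is total degree, $|\alpha|=\sum_i\alpha_i$, and $\alpha<\beta$ means $\alpha_i\le\beta_i$ for all $i$ and $\alpha\ne\beta$. A function $z:2^{[n]}\to\mathbb{R}$ is submodular if $z(I)+z(J)\ge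 z(I\cup J)+z(I\cap J)$ for all $I,J$, and supermodular if $-z$ is submodular. A pair $(y,z)$ is paramodular if $y$ is supermodular, $z$ is submodular, and $z(I)-y(J)\ge z(I\setminus J)-y(J\setminus I)$ for all $I,J\subseteq[n]$. A polytope $Q\subseteq\mathbb{R}^n$ is a generalized polymatroid if there is a paramodular pair $(y,z)$ with $Q=\{t\in\mathbb{R}^n: y(I)\le\sum_{i\in I}t_i\le z(I)\ \forall I\subseteq[n]\}$.
   Formalization: The Newton polytope is taken as the set of rational points that are rational convex combinations of the support, and the generalized polymatroid identity, with a rational-valued paramodular pair, is stated for rational points t instead of real ones. -}

module Defs where

open import Data.Nat as ℕ using (ℕ; zero; suc; _∸_)
open import Data.Integer as ℤ using (ℤ; 0ℤ; 1ℤ)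
open import Data.Rational as ℚ using (ℚ)
open import Data.Fin using (Fin; toℕ)
open import Data.Vec using (Vec; []; _∷_; tabulate; toList; map; zipWith; replicate; foldr)
import Data.Vec.Properties as VecP
open import Data.Vec.Relation.Binary.Pointwise.Inductive using (Pointwise)
open import Data.List using (List; allFin; upTo)
import Data.List as List
open import Data.List.Relation.Unary.All using (All)
open import Data.List.Relation.Binary.Permutation.Propositional using (_↭_)
open import Data.Maybe using (Maybe; just; nothing; maybe)
open import Data.Bool using (if_then_else_)
open import Data.Fin.Subset using (Subset; _∪_; _∩_; _─_)
open import Data.Product using (Σ; _×_; _,_; ∃)
open import Data.Empty using (⊥)
open import Relation.Nullary using (¬_; does)
open import Relation.Binary.PropositionalEquality using (_≡_)

-- Indices are 0-based: index j here is position j+1 of the paper.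

IsPermutation : ∀ {n} → Vec ℕ n → Set
IsPermutation {n} w = toList w ↭ List.map suc (upTo n)

w₀ : (n : ℕ) → Vec ℕ n
w₀ n = tabulate (λ i → n ∸ toℕ i)

swapAt : ∀ {A : Set} {n} → ℕ → Vec A n → Vec A n
swapAt zero    (a ∷ b ∷ v) = b ∷ a ∷ v
swapAt zero    v           = v
swapAt (suc j) []          = []
swapAt (suc j) (a ∷ v)     = a ∷ swapAt j v

AscentAt : ∀ {n} → ℕ → Vec ℕ n → Set
AscentAt zero    (a ∷ b ∷ v) = a ℕ.< b
AscentAt zero    _           = ⊥
AscentAt (suc j) []          = ⊥
AscentAt (suc j) (a ∷ v)     = AscentAt j v

descents : ∀ {n} → Vec ℕ n → ℕ
descents (a ∷ b ∷ v) = (if does (b ℕ.<? a) then 1 else 0) ℕ.+ descents (b ∷ v)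
descents _ = 0

Grassmannian : ∀ {n} → Vec ℕ n → Set
Grassmannian w = descents w ≡ 1

-- Polynomials in ℤ[x₁,…,xₙ] as coefficient functions on exponent vectors

Mono : ℕ → Set
Mono n = Vec ℕ n

Poly : ℕ → Set
Poly n = Mono n → ℤ

_≈ₚ_ : ∀ {n} → Poly n → Poly n → Set
f ≈ₚ g = ∀ a → f a ≡ g a

monomial : ∀ {n} → Mono n → Poly n
monomial α a = if does (VecP.≡-dec ℕ._≟_ a α) then 1ℤ else 0ℤ

_−ₚ_ : ∀ {n} → Poly n → Poly n → Poly n
(f −ₚ g) a = f a ℤ.- g a

decAt : ∀ {n} → ℕ → Mono n → Maybe (Mono n)
decAt j       []            = nothing
decAt zero    (zero ∷ a)    = nothing
decAt zero    (suc k ∷ a)   = just (k ∷ a)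
decAt (suc j) (k ∷ a)       = Data.Maybe.map (k ∷_) (decAt j a)
  where import Data.Maybe

mulX : ∀ {n} → ℕ → Poly n → Poly n
mulX j f a = maybe f 0ℤ (decAt j a)

swapVars : ∀ {n} → ℕ → Poly n → Poly n
swapVars j f a = f (swapAt j a)

IsDivDiff : ∀ {n} → ℕ → Poly n → Poly n → Set
IsDivDiff j f g = (mulX j g −ₚ mulX (suc j) g) ≈ₚ (f −ₚ swapVars j f)

oneMinusX : ∀ {n} → ℕ → Poly n → Poly n
oneMinusX j f = f −ₚ mulX j f

IsIsobaricDivDiff : ∀ {n} → ℕ → Poly n → Poly n → Set
IsIsobaricDivDiff j f g = IsDivDiff j (oneMinusX (suc j) f) g

δ : (n : ℕ) → Mono n
δ n = tabulate (λ i → n ∸ suc (toℕ i))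

data Grothendieck (n : ℕ) : Vec ℕ n → Poly n → Set where
  top  : Grothendieck n (w₀ n) (monomial (δ n))
  step : ∀ {w f g} (j : ℕ) → AscentAt j w →
         Grothendieck n (swapAt j w) f → IsIsobaricDivDiff j f g →
         Grothendieck n w g

InSupp : ∀ {n} → Poly n → Mono n → Set
InSupp f α = ¬ (f α ≡ 0ℤ)

∣_∣ₘ : ∀ {n} → Mono n → ℕ
∣ α ∣ₘ = Data.Vec.sum α
  where import Data.Vec

IsDegree : ∀ {n} → Poly n → ℕ → Set
IsDegree f d = (Σ _ λ α → InSupp f α × ∣ α ∣ₘ ≡ d)
             × (∀ α → InSupp f α → ∣ α ∣ₘ ℕ.≤ d)

_<ₘ_ : ∀ {n} → Mono n → Mono n → Set
α <ₘ β = Pointwise ℕ._≤_ α β × ¬ (α ≡ β)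

intToℚ : ℤ → ℚ
intToℚ z = z ℚ./ 1

toℚ : ∀ {n} → Mono n → Vec ℚ n
toℚ α = map (λ k → intToℚ (ℤ.+ k)) α

toℤ : ∀ {n} → Mono n → Vec ℤ n
toℤ α = map ℤ.+_ α

sumℚ : List ℚ → ℚ
sumℚ = List.foldr ℚ._+_ ℚ.0ℚ

combo : ∀ {n} → List (ℚ × Vec ℚ n) → Vec ℚ n
combo {n} = List.foldr (λ { (c , v) acc → zipWith ℚ._+_ (map (c ℚ.*_) v) acc })
                       (replicate n ℚ.0ℚ)

InNewton : ∀ {n} → Poly n → Vec ℚ n → Set
InNewton {n} f t =
  Σ (List (ℚ × Mono n)) λ cs →
      All (λ { (c , α) → (ℚ.0ℚ ℚ.≤ c) × InSupp f α }) cs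
    × sumℚ (List.map (λ { (c , _) → c }) cs) ≡ ℚ.1ℚ
    × combo (List.map (λ { (c , α) → (c , toℚ α) }) cs) ≡ t

SaturatedNewton : ∀ {n} → Poly n → Set
SaturatedNewton {n} f =
  ∀ (t : Vec ℤ n) →
    (InNewton f (map intToℚ t) → Σ (Mono n) λ α → InSupp f α × toℤ α ≡ t)
  × ((Σ (Mono n) λ α → InSupp f α × toℤ α ≡ t) → InNewton f (map intToℚ t))

sumOver : ∀ {n} → Subset n → Vec ℚ n → ℚ
sumOver I t = foldr _ ℚ._+_ ℚ.0ℚ
  (zipWith (λ b x → if b then x else ℚ.0ℚ) I t)

Submodular : ∀ {n} → (Subset n → ℚ) → Set
Submodular z = ∀ I J → z (I ∪ J) ℚ.+ z (I ∩ J) ℚ.≤ z I ℚ.+ z J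

Supermodular : ∀ {n} → (Subset n → ℚ) → Set
Supermodular y = Submodular (λ I → ℚ.- y I)

Paramodular : ∀ {n} → (Subset n → ℚ) → (Subset n → ℚ) → Set
Paramodular y z = Supermodular y × Submodular z
  × (∀ I J → z (I ─ J) ℚ.- y (J ─ I) ℚ.≤ z I ℚ.- y J)

IsGeneralizedPolymatroid : ∀ {n} → (Vec ℚ n → Set) → Set
IsGeneralizedPolymatroid {n} Q =
  Σ (Subset n → ℚ) λ y → Σ (Subset n → ℚ) λ z → Paramodular y z
    × (∀ t → (Q t → ∀ I → (y I ℚ.≤ sumOver I t) × (sumOver I t ℚ.≤ z I))
           × ((∀ I → (y I ℚ.≤ sumOver I t) × (sumOver I t ℚ.≤ z I)) → Q t))

{-# OPTIONS --safe #-}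
-- By Fomin and Kirillov, the Grothendieck polynomials are the coefficients 𝔉 of the product of the
-- A_k(x_k) = h_{n-1}(x_k) ⋯ h_k(x_k), with h_i(x) = 1 + x u_i, in the 0-Hecke algebra: since A_k(x) A_k(y) = A_k(y) A_k(x)
-- by the Yang–Baxter relation, 𝔉 h_j(x_{j+1}) is symmetric in x_j, x_{j+1}, and that symmetry is exactly the divided
-- difference recursion.  Left multiplication permutes values, so for a Grassmannian permutation only the 0-1 word
-- marking the values of its first run matters.  No terms cancel there, and peeling off x_1 gives a branching rule for the
-- support in terms of the partition λ: remove a horizontal strip, then put back at most one box in each shortened row.
--
-- The support is symmetric, so replacing two entries of an exponent vector by more balanced ones with the same sum can be
-- checked in two variables; and the branching rule contains every decreasing ν with λ_i ≤ ν_i ≤ min_{j ≤ i} (λ_j + j − 1).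
-- By Hardy–Littlewood–Pólya, the support therefore consists of the lattice points of the generalized polymatroid whose
-- bounds on a sum of k coordinates are the sum of the k smallest λ_i and the sum of the k largest values of that minimum.
-- The same majorization argument over ℚ shows that every rational point is a convex combination of the support, and one
-- can raise a smallest coordinate as long as the total is not maximal.
module Submission where

open import Defs
open import Data.Nat as ℕ using (ℕ; zero; suc; _∸_; _≤_; _<_; z≤n; s≤s; _+_)
open import Data.Nat.Properties as ℕP using (≤-trans; ≤-refl; ≤-reflexive; +-suc; +-comm; +-identityʳ; +-assoc;
  +-monoʳ-≤; +-mono-≤; <-irrefl; m≤m+n; m≤n+m)
open import Data.Integer as ℤ using (ℤ; 0ℤ; 1ℤ)
import Data.Integer.Properties as ℤP
import Data.Integer.Tactic.RingSolver as ℤS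
import Data.Nat.Tactic.RingSolver as ℕS
open import Data.Rational as ℚ using (ℚ)
open import Data.Vec as Vec using (Vec; []; _∷_; toList; replicate; zipWith)
import Data.Vec.Properties as VecP
open import Data.List as List using (List; []; _∷_)
open import Data.Maybe using (just; nothing; maybe)
open import Data.Bool using (Bool; true; false; if_then_else_; not)
open import Data.Product using (Σ; _×_; _,_; ∃; proj₁; proj₂)
open import Data.Sum using (_⊎_; inj₁; inj₂)
open import Data.Empty using (⊥; ⊥-elim)
open import Function using (_∘_)
open import Relation.Nullary using (¬_; does; yes; no)
open import Relation.Nullary.Decidable using (dec-true; dec-false)
open import Relation.Binary.PropositionalEquality
open import Data.List.Relation.Unary.All as All using (All; []; _∷_)
open import Data.List.Relation.Unary.AllPairs as AllPairs using (AllPairs; []; _∷_)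
open import Data.List.Relation.Unary.Any using (here; there)
open import Data.List.Membership.Propositional using (_∈_)
open import Data.List.Relation.Unary.Unique.Propositional using (Unique)
import Data.List.Relation.Unary.Unique.Propositional.Properties as UniqueP
import Data.List.Properties as ListP
open import Data.List.Relation.Binary.Permutation.Propositional using (_↭_; ↭-sym; ↭-trans; prep; ↭-reflexive; ↭⇒↭ₛ)
import Data.List.Relation.Binary.Permutation.Propositional.Properties as PermP
import Data.List.Relation.Binary.Permutation.Setoid.Properties as PermS
import Data.List.Membership.Propositional.Properties as ∈P
open import Data.Nat.ListAction using (sum)
open import Algebra.Structures using (IsAbelianGroup)
open import Relation.Binary.Structures using (IsTotalOrder)
import Data.Rational.Properties as ℚP
import Data.Rational.Unnormalised as ℚᵘ
import Data.Rational.Unnormalised.Properties as ℚᵘP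
open import Data.Rational.Solver using (module +-*-Solver)
import Data.List.Relation.Unary.All.Properties as AllP
open import Data.Fin.Subset using (_∪_; _∩_; _─_)
open import Data.Fin.Subset.Properties using (∩-comm)
open import Data.Vec.Relation.Binary.Pointwise.Inductive using (Pointwise; []; _∷_)

-- Polynomials and multiplication by a variable

-- The two sides of the 0-Hecke algebra serve different ends. Divided differences act on positions,
-- hence on the right, and the permutations between `w₀` and `w` need not be Grassmannian. Left
-- generators act on values and stay among words with at most one descent. Right factors can be
-- traded for left ones because the product is applied to the unit, where both sides agree, and
-- because the two actions commute. `Grothendieck` is a relation, and no quotient is ever
-- constructed: `𝔉` satisfies the recursion, quotients are unique, and so every derivation agrees
-- with `𝔉`. The branching rule treats the variables in order and hides the symmetry of the support.
-- That symmetry is fetched back from `𝔉` and stated for arbitrary partitions, because peeling off a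
-- variable changes the partition.

_+ₚ_ : ∀ {n} → Poly n → Poly n → Poly n
(f +ₚ g) a = f a ℤ.+ g a

module _ {n : ℕ} where

  mulX-cong : ∀ i {f g : Poly n} → f ≈ₚ g → mulX i f ≈ₚ mulX i g
  mulX-cong i f≈g a with decAt i a
  ... | just b  = f≈g b
  ... | nothing = refl

  mulX-+ : ∀ i (f g : Poly n) → mulX i (f +ₚ g) ≈ₚ (mulX i f +ₚ mulX i g)
  mulX-+ i f g a with decAt i a
  ... | just b  = refl
  ... | nothing = refl

  mulX-− : ∀ i (f g : Poly n) → mulX i (f −ₚ g) ≈ₚ (mulX i f −ₚ mulX i g)
  mulX-− i f g a with decAt i a
  ... | just b  = refl
  ... | nothing = refl

  mulX-0 : ∀ i a → mulX {n} i (λ _ → 0ℤ) a ≡ 0ℤ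
  mulX-0 i a with decAt i a
  ... | just b  = refl
  ... | nothing = refl

mulX-suc : ∀ {n} i (f : Poly (suc n)) k a → mulX (suc i) f (k ∷ a) ≡ mulX i (λ b → f (k ∷ b)) a
mulX-suc i f k a with decAt i a
... | just b  = refl
... | nothing = refl

mulX-comm-zero : ∀ {n} k (f : Poly (suc n)) → mulX zero (mulX (suc k) f) ≈ₚ mulX (suc k) (mulX zero f)
mulX-comm-zero k f (zero ∷ a)  = sym (trans (mulX-suc k (mulX zero f) zero a) (mulX-0 k a))
mulX-comm-zero k f (suc x ∷ a) = trans (mulX-suc k f x a) (sym (mulX-suc k (mulX zero f) (suc x) a))

mulX-comm : ∀ {n} i k (f : Poly n) → mulX i (mulX k f) ≈ₚ mulX k (mulX i f)
mulX-comm i       k       f []      = refl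
mulX-comm zero    zero    f (x ∷ a) = refl
mulX-comm zero    (suc k) f (x ∷ a) = mulX-comm-zero k f (x ∷ a)
mulX-comm (suc i) zero    f (x ∷ a) = sym (mulX-comm-zero i f (x ∷ a))
mulX-comm (suc i) (suc k) f (x ∷ a) =
  trans (mulX-suc i (mulX (suc k) f) x a)
  (trans (mulX-cong i (mulX-suc k f x) a)
  (trans (mulX-comm i k (λ b → f (x ∷ b)) a)
  (trans (mulX-cong k (λ b → sym (mulX-suc i f x b)) a)
  (sym (mulX-suc k (mulX (suc i) f) x a)))))

swapVars-mulX-< : ∀ {n} j i (f : Poly n) → i < j → swapVars j (mulX i f) ≈ₚ mulX i (swapVars j f)
swapVars-mulX-< (suc j) zero    f i<j []          = refl
swapVars-mulX-< (suc j) zero    f i<j (zero ∷ a)  = refl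
swapVars-mulX-< (suc j) zero    f i<j (suc x ∷ a) = refl
swapVars-mulX-< (suc j) (suc i) f i<j []          = refl
swapVars-mulX-< (suc j) (suc i) f (s≤s i<j) (x ∷ a) =
  trans (mulX-suc i f x (swapAt j a))
  (trans (swapVars-mulX-< j i (λ b → f (x ∷ b)) i<j a)
  (sym (mulX-suc i (swapVars (suc j) f) x a)))

swapVars-mulX-> : ∀ {n} j i (f : Poly n) → suc j < i → swapVars j (mulX i f) ≈ₚ mulX i (swapVars j f)
swapVars-mulX-> zero    (suc (suc i)) f _ []          = refl
swapVars-mulX-> zero    (suc (suc i)) f _ (x ∷ [])    = refl
swapVars-mulX-> zero    (suc (suc i)) f _ (x ∷ y ∷ a) with decAt i a
... | just b  = refl
... | nothing = refl
swapVars-mulX-> zero    (suc zero) f (s≤s ()) a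
swapVars-mulX-> (suc j) (suc i) f _ []          = refl
swapVars-mulX-> (suc j) (suc i) f (s≤s j<i) (x ∷ a) =
  trans (mulX-suc i f x (swapAt j a))
  (trans (swapVars-mulX-> j i (λ b → f (x ∷ b)) j<i a)
  (sym (mulX-suc i (swapVars (suc j) f) x a)))

swapVars-mulX-right : ∀ {n} j (f : Poly n) → suc j < n →
                      swapVars j (mulX (suc j) f) ≈ₚ mulX j (swapVars j f)
swapVars-mulX-right zero f _ (zero ∷ y ∷ a)  with y
... | zero  = refl
... | suc _ = refl
swapVars-mulX-right zero f _ (suc x ∷ y ∷ a) = refl
swapVars-mulX-right zero f (s≤s ()) (x ∷ [])
swapVars-mulX-right (suc j) f (s≤s j<n) (x ∷ a) =
  trans (mulX-suc (suc j) f x (swapAt j a))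
  (trans (swapVars-mulX-right j (λ b → f (x ∷ b)) j<n a)
  (sym (mulX-suc j (swapVars (suc j) f) x a)))

swapAt-involutive : ∀ {A : Set} {n} j (v : Vec A n) → swapAt j (swapAt j v) ≡ v
swapAt-involutive zero    []          = refl
swapAt-involutive zero    (x ∷ [])    = refl
swapAt-involutive zero    (x ∷ y ∷ v) = refl
swapAt-involutive (suc j) []          = refl
swapAt-involutive (suc j) (x ∷ v)     = cong (x ∷_) (swapAt-involutive j v)

swapVars-mulX-left : ∀ {n} j (f : Poly n) → suc j < n →
                     swapVars j (mulX j f) ≈ₚ mulX (suc j) (swapVars j f)
swapVars-mulX-left j f j<n a = trans
  (mulX-cong j (λ b → cong f (sym (swapAt-involutive j b))) (swapAt j a))
  (trans (sym (swapVars-mulX-right j (swapVars j f) j<n (swapAt j a)))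
         (cong (mulX (suc j) (swapVars j f)) (swapAt-involutive j a)))

-- Operators on families of polynomials

Family : Set → ℕ → Set
Family W n = W → Poly n

module _ {W : Set} where

  -- A 0-Hecke generator u with u² = −u acting on coefficient functions; d tells whether s lowers the length.
  dem : (W → Bool) → (W → W) → (W → ℤ) → W → ℤ
  dem d s g w = if d w then g (s w) ℤ.- g w else 0ℤ

  dem-cong : ∀ d s {g h : W → ℤ} → (∀ w → g w ≡ h w) → ∀ w → dem d s g w ≡ dem d s h w
  dem-cong d s e w with d w
  ... | true  = cong₂ ℤ._-_ (e (s w)) (e w)
  ... | false = refl

  dem-+ : ∀ d s (g h : W → ℤ) w → dem d s (λ v → g v ℤ.+ h v) w ≡ dem d s g w ℤ.+ dem d s h w
  dem-+ d s g h w with d w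
  ... | true  = lemma (g (s w)) (h (s w)) (g w) (h w)
    where
    lemma : ∀ a b c d → (a ℤ.+ b) ℤ.- (c ℤ.+ d) ≡ (a ℤ.- c) ℤ.+ (b ℤ.- d)
    lemma = ℤS.solve-∀
  ... | false = refl

  infix 4 _≈_
  _≈_ : ∀ {n} → Family W n → Family W n → Set
  f ≈ g = ∀ w → f w ≈ₚ g w

  module _ {n : ℕ} where

    demazure : (W → Bool) → (W → W) → Family W n → Family W n
    demazure d s f w a = dem d s (λ v → f v a) w

    demazure-mulX : ∀ d s i (f : Family W n) →
      demazure d s (λ w → mulX i (f w)) ≈ (λ w → mulX i (demazure d s f w))
    demazure-mulX d s i f w a with d w
    ... | true  = sym (mulX-− i (f (s w)) (f w) a)
    ... | false = sym (mulX-0 i a)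

    -- Multiplication by h(xᵢ) = 1 + xᵢ u.
    hecke : (W → Bool) → (W → W) → ℕ → Family W n → Family W n
    hecke d s i f w = f w +ₚ mulX i (demazure d s f w)

    hecke-cong : ∀ d s i {f g : Family W n} → f ≈ g → hecke d s i f ≈ hecke d s i g
    hecke-cong d s i f≈g w a = cong₂ ℤ._+_ (f≈g w a)
      (mulX-cong i (λ b → dem-cong d s (λ v → f≈g v b) w) a)

    hecke-comm : ∀ d s i d′ s′ l (f : Family W n) w →
      (∀ g → dem d s (dem d′ s′ g) w ≡ dem d′ s′ (dem d s g) w) →
      hecke d s i (hecke d′ s′ l f) w ≈ₚ hecke d′ s′ l (hecke d s i f) w
    hecke-comm d s i d′ s′ l f w comm a =
      trans (cong (λ z → hecke d′ s′ l f w a ℤ.+ z) (expand d s i d′ s′ l))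
      (trans (lemma (f w a) _ _ _)
      (cong (λ z → hecke d s i f w a ℤ.+ z) (sym (trans (expand d′ s′ l d s i)
        (cong (λ z → mulX l (demazure d′ s′ f w) a ℤ.+ z)
          (trans (mulX-comm l i (demazure d′ s′ (demazure d s f) w) a)
                 (mulX-cong i (mulX-cong l (λ b → sym (comm (λ v → f v b)))) a)))))))
      where
      expand : ∀ d s i d′ s′ l → mulX i (demazure d s (hecke d′ s′ l f) w) a ≡
               mulX i (demazure d s f w) a ℤ.+ mulX i (mulX l (demazure d s (demazure d′ s′ f) w)) a
      expand d s i d′ s′ l = trans
        (mulX-cong i (λ b → trans (dem-+ d s (λ v → f v b) (λ v → mulX l (demazure d′ s′ f v) b) w)
          (cong (λ z → demazure d s f w b ℤ.+ z) (demazure-mulX d s l (demazure d′ s′ f) w b))) a)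
        (mulX-+ i (demazure d s f w) (mulX l (demazure d s (demazure d′ s′ f) w)) a)
      lemma : ∀ p q r s → (p ℤ.+ q) ℤ.+ (r ℤ.+ s) ≡ (p ℤ.+ r) ℤ.+ (q ℤ.+ s)
      lemma = ℤS.solve-∀

-- The 0-Hecke action on positions

descent? : ∀ {n} → ℕ → Vec ℕ n → Bool
descent? zero    (a ∷ b ∷ v) = b ℕ.<ᵇ a
descent? zero    _           = false
descent? (suc j) []          = false
descent? (suc j) (a ∷ v)     = descent? j v

<ᵇ-asym : ∀ a b → (a ℕ.<ᵇ b) ≡ true → (b ℕ.<ᵇ a) ≡ false
<ᵇ-asym zero    (suc b) _ = refl
<ᵇ-asym (suc a) (suc b) e = <ᵇ-asym a b e

<ᵇ-trans : ∀ a b c → (a ℕ.<ᵇ b) ≡ true → (b ℕ.<ᵇ c) ≡ true → (a ℕ.<ᵇ c) ≡ true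
<ᵇ-trans zero    (suc b) (suc c) _ _ = refl
<ᵇ-trans (suc a) (suc b) (suc c) e f = <ᵇ-trans a b c e f

∂ : ∀ {n} → ℕ → (Vec ℕ n → ℤ) → Vec ℕ n → ℤ
∂ j = dem (descent? j) (swapAt j)

∂-idem : ∀ {n} j (g : Vec ℕ n → ℤ) w → ∂ j (∂ j g) w ≡ ℤ.- ∂ j g w
∂-idem zero    g []          = refl
∂-idem zero    g (a ∷ [])    = refl
∂-idem zero    g (a ∷ b ∷ v) with b ℕ.<ᵇ a in eq
... | false = refl
... | true rewrite <ᵇ-asym b a eq = ℤP.+-identityˡ _
∂-idem (suc j) g []          = refl
∂-idem (suc j) g (a ∷ v)     = ∂-idem j (λ u → g (a ∷ u)) v

∂-0 : ∀ {n} k (w : Vec ℕ n) → ∂ k (λ _ → 0ℤ) w ≡ 0ℤ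
∂-0 k w with descent? k w
... | true  = refl
... | false = refl

∂-− : ∀ {n} k (g h : Vec ℕ n → ℤ) w → ∂ k (λ v → g v ℤ.- h v) w ≡ ∂ k g w ℤ.- ∂ k h w
∂-− k g h w with descent? k w
... | true  = lemma (g (swapAt k w)) (h (swapAt k w)) (g w) (h w)
  where
  lemma : ∀ a b c d → (a ℤ.- b) ℤ.- (c ℤ.- d) ≡ (a ℤ.- c) ℤ.- (b ℤ.- d)
  lemma = ℤS.solve-∀
... | false = refl

∂-far : ∀ {n} j k (g : Vec ℕ n → ℤ) → suc j < k → ∀ w → ∂ j (∂ k g) w ≡ ∂ k (∂ j g) w
∂-far zero (suc zero) g (s≤s ()) w
∂-far zero    (suc (suc k)) g _ []          = refl
∂-far zero    (suc (suc k)) g _ (a ∷ [])    = refl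
∂-far zero    (suc (suc k)) g _ (a ∷ b ∷ v) with b ℕ.<ᵇ a
... | true  = sym (∂-− k (λ u → g (b ∷ a ∷ u)) (λ u → g (a ∷ b ∷ u)) v)
... | false = sym (∂-0 k v)
∂-far (suc j) (suc k) g _         []      = refl
∂-far (suc j) (suc k) g (s≤s j<k) (a ∷ v) = ∂-far j k (λ u → g (a ∷ u)) j<k v

∂-braid : ∀ {n} j (g : Vec ℕ n → ℤ) w → ∂ j (∂ (suc j) (∂ j g)) w ≡ ∂ (suc j) (∂ j (∂ (suc j) g)) w
∂-braid zero g []           = refl
∂-braid zero g (a ∷ [])     = refl
∂-braid zero g (a ∷ b ∷ []) with b ℕ.<ᵇ a
... | true  = refl
... | false = refl
∂-braid zero g (a ∷ b ∷ c ∷ v) with b ℕ.<ᵇ a in ba | c ℕ.<ᵇ a in ca | c ℕ.<ᵇ b in cb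
... | true  | true  | true  rewrite <ᵇ-asym b a ba | <ᵇ-asym c b cb =
        lemma (g (a ∷ b ∷ c ∷ v)) (g (a ∷ c ∷ b ∷ v)) (g (b ∷ a ∷ c ∷ v))
              (g (b ∷ c ∷ a ∷ v)) (g (c ∷ a ∷ b ∷ v)) (g (c ∷ b ∷ a ∷ v))
  where
  lemma : ∀ abc acb bac bca cab cba →
    ((cba ℤ.- bca) ℤ.- 0ℤ) ℤ.- ((cab ℤ.- acb) ℤ.- (bac ℤ.- abc)) ≡
    ((cba ℤ.- cab) ℤ.- 0ℤ) ℤ.- ((bca ℤ.- bac) ℤ.- (acb ℤ.- abc))
  lemma = ℤS.solve-∀
... | true  | true  | false rewrite <ᵇ-asym b a ba = refl
... | true  | false | true  with trans (sym ca) (<ᵇ-trans c b a cb ba)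
...   | ()
∂-braid zero g (a ∷ b ∷ c ∷ v) | true  | false | false = refl
∂-braid zero g (a ∷ b ∷ c ∷ v) | false | true  | true  rewrite <ᵇ-asym c b cb = refl
∂-braid zero g (a ∷ b ∷ c ∷ v) | false | true  | false = refl
∂-braid zero g (a ∷ b ∷ c ∷ v) | false | false | true  = refl
∂-braid zero g (a ∷ b ∷ c ∷ v) | false | false | false = refl
∂-braid (suc j) g []      = refl
∂-braid (suc j) g (a ∷ v) = ∂-braid j (λ u → g (a ∷ u)) v

-- Families indexed by words and the Yang-Baxter relation

module _ {n : ℕ} where

  X : Set
  X = Family (Vec ℕ n) n

  infixr 6 _⊞_
  _⊞_ : X → X → X
  (f ⊞ g) w = f w +ₚ g w

  ⊟_ : X → X
  (⊟ f) w a = ℤ.- f w a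

  var : ℕ → X → X
  var i f w = mulX i (f w)

  Δ : ℕ → X → X
  Δ j = demazure (descent? j) (swapAt j)

  H : ℕ → ℕ → X → X
  H j = hecke (descent? j) (swapAt j)

  ≈-sym : ∀ {f g : X} → f ≈ g → g ≈ f
  ≈-sym e w a = sym (e w a)

  ≈-trans : ∀ {f g h : X} → f ≈ g → g ≈ h → f ≈ h
  ≈-trans e e′ w a = trans (e w a) (e′ w a)

  Δ-cong : ∀ j {f g : X} → f ≈ g → Δ j f ≈ Δ j g
  Δ-cong j f≈g w a = dem-cong (descent? j) (swapAt j) (λ v → f≈g v a) w

  Δ-+ : ∀ j (f g : X) → Δ j (f ⊞ g) ≈ Δ j f ⊞ Δ j g
  Δ-+ j f g w a = dem-+ (descent? j) (swapAt j) (λ v → f v a) (λ v → g v a) w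

  Δ-idem : ∀ j (f : X) → Δ j (Δ j f) ≈ ⊟ Δ j f
  Δ-idem j f w a = ∂-idem j (λ v → f v a) w

  Δ-braid : ∀ j (f : X) → Δ j (Δ (suc j) (Δ j f)) ≈ Δ (suc j) (Δ j (Δ (suc j) f))
  Δ-braid j f w a = ∂-braid j (λ v → f v a) w

  var-cong : ∀ i {f g : X} → f ≈ g → var i f ≈ var i g
  var-cong i f≈g w = mulX-cong i (f≈g w)

  var-+ : ∀ i (f g : X) → var i (f ⊞ g) ≈ var i f ⊞ var i g
  var-+ i f g w = mulX-+ i (f w) (g w)

  var-⊟ : ∀ i (f : X) → var i (⊟ f) ≈ ⊟ var i f
  var-⊟ i f w a with decAt i a
  ... | just b  = refl
  ... | nothing = refl

  var-comm : ∀ i k (f : X) → var i (var k f) ≈ var k (var i f)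
  var-comm i k f w = mulX-comm i k (f w)

  Δ-var : ∀ j i (f : X) → Δ j (var i f) ≈ var i (Δ j f)
  Δ-var j i f = demazure-mulX (descent? j) (swapAt j) i f

  H-cong : ∀ j i {f g : X} → f ≈ g → H j i f ≈ H j i g
  H-cong j i = hecke-cong (descent? j) (swapAt j) i

  ⊞-cong : ∀ {f f′ g g′ : X} → f ≈ f′ → g ≈ g′ → f ⊞ g ≈ f′ ⊞ g′
  ⊞-cong e e′ w a = cong₂ ℤ._+_ (e w a) (e′ w a)

  Δ-H : ∀ k j i (f : X) → Δ k (H j i f) ≈ Δ k f ⊞ var i (Δ k (Δ j f))
  Δ-H k j i f w a = trans (Δ-+ k f (var i (Δ j f)) w a)
    (cong (λ z → Δ k f w a ℤ.+ z) (Δ-var k i (Δ j f) w a))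

  var-Δ-H : ∀ l k j i (f : X) → var l (Δ k (H j i f)) ≈ var l (Δ k f) ⊞ var l (var i (Δ k (Δ j f)))
  var-Δ-H l k j i f w a = trans (var-cong l (Δ-H k j i f) w a)
    (var-+ l (Δ k f) (var i (Δ k (Δ j f))) w a)

  Δ-Δ-H : ∀ l k j i (f : X) → Δ l (Δ k (H j i f)) ≈ Δ l (Δ k f) ⊞ var i (Δ l (Δ k (Δ j f)))
  Δ-Δ-H l k j i f w a = trans (Δ-cong l (Δ-H k j i f) w a)
    (trans (Δ-+ l (Δ k f) (var i (Δ k (Δ j f))) w a)
           (cong (λ z → Δ l (Δ k f) w a ℤ.+ z) (Δ-var l i (Δ k (Δ j f)) w a)))

  Δ-⊟ : ∀ j (f : X) → Δ j (⊟ f) ≈ ⊟ Δ j f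
  Δ-⊟ j f w a with descent? j w
  ... | true  = sym (ℤP.neg-distrib-+ (f (swapAt j w) a) (ℤ.- f w a))
  ... | false = refl

  var-var-+ : ∀ i l (f g : X) → var i (var l (f ⊞ g)) ≈ var i (var l f) ⊞ var i (var l g)
  var-var-+ i l f g w a = trans (var-cong i (var-+ l f g) w a) (var-+ i (var l f) (var l g) w a)

  H-far : ∀ j k i l (f : X) → suc j < k → H j i (H k l f) ≈ H k l (H j i f)
  H-far j k i l f j<k w = hecke-comm (descent? j) (swapAt j) i (descent? k) (swapAt k) l f w
    (λ g → ∂-far j k g j<k w)

  H-comm : ∀ j x y (f : X) → H j y (H j x f) ≈ H j x (H j y f)
  H-comm j x y f w = hecke-comm (descent? j) (swapAt j) y (descent? j) (swapAt j) x f w (λ g → refl)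

  -- Right multiplication by Z = 1 + (x + y − xy) u + xy (u v − v u), with u, v the generators j, j+1.
  Z : ℕ → ℕ → ℕ → X → X
  Z j x y g = g ⊞ var x (Δ j g) ⊞ var y (Δ j g) ⊞ ⊟ var x (var y (Δ j g))
                ⊞ var x (var y (Δ (suc j) (Δ j g))) ⊞ ⊟ var x (var y (Δ j (Δ (suc j) g)))

  Z-cong : ∀ j x y {f g : X} → f ≈ g → Z j x y f ≈ Z j x y g
  Z-cong j x y e = ⊞-cong e (⊞-cong (var-cong x (Δ-cong j e)) (⊞-cong (var-cong y (Δ-cong j e))
    (⊞-cong (λ w a → cong ℤ.-_ (var-cong x (var-cong y (Δ-cong j e)) w a))
    (⊞-cong (var-cong x (var-cong y (Δ-cong (suc j) (Δ-cong j e))))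
    (λ w a → cong ℤ.-_ (var-cong x (var-cong y (Δ-cong j (Δ-cong (suc j) e))) w a))))))

  Z-comm : ∀ j x y (g : X) → Z j x y g ≈ Z j y x g
  Z-comm j x y g w a = trans
    (lemma (g w a) (var x (Δ j g) w a) (var y (Δ j g) w a) (ℤ.- var x (var y (Δ j g)) w a)
           (var x (var y (Δ (suc j) (Δ j g))) w a) (ℤ.- var x (var y (Δ j (Δ (suc j) g))) w a))
    (cong (λ z → g w a ℤ.+ (var y (Δ j g) w a ℤ.+ (var x (Δ j g) w a ℤ.+ z)))
      (cong₂ ℤ._+_ (cong ℤ.-_ (var-comm x y (Δ j g) w a))
        (cong₂ ℤ._+_ (var-comm x y (Δ (suc j) (Δ j g)) w a)
                     (cong ℤ.-_ (var-comm x y (Δ j (Δ (suc j) g)) w a)))))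
    where
    lemma : ∀ p q r s t u → p ℤ.+ (q ℤ.+ (r ℤ.+ (s ℤ.+ (t ℤ.+ u)))) ≡ p ℤ.+ (r ℤ.+ (q ℤ.+ (s ℤ.+ (t ℤ.+ u))))
    lemma = ℤS.solve-∀

  -- h_j(x) h_{j+1}(y) h_j(y) = h_{j+1}(y) Z: moving h_{j+1}(y) to the front leaves a factor symmetric in x, y.
  yangBaxter : ∀ j x y (f : X) → H j y (H (suc j) y (H j x f)) ≈ Z j x y (H (suc j) y f)
  yangBaxter j x y f w a = begin
    f w a ℤ.+ var x u w a ℤ.+ var y (Δ k (H j x f)) w a ℤ.+ var y (Δ j (H k y (H j x f))) w a
      ≡⟨ cong₂ (λ p q → f w a ℤ.+ var x u w a ℤ.+ p ℤ.+ q) left₁ left₂ ⟩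
    f w a ℤ.+ var x u w a ℤ.+ (var y v w a ℤ.+ var x (var y vu) w a)
      ℤ.+ ((var y u w a ℤ.+ ℤ.- var x (var y u) w a) ℤ.+ (var y (var y uv) w a ℤ.+ var y (var y (var x uvu)) w a))
      ≡⟨ lemma (f w a) (var x u w a) (var y u w a) (var x (var y u) w a) (var y v w a) (var x (var y vu) w a)
               (var x (var y uv) w a) (var y (var y uv) w a) (var y (var y (var x uvu)) w a) (var x (var y (var y uv)) w a) ⟩
    (f w a ℤ.+ var y v w a)
      ℤ.+ ((var x u w a ℤ.+ var x (var y uv) w a)
      ℤ.+ ((var y u w a ℤ.+ var y (var y uv) w a)
      ℤ.+ (ℤ.- (var x (var y u) w a ℤ.+ var x (var y (var y uv)) w a)
      ℤ.+ ((var x (var y vu) w a ℤ.+ var y (var y (var x uvu)) w a)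
      ℤ.+ ℤ.- (var x (var y uv) w a ℤ.+ ℤ.- var x (var y (var y uv)) w a)))))
      ≡⟨ cong (λ z → (f w a ℤ.+ var y v w a) ℤ.+ z)
          (cong₂ ℤ._+_ (sym (right₁ x w a)) (cong₂ ℤ._+_ (sym (right₁ y w a))
          (cong₂ ℤ._+_ (cong ℤ.-_ (sym right₂)) (cong₂ ℤ._+_ (sym right₃) (cong ℤ.-_ (sym right₄)))))) ⟩
    Z j x y (H k y f) w a ∎
    where
    open ≡-Reasoning
    k = suc j
    u v vu uv uvu : X
    u = Δ j f
    v = Δ k f
    vu = Δ k u
    uv = Δ j v
    uvu = Δ j (Δ k (Δ j f))
    left₁ : var y (Δ k (H j x f)) w a ≡ var y v w a ℤ.+ var x (var y vu) w a
    left₁ = trans (var-Δ-H y k j x f w a) (cong (λ z → var y v w a ℤ.+ z) (var-comm y x vu w a))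
    left₂ : var y (Δ j (H k y (H j x f))) w a ≡
            (var y u w a ℤ.+ ℤ.- var x (var y u) w a) ℤ.+ (var y (var y uv) w a ℤ.+ var y (var y (var x uvu)) w a)
    left₂ = trans (var-Δ-H y j k y (H j x f) w a) (cong₂ ℤ._+_
      (trans (var-Δ-H y j j x f w a) (cong (λ z → var y u w a ℤ.+ z)
        (trans (var-comm y x (Δ j u) w a) (trans (var-cong x (var-cong y (Δ-idem j f)) w a)
        (trans (var-cong x (var-⊟ y u) w a) (var-⊟ x (var y u) w a))))))
      (trans (var-cong y (var-cong y (Δ-Δ-H j k j x f)) w a) (var-var-+ y y uv (var x uvu) w a)))
    right₁ : ∀ i → var i (Δ j (H k y f)) ≈ var i u ⊞ var i (var y uv)
    right₁ i = var-Δ-H i j k y f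
    right₂ : var x (var y (Δ j (H k y f))) w a ≡ var x (var y u) w a ℤ.+ var x (var y (var y uv)) w a
    right₂ = trans (var-cong x (right₁ y) w a) (var-+ x (var y u) (var y (var y uv)) w a)
    right₃ : var x (var y (Δ k (Δ j (H k y f)))) w a ≡ var x (var y vu) w a ℤ.+ var y (var y (var x uvu)) w a
    right₃ = trans (var-cong x (var-cong y (Δ-Δ-H k j k y f)) w a)
      (trans (var-var-+ x y vu (var y (Δ k uv)) w a) (cong (λ z → var x (var y vu) w a ℤ.+ z)
        (trans (var-comm x y (var y (Δ k uv)) w a) (trans (var-cong y (var-comm x y (Δ k uv)) w a)
          (var-cong y (var-cong y (var-cong x (≈-sym (Δ-braid j f)))) w a)))))
    right₄ : var x (var y (Δ j (Δ k (H k y f)))) w a ≡ var x (var y uv) w a ℤ.+ ℤ.- var x (var y (var y uv)) w a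
    right₄ = trans (var-cong x (var-cong y (Δ-Δ-H j k k y f)) w a)
      (trans (var-var-+ x y uv (var y (Δ j (Δ k v))) w a) (cong (λ z → var x (var y uv) w a ℤ.+ z)
        (trans (var-cong x (var-cong y (var-cong y (Δ-cong j (Δ-idem k f)))) w a)
        (trans (var-cong x (var-cong y (var-cong y (Δ-⊟ j v))) w a)
        (trans (var-cong x (var-cong y (var-⊟ y uv)) w a)
        (trans (var-cong x (var-⊟ y (var y uv)) w a) (var-⊟ x (var y (var y uv)) w a)))))))
    lemma : ∀ F xu yu xyu yv xyvu xyuv yyuv yyxuvu xyyuv →
      F ℤ.+ xu ℤ.+ (yv ℤ.+ xyvu) ℤ.+ ((yu ℤ.+ ℤ.- xyu) ℤ.+ (yyuv ℤ.+ yyxuvu)) ≡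
      (F ℤ.+ yv) ℤ.+ ((xu ℤ.+ xyuv) ℤ.+ ((yu ℤ.+ yyuv) ℤ.+ (ℤ.- (xyu ℤ.+ xyyuv)
        ℤ.+ ((xyvu ℤ.+ yyxuvu) ℤ.+ ℤ.- (xyuv ℤ.+ ℤ.- xyyuv)))))
    lemma = ℤS.solve-∀

-- Products of generators and their symmetry

module _ {n : ℕ} where

  -- Right multiplication by A_k(x_i) = h_{k+m-1}(x_i) ⋯ h_k(x_i).
  A : ℕ → ℕ → ℕ → X {n} → X
  A k zero    i f = f
  A k (suc m) i f = H k i (A (suc k) m i f)

  -- Right multiplication by A_k(x_k) A_{k+1}(x_{k+1}) ⋯, all of them ending in h_{k+m-1}.
  B : ℕ → ℕ → X {n} → X
  B k zero    f = f
  B k (suc m) f = B (suc k) m (A k (suc m) k f)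

  A-cong : ∀ k m i {f g : X} → f ≈ g → A k m i f ≈ A k m i g
  A-cong k zero    i e = e
  A-cong k (suc m) i e = H-cong k i (A-cong (suc k) m i e)

  B-cong : ∀ k m {f g : X} → f ≈ g → B k m f ≈ B k m g
  B-cong k zero    e = e
  B-cong k (suc m) e = B-cong (suc k) m (A-cong k (suc m) k e)

  H-A-far : ∀ j k m i l (f : X) → suc j < k → H j i (A k m l f) ≈ A k m l (H j i f)
  H-A-far j k zero    i l f j<k = λ _ _ → refl
  H-A-far j k (suc m) i l f j<k = ≈-trans (H-far j k i l (A (suc k) m l f) j<k)
    (H-cong k l (H-A-far j (suc k) m i l f (ℕP.m<n⇒m<1+n j<k)))

  H-B-far : ∀ j k m i (f : X) → suc j < k → H j i (B k m f) ≈ B k m (H j i f)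
  H-B-far j k zero    i f j<k = λ _ _ → refl
  H-B-far j k (suc m) i f j<k = ≈-trans
    (H-B-far j (suc k) m i (A k (suc m) k f) (ℕP.m<n⇒m<1+n j<k))
    (B-cong (suc k) m (H-A-far j k (suc m) i k f j<k))

  -- The only obstruction to induction is the factor `H k x` between the two shorter blocks. It
  -- commutes with all of `A (suc k) (suc m) y` except `H (suc k) y`, and `yangBaxter` handles that
  -- last passage: either order becomes `Z` applied to the two shorter blocks, and `Z` is symmetric
  -- by `Z-comm`.
  A-comm : ∀ k m x y (f : X) → A k m y (A k m x f) ≈ A k m x (A k m y f)
  A-comm k zero          x y f = λ _ _ → refl
  A-comm k (suc zero)    x y f = H-comm k x y f
  A-comm k (suc (suc m)) x y f = ≈-trans (rearrange x y) (≈-trans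
      (Z-comm k x y (A (suc k) (suc m) y (A (suc k) (suc m) x f))) (≈-trans
      (Z-cong k y x (A-comm (suc k) (suc m) x y f)) (≈-sym (rearrange y x))))
    where
    rearrange : ∀ x y → A k (suc (suc m)) y (A k (suc (suc m)) x f) ≈
                        Z k x y (A (suc k) (suc m) y (A (suc k) (suc m) x f))
    rearrange x y = ≈-trans
      (H-cong k y (H-cong (suc k) y (≈-sym
        (H-A-far k (suc (suc k)) m x y (A (suc k) (suc m) x f) ≤-refl))))
      (yangBaxter k x y (A (suc (suc k)) m y (A (suc k) (suc m) x f)))

  sw : ℕ → X {n} → X
  sw j f w = swapVars j (f w)

  private
    sw-H : ∀ j k i i′ → (∀ (f : Poly n) → swapVars j (mulX i f) ≈ₚ mulX i′ (swapVars j f)) →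
           ∀ (f : X) → sw j (H k i f) ≈ H k i′ (sw j f)
    sw-H j k i i′ e f w a = cong (λ z → f w (swapAt j a) ℤ.+ z) (e (Δ k f w) a)

    sw-A : ∀ j k m i i′ → (∀ (f : Poly n) → swapVars j (mulX i f) ≈ₚ mulX i′ (swapVars j f)) →
           ∀ (f : X) → sw j (A k m i f) ≈ A k m i′ (sw j f)
    sw-A j k zero    i i′ e f = λ _ _ → refl
    sw-A j k (suc m) i i′ e f = ≈-trans (sw-H j k i i′ e (A (suc k) m i f)) (H-cong k i′ (sw-A j (suc k) m i i′ e f))

    sw-B : ∀ j k m → suc j < k → ∀ (f : X) → sw j (B k m f) ≈ B k m (sw j f)
    sw-B j k zero    j<k f = λ _ _ → refl
    sw-B j k (suc m) j<k f = ≈-trans (sw-B j (suc k) m (ℕP.m<n⇒m<1+n j<k) _)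
      (B-cong (suc k) m (sw-A j k (suc m) k k (λ p → swapVars-mulX-> j k p j<k) f))

  -- Blocks before the `j`-th involve only earlier variables and commute with the swap, and
  -- `H j (suc j)` moves past the blocks from `j+2` on. There it meets `A (suc j)` in the variable
  -- `j+1` and completes it to `A j`. The two consecutive blocks thus become `A j` in both
  -- variables, which `A-comm` makes symmetric.
  H-B-symmetric : ∀ j k m (f : X) → suc j < n → k ≤ j → j < k + m → sw j f ≈ f →
                  sw j (H j (suc j) (B k m f)) ≈ H j (suc j) (B k m f)
  H-B-symmetric j k zero    f _   k≤j j<k _ =
    ⊥-elim (ℕP.<⇒≱ (subst (j <_) (+-identityʳ k) j<k) k≤j)
  H-B-symmetric j k (suc m) f j<n k≤j j<k+m f-sym with ℕP.m≤n⇒m<n∨m≡n k≤j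
  ... | inj₁ k<j = H-B-symmetric j (suc k) m (A k (suc m) k f) j<n k<j
          (subst (j <_) (+-suc k m) j<k+m)
          (≈-trans (sw-A j k (suc m) k k (λ p → swapVars-mulX-< j k p k<j) f)
                   (A-cong k (suc m) k f-sym))
  ... | inj₂ refl = case m
    where
    sym-AA : ∀ m → sw j (A j m (suc j) (A j m j f)) ≈ A j m (suc j) (A j m j f)
    sym-AA m = ≈-trans
      (sw-A j j m (suc j) j (λ p → swapVars-mulX-right j p j<n) (A j m j f)) (≈-trans
      (A-cong j m j (≈-trans (sw-A j j m j (suc j) (λ p → swapVars-mulX-left j p j<n) f)
                             (A-cong j m (suc j) f-sym)))
      (A-comm j m (suc j) j f))
    case : ∀ m → sw j (H j (suc j) (B j (suc m) f)) ≈ H j (suc j) (B j (suc m) f)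
    -- For the last generator no block follows `A j`, and `H j (suc j)` is itself the second block.
    case zero    = sym-AA 1
    case (suc m) = ≈-trans (λ w a → push w (swapAt j a)) (≈-trans
      (sw-B j (suc (suc j)) m ≤-refl (A j (suc (suc m)) (suc j) (A j (suc (suc m)) j f))) (≈-trans
      (B-cong (suc (suc j)) m (sym-AA (suc (suc m)))) (≈-sym push)))
      where
      push : H j (suc j) (B j (suc (suc m)) f) ≈
             B (suc (suc j)) m (A j (suc (suc m)) (suc j) (A j (suc (suc m)) j f))
      push = H-B-far j (suc (suc j)) m (suc j) _ ≤-refl

-- The Fomin-Kirillov product and the divided difference recursion

upFrom : ℕ → (n : ℕ) → Vec ℕ n
upFrom c zero    = []
upFrom c (suc n) = c ∷ upFrom (suc c) n

identity : (n : ℕ) → Vec ℕ n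
identity n = upFrom 1 n

one : ∀ {n} → Poly n
one {n} = monomial (replicate n 0)

unit : ∀ {n} → X {n}
unit {n} w a = if does (VecP.≡-dec ℕ._≟_ w (identity n)) then one a else 0ℤ

-- The coefficient of w in the Fomin–Kirillov product ∏ₖ A_k(x_k) in the 0-Hecke algebra.
𝔉 : ∀ {n} → Vec ℕ n → Poly n
𝔉 {n} = B 0 (n ∸ 1) unit

swapAt-replicate : ∀ {A : Set} j n (x : A) → swapAt j (replicate n x) ≡ replicate n x
swapAt-replicate zero    zero          x = refl
swapAt-replicate zero    (suc zero)    x = refl
swapAt-replicate zero    (suc (suc n)) x = refl
swapAt-replicate (suc j) zero          x = refl
swapAt-replicate (suc j) (suc n)       x = cong (x ∷_) (swapAt-replicate j n x)

unit-symmetric : ∀ {n} j → sw j (unit {n}) ≈ unit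
unit-symmetric {n} j w a with does (VecP.≡-dec ℕ._≟_ w (identity n))
... | false = refl
... | true with VecP.≡-dec ℕ._≟_ a (replicate n 0) | VecP.≡-dec ℕ._≟_ (swapAt j a) (replicate n 0)
...   | yes _ | yes _ = refl
...   | no  _ | no  _ = refl
...   | yes p | no ¬q = ⊥-elim (¬q (trans (cong (swapAt j) p) (swapAt-replicate j n 0)))
...   | no ¬p | yes q = ⊥-elim (¬p (trans (sym (swapAt-involutive j a))
                                          (trans (cong (swapAt j) q) (swapAt-replicate j n 0))))

H-𝔉-symmetric : ∀ {n} j → suc j < n → sw j (H j (suc j) (𝔉 {n})) ≈ H j (suc j) 𝔉
H-𝔉-symmetric {suc n} j j<n = H-B-symmetric j 0 n unit j<n z≤n (ℕP.≤-pred j<n) (unit-symmetric j)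

ascent-< : ∀ {n} j (w : Vec ℕ n) → AscentAt j w → suc j < n
ascent-< zero    (a ∷ b ∷ v) _ = s≤s (s≤s z≤n)
ascent-< (suc j) (a ∷ v)     p = s≤s (ascent-< j v p)

ascent-descent? : ∀ {n} j (w : Vec ℕ n) → AscentAt j w →
                  descent? j w ≡ false × descent? j (swapAt j w) ≡ true
ascent-descent? zero    (a ∷ b ∷ v) a<b = <ᵇ-asym a b eq , eq
  where
  eq : (a ℕ.<ᵇ b) ≡ true
  eq = dec-true (a ℕ.<? b) a<b
ascent-descent? (suc j) (a ∷ v) p = ascent-descent? j v p

-- Where `w` has no descent the generator contributes zero, so `H j (suc j) 𝔉` and `𝔉` coincide at
-- `w` and share the symmetry.
𝔉-symmetric : ∀ {n} j (w : Vec ℕ n) → suc j < n → descent? j w ≡ false → swapVars j (𝔉 w) ≈ₚ 𝔉 w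
𝔉-symmetric j w j<n eq a = trans (sym (noDescent (swapAt j a)))
  (trans (H-𝔉-symmetric j j<n w a) (noDescent a))
  where
  noDescent : ∀ b → H j (suc j) 𝔉 w b ≡ 𝔉 w b
  noDescent b = trans (cong (λ z → 𝔉 w b ℤ.+ z)
      (trans (mulX-cong (suc j) (λ c → cong (λ d → if d then 𝔉 (swapAt j w) c ℤ.- 𝔉 w c else 0ℤ) eq) b) (mulX-0 (suc j) b)))
    (ℤP.+-identityʳ _)

-- Write x, y for the variables `j`, `j+1`. At `v`, which has the descent, `H j (suc j) 𝔉` is (1 -
-- y) f + y g. Equating it with its swap, where g is symmetric and f becomes f′, gives (x - y) g =
-- (1 - y) f - (1 - x) f′.
𝔉-isobaric : ∀ {n} j (w : Vec ℕ n) → AscentAt j w → IsIsobaricDivDiff j (𝔉 (swapAt j w)) (𝔉 w)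
𝔉-isobaric {n} j w asc a = rearrange (mulX j g a) (mulX (suc j) g a) (f a) (mulX (suc j) f a)
    (f (swapAt j a)) (mulX (suc j) f (swapAt j a)) (mulX (suc j) g (swapAt j a))
    (trans (sym (unfold (swapAt j a))) (trans (H-𝔉-symmetric j j<n v a) (unfold a)))
    (trans (swapVars-mulX-right j g j<n a) (mulX-cong j (𝔉-symmetric j w j<n (proj₁ dd)) a))
  where
  v = swapAt j w
  f = 𝔉 v
  g = 𝔉 w
  j<n = ascent-< j w asc
  dd = ascent-descent? j w asc
  unfold : ∀ b → H j (suc j) 𝔉 v b ≡ f b ℤ.+ (mulX (suc j) g b ℤ.- mulX (suc j) f b)
  unfold b = cong (λ z → f b ℤ.+ z) (trans
    (mulX-cong (suc j) (λ c → trans (cong (λ d → if d then 𝔉 (swapAt j v) c ℤ.- f c else 0ℤ) (proj₂ dd))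
      (cong (λ u → 𝔉 u c ℤ.- f c) (swapAt-involutive j w))) b)
    (mulX-− (suc j) g f b))
  rearrange : ∀ xg yg F yF F′ yF′ yg′ → F′ ℤ.+ (yg′ ℤ.- yF′) ≡ F ℤ.+ (yg ℤ.- yF) → yg′ ≡ xg →
              xg ℤ.- yg ≡ (F ℤ.- yF) ℤ.- (F′ ℤ.- yF′)
  rearrange xg yg F yF F′ yF′ yg′ e refl = begin
    xg ℤ.- yg                                            ≡⟨ one′ xg yg F′ yF′ ⟩
    (F′ ℤ.+ (xg ℤ.- yF′)) ℤ.- (yg ℤ.+ (F′ ℤ.- yF′))       ≡⟨ cong (λ z → z ℤ.- (yg ℤ.+ (F′ ℤ.- yF′))) e ⟩
    (F ℤ.+ (yg ℤ.- yF)) ℤ.- (yg ℤ.+ (F′ ℤ.- yF′))         ≡⟨ two′ yg F yF F′ yF′ ⟩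
    (F ℤ.- yF) ℤ.- (F′ ℤ.- yF′) ∎
    where
    open ≡-Reasoning
    one′ : ∀ xg yg F′ yF′ → xg ℤ.- yg ≡ (F′ ℤ.+ (xg ℤ.- yF′)) ℤ.- (yg ℤ.+ (F′ ℤ.- yF′))
    one′ = ℤS.solve-∀
    two′ : ∀ yg F yF F′ yF′ → (F ℤ.+ (yg ℤ.- yF)) ℤ.- (yg ℤ.+ (F′ ℤ.- yF′)) ≡ (F ℤ.- yF) ℤ.- (F′ ℤ.- yF′)
    two′ = ℤS.solve-∀

-- The difference of two variables is not a zero divisor, even on coefficient functions of infinite
-- support: the equation identifies the coefficients along each antidiagonal in the two exponents,
-- down to the one whose second exponent is 0, which must vanish.
mulX-difference-injective : ∀ {n} j (g : Poly n) → suc j < n → mulX j g ≈ₚ mulX (suc j) g → ∀ a → g a ≡ 0ℤ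
mulX-difference-injective zero g (s≤s ()) e (x ∷ [])
mulX-difference-injective zero g _ e (x ∷ y ∷ a) = go y x
  where
  go : ∀ y x → g (x ∷ y ∷ a) ≡ 0ℤ
  go zero    x = e (suc x ∷ zero ∷ a)
  go (suc y) x = trans (e (suc x ∷ suc y ∷ a)) (go y (suc x))
mulX-difference-injective (suc j) g (s≤s j<n) e (x ∷ a) =
  mulX-difference-injective j (λ b → g (x ∷ b)) j<n
    (λ b → trans (sym (mulX-suc j g x b)) (trans (e (x ∷ b)) (mulX-suc (suc j) g x b))) a

isobaric-unique : ∀ {n} j {f f′ g g′ : Poly n} → suc j < n → f ≈ₚ f′ →
                  IsIsobaricDivDiff j f g → IsIsobaricDivDiff j f′ g′ → g ≈ₚ g′
isobaric-unique j {f} {f′} {g} {g′} j<n f≈f′ e e′ a =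
  ℤP.i-j≡0⇒i≡j (g a) (g′ a) (mulX-difference-injective j (g −ₚ g′) j<n equal a)
  where
  exchange : ∀ p q r s → p ℤ.- q ≡ r ℤ.- s → p ℤ.- r ≡ q ℤ.- s
  exchange p q r s e = trans (one′ p q r) (trans (cong (λ z → (z ℤ.+ q) ℤ.- r) e) (two′ q r s))
    where
    one′ : ∀ p q r → p ℤ.- r ≡ ((p ℤ.- q) ℤ.+ q) ℤ.- r
    one′ = ℤS.solve-∀
    two′ : ∀ q r s → ((r ℤ.- s) ℤ.+ q) ℤ.- r ≡ q ℤ.- s
    two′ = ℤS.solve-∀
  1−x : ∀ b → oneMinusX (suc j) f b ≡ oneMinusX (suc j) f′ b
  1−x b = cong₂ ℤ._-_ (f≈f′ b) (mulX-cong (suc j) f≈f′ b)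
  equal : mulX j (g −ₚ g′) ≈ₚ mulX (suc j) (g −ₚ g′)
  equal b = trans (mulX-− j g g′ b) (trans
    (exchange (mulX j g b) (mulX (suc j) g b) (mulX j g′ b) (mulX (suc j) g′ b)
      (trans (e b) (trans (cong₂ ℤ._-_ (1−x b) (1−x (swapAt j b))) (sym (e′ b)))))
    (sym (mulX-− (suc j) g g′ b)))

-- The 0-Hecke action on values

swapValue : ℕ → ℕ → ℕ
swapValue p v = if does (v ℕ.≟ p) then suc p else if does (v ℕ.≟ suc p) then p else v

swapValues : ∀ {n} → ℕ → Vec ℕ n → Vec ℕ n
swapValues p = Vec.map (swapValue p)

swapValue-low : ∀ p → swapValue p p ≡ suc p
swapValue-low p rewrite dec-true (p ℕ.≟ p) refl = refl

swapValue-high : ∀ p → swapValue p (suc p) ≡ p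
swapValue-high p rewrite dec-false (suc p ℕ.≟ p) ℕP.1+n≢n | dec-true (suc p ℕ.≟ suc p) refl = refl

swapValue-other : ∀ p {v} → ¬ v ≡ p → ¬ v ≡ suc p → swapValue p v ≡ v
swapValue-other p {v} v≢p v≢sp rewrite dec-false (v ℕ.≟ p) v≢p | dec-false (v ℕ.≟ suc p) v≢sp = refl

data Classified (p v : ℕ) : Set where
  low   : v ≡ p → Classified p v
  high  : v ≡ suc p → Classified p v
  other : ¬ v ≡ p → ¬ v ≡ suc p → Classified p v

classify : ∀ p v → Classified p v
classify p v with v ℕ.≟ p | v ℕ.≟ suc p
... | yes e | _     = low e
... | no _  | yes e = high e
... | no ¬e | no ¬f = other ¬e ¬f

swapValue-involutive : ∀ p v → swapValue p (swapValue p v) ≡ v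
swapValue-involutive p v with classify p v
... | low refl    = trans (cong (swapValue p) (swapValue-low p)) (swapValue-high p)
... | high refl   = trans (cong (swapValue p) (swapValue-high p)) (swapValue-low p)
... | other ¬e ¬f = trans (cong (swapValue p) (swapValue-other p ¬e ¬f)) (swapValue-other p ¬e ¬f)

swapValues-involutive : ∀ {n} p (w : Vec ℕ n) → swapValues p (swapValues p w) ≡ w
swapValues-involutive p []      = refl
swapValues-involutive p (v ∷ w) = cong₂ _∷_ (swapValue-involutive p v) (swapValues-involutive p w)

opaque
  -- The left descent at `p`: in a permutation, exchanging the values `p` and `p+1` lowers the
  -- length exactly when `p+1` stands first.
  sucFirst : ℕ → List ℕ → Bool
  sucFirst p []       = false
  sucFirst p (v ∷ vs) =
    if does (v ℕ.≟ p) then false else if does (v ℕ.≟ suc p) then true else sucFirst p vs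

  sucFirst-[] : ∀ p → sucFirst p [] ≡ false
  sucFirst-[] p = refl

  sucFirst-low : ∀ p vs → sucFirst p (p ∷ vs) ≡ false
  sucFirst-low p vs rewrite dec-true (p ℕ.≟ p) refl = refl

  sucFirst-high : ∀ p vs → sucFirst p (suc p ∷ vs) ≡ true
  sucFirst-high p vs rewrite dec-false (suc p ℕ.≟ p) ℕP.1+n≢n | dec-true (suc p ℕ.≟ suc p) refl = refl

  sucFirst-other : ∀ p {v} vs → ¬ v ≡ p → ¬ v ≡ suc p → sucFirst p (v ∷ vs) ≡ sucFirst p vs
  sucFirst-other p {v} vs v≢p v≢sp rewrite dec-false (v ℕ.≟ p) v≢p | dec-false (v ℕ.≟ suc p) v≢sp = refl

  sucFirst-∷ : ∀ p v us vs → sucFirst p us ≡ sucFirst p vs →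
               sucFirst p (v ∷ us) ≡ sucFirst p (v ∷ vs)
  sucFirst-∷ p v us vs e with does (v ℕ.≟ p) | does (v ℕ.≟ suc p)
  ... | true  | _     = refl
  ... | false | true  = refl
  ... | false | false = e

  sucFirst-suc : ∀ p vs → sucFirst (suc p) (List.map suc vs) ≡ sucFirst p vs
  sucFirst-suc p []       = refl
  sucFirst-suc p (v ∷ vs) with does (v ℕ.≟ p) | does (v ℕ.≟ suc p)
  ... | true  | _     = refl
  ... | false | true  = refl
  ... | false | false = sucFirst-suc p vs

swapValue-suc : ∀ p v → swapValue (suc p) (suc v) ≡ suc (swapValue p v)
swapValue-suc p v with does (v ℕ.≟ p) | does (v ℕ.≟ suc p)
... | true  | _     = refl
... | false | true  = refl
... | false | false = refl

swapValues-fixed : ∀ {n} p (w : Vec ℕ n) → All (λ v → ¬ p ≡ v) (toList w) →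
                   All (λ v → ¬ suc p ≡ v) (toList w) → swapValues p w ≡ w
swapValues-fixed p []      _        _        = refl
swapValues-fixed p (v ∷ w) (a ∷ as) (b ∷ bs) =
  cong₂ _∷_ (swapValue-other p (λ e → a (sym e)) (λ e → b (sym e))) (swapValues-fixed p w as bs)

swapAt-map : ∀ {A B : Set} {n} j (f : A → B) (v : Vec A n) → swapAt j (Vec.map f v) ≡ Vec.map f (swapAt j v)
swapAt-map zero    f []          = refl
swapAt-map zero    f (x ∷ [])    = refl
swapAt-map zero    f (x ∷ y ∷ v) = refl
swapAt-map (suc j) f []          = refl
swapAt-map (suc j) f (x ∷ v)     = cong (f x ∷_) (swapAt-map j f v)

<ᵇ-suc : ∀ b p → ¬ b ≡ p → (b ℕ.<ᵇ p) ≡ (b ℕ.<ᵇ suc p)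
<ᵇ-suc zero    zero    b≢p = ⊥-elim (b≢p refl)
<ᵇ-suc zero    (suc p) b≢p = refl
<ᵇ-suc (suc b) zero    b≢p = refl
<ᵇ-suc (suc b) (suc p) b≢p = <ᵇ-suc b p (λ e → b≢p (cong suc e))

suc-<ᵇ : ∀ p a → ¬ a ≡ suc p → (p ℕ.<ᵇ a) ≡ (suc p ℕ.<ᵇ a)
suc-<ᵇ p       zero          a≢ = refl
suc-<ᵇ zero    (suc zero)    a≢ = ⊥-elim (a≢ refl)
suc-<ᵇ zero    (suc (suc a)) a≢ = refl
suc-<ᵇ (suc p) (suc a)       a≢ = suc-<ᵇ p a (λ e → a≢ (cong suc e))

n<ᵇ1+n : ∀ p → (p ℕ.<ᵇ suc p) ≡ true
n<ᵇ1+n zero    = refl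
n<ᵇ1+n (suc p) = n<ᵇ1+n p

-- Either positions j, j+1 hold the values p, p+1, or the two transpositions do not interact.
data Interaction {n} (j p : ℕ) (w : Vec ℕ n) : Set where
  apart   : sucFirst p (toList (swapAt j w)) ≡ sucFirst p (toList w) →
            descent? j (swapValues p w) ≡ descent? j w → Interaction j p w
  adjacent : p ∈ toList w → suc p ∈ toList w → swapAt j w ≡ swapValues p w →
            descent? j w ≡ sucFirst p (toList w) →
            sucFirst p (toList (swapAt j w)) ≡ not (sucFirst p (toList w)) →
            descent? j (swapValues p w) ≡ not (descent? j w) → Interaction j p w

interaction : ∀ {n} j p (w : Vec ℕ n) → Unique (toList w) → Interaction j p w
interaction zero p []          _ = apart refl refl
interaction zero p (a ∷ [])    _ = apart refl refl
interaction zero p (a ∷ b ∷ v) ((a≢b ∷ a∉) ∷ (b∉ ∷ _)) with classify p a | classify p b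
... | low refl  | low refl  = ⊥-elim (a≢b refl)
... | high refl | high refl = ⊥-elim (a≢b refl)
... | low refl  | high refl = adjacent (here refl) (there (here refl))
        (cong₂ _∷_ (sym (swapValue-low p)) (cong₂ _∷_ (sym (swapValue-high p)) (sym (swapValues-fixed p v a∉ b∉))))
        (trans (<ᵇ-asym p (suc p) (n<ᵇ1+n p)) (sym (sucFirst-low p _)))
        (trans (sucFirst-high p _) (cong not (sym (sucFirst-low p _))))
        (trans (cong₂ ℕ._<ᵇ_ (swapValue-high p) (swapValue-low p))
          (trans (n<ᵇ1+n p) (cong not (sym (<ᵇ-asym p (suc p) (n<ᵇ1+n p))))))
... | high refl | low refl  = adjacent (there (here refl)) (here refl)
        (cong₂ _∷_ (sym (swapValue-high p)) (cong₂ _∷_ (sym (swapValue-low p)) (sym (swapValues-fixed p v b∉ a∉))))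
        (trans (n<ᵇ1+n p) (sym (sucFirst-high p _)))
        (trans (sucFirst-low p _) (cong not (sym (sucFirst-high p _))))
        (trans (cong₂ ℕ._<ᵇ_ (swapValue-low p) (swapValue-high p))
          (trans (<ᵇ-asym p (suc p) (n<ᵇ1+n p)) (cong not (sym (n<ᵇ1+n p)))))
... | low refl  | other b≢p b≢sp =
        apart (trans (trans (sucFirst-other p _ b≢p b≢sp) (sucFirst-low p _)) (sym (sucFirst-low p _)))
              (trans (cong₂ ℕ._<ᵇ_ (swapValue-other p b≢p b≢sp) (swapValue-low p)) (sym (<ᵇ-suc b p b≢p)))
... | high refl | other b≢p b≢sp =
        apart (trans (trans (sucFirst-other p _ b≢p b≢sp) (sucFirst-high p _)) (sym (sucFirst-high p _)))
              (trans (cong₂ ℕ._<ᵇ_ (swapValue-other p b≢p b≢sp) (swapValue-high p)) (<ᵇ-suc b p b≢p))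
... | other a≢p a≢sp | low refl  =
        apart (trans (sucFirst-low p _) (sym (trans (sucFirst-other p _ a≢p a≢sp) (sucFirst-low p _))))
              (trans (cong₂ ℕ._<ᵇ_ (swapValue-low p) (swapValue-other p a≢p a≢sp)) (sym (suc-<ᵇ p a a≢sp)))
... | other a≢p a≢sp | high refl =
        apart (trans (sucFirst-high p _) (sym (trans (sucFirst-other p _ a≢p a≢sp) (sucFirst-high p _))))
              (trans (cong₂ ℕ._<ᵇ_ (swapValue-high p) (swapValue-other p a≢p a≢sp)) (suc-<ᵇ p a a≢sp))
... | other a≢p a≢sp | other b≢p b≢sp =
        apart (trans (trans (sucFirst-other p _ b≢p b≢sp) (sucFirst-other p _ a≢p a≢sp))
                     (sym (trans (sucFirst-other p _ a≢p a≢sp) (sucFirst-other p _ b≢p b≢sp))))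
              (cong₂ ℕ._<ᵇ_ (swapValue-other p b≢p b≢sp) (swapValue-other p a≢p a≢sp))
interaction (suc j) p []      _ = apart refl refl
interaction (suc j) p (x ∷ w) (x∉ ∷ uniq) with interaction j p w uniq
... | apart e e′ = apart (sucFirst-∷ p x (toList (swapAt j w)) (toList w) e) e′
... | adjacent p∈ sp∈ e e₁ e₂ e₃ = adjacent (there p∈) (there sp∈)
        (cong₂ _∷_ (sym (swapValue-other p x≢p x≢sp)) e)
        (trans e₁ (sym (sucFirst-other p (toList w) x≢p x≢sp)))
        (trans (sucFirst-other p (toList (swapAt j w)) x≢p x≢sp)
          (trans e₂ (cong not (sym (sucFirst-other p (toList w) x≢p x≢sp)))))
        e₃
  where
  x≢p : ¬ x ≡ p
  x≢p = All.lookup x∉ p∈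
  x≢sp : ¬ x ≡ suc p
  x≢sp = All.lookup x∉ sp∈

∂ᴸ : ∀ {n} → ℕ → (Vec ℕ n → ℤ) → Vec ℕ n → ℤ
∂ᴸ p = dem (λ w → sucFirst p (toList w)) (swapValues p)

-- If the transpositions are `apart`, neither affects the descent test of the other and the four
-- terms rearrange. If they are `adjacent`, both lead to the same word w′, where both tests are
-- reversed; either composite is then -(g w′ - g w) at a descent and 0 otherwise.
∂-∂ᴸ : ∀ {n} j p (g : Vec ℕ n → ℤ) w → Unique (toList w) → ∂ j (∂ᴸ p g) w ≡ ∂ᴸ p (∂ j g) w
∂-∂ᴸ j p g w uniq with interaction j p w uniq
... | apart e e′ rewrite e | e′ | swapAt-map j (swapValue p) w with descent? j w | sucFirst p (toList w)
...   | true  | true  = lemma (g (swapValues p (swapAt j w))) (g (swapAt j w)) (g (swapValues p w)) (g w)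
  where
  lemma : ∀ a b c d → (a ℤ.- b) ℤ.- (c ℤ.- d) ≡ (a ℤ.- c) ℤ.- (b ℤ.- d)
  lemma = ℤS.solve-∀
...   | true  | false = refl
...   | false | true  = refl
...   | false | false = refl
∂-∂ᴸ j p g w uniq | adjacent _ _ e e₁ e₂ e₃ rewrite e₂ | e₃ | e₁ with sucFirst p (toList w)
... | true  = cong (λ u → 0ℤ ℤ.- (g u ℤ.- g w)) (sym e)
... | false = refl

unique-swapAt : ∀ {n} j (w : Vec ℕ n) → Unique (toList w) → Unique (toList (swapAt j w))
unique-swapAt zero    []          u = u
unique-swapAt zero    (a ∷ [])    u = u
unique-swapAt zero    (a ∷ b ∷ v) ((a≢b ∷ a∉) ∷ (b∉ ∷ u)) = ((λ e → a≢b (sym e)) ∷ b∉) ∷ (a∉ ∷ u)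
unique-swapAt (suc j) []          u = u
unique-swapAt (suc j) (a ∷ v)     (a∉ ∷ u) = swap-All j v a∉ ∷ unique-swapAt j v u
  where
  swap-All : ∀ {P : ℕ → Set} {n} j (v : Vec ℕ n) → All P (toList v) → All P (toList (swapAt j v))
  swap-All zero    []          as           = as
  swap-All zero    (x ∷ [])    as           = as
  swap-All zero    (x ∷ y ∷ v) (a ∷ b ∷ as) = b ∷ a ∷ as
  swap-All (suc j) []          as           = as
  swap-All (suc j) (x ∷ v)     (a ∷ as)     = a ∷ swap-All j v as

unique-swapValues : ∀ {n} p (w : Vec ℕ n) → Unique (toList w) → Unique (toList (swapValues p w))
unique-swapValues p w u = subst Unique (sym (VecP.toList-map (swapValue p) w))
  (UniqueP.map⁺ (λ {x} {y} e → trans (sym (swapValue-involutive p x))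
    (trans (cong (swapValue p) e) (swapValue-involutive p y))) u)

-- `∂-∂ᴸ` assumes distinct letters, as `swapValues` changes every copy of a value, so left operators
-- are compared with right ones on such words.
infix 4 _≈ᵁ_
_≈ᵁ_ : ∀ {n} → X {n} → X → Set
f ≈ᵁ g = ∀ w → Unique (toList w) → f w ≈ₚ g w

hecke-congᵁ : ∀ {n} d s i {f g : X {n}} → (∀ w → Unique (toList w) → Unique (toList (s w))) →
              f ≈ᵁ g → hecke d s i f ≈ᵁ hecke d s i g
hecke-congᵁ d s i {f} {g} closed e w u a = cong₂ ℤ._+_ (e w u a) (mulX-cong i pointwise a)
  where
  pointwise : ∀ b → demazure d s f w b ≡ demazure d s g w b
  pointwise b with d w
  ... | true  = cong₂ ℤ._-_ (e (s w) (closed w u) b) (e w u b)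
  ... | false = refl

-- Turning right factors into left factors

Hᴸ : ∀ {n} → ℕ → ℕ → X {n} → X
Hᴸ k = hecke (λ w → sucFirst (suc k) (toList w)) (swapValues (suc k))

-- Generic products mirroring A and B, with the outermost factor applied last.
module Product {ℓ} {Y : Set ℓ} (h : ℕ → ℕ → Y → Y) where

  Aᴸ : ℕ → ℕ → ℕ → Y → Y
  Aᴸ k zero    i g = g
  Aᴸ k (suc m) i g = Aᴸ (suc k) m i (h k i g)

  Bᴸ : ℕ → ℕ → Y → Y
  Bᴸ k zero    g = g
  Bᴸ k (suc m) g = Aᴸ k (suc m) k (Bᴸ (suc k) m g)

module _ {n : ℕ} where

  open Product (Hᴸ {n})

  private
    Congruent : (X {n} → X {n}) → Set
    Congruent Λ = ∀ (f g : X) → f ≈ᵁ g → Λ f ≈ᵁ Λ g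

    Central : (X {n} → X {n}) → Set
    Central Λ = ∀ j i f → H j i (Λ f) ≈ᵁ Λ (H j i f)

    Hᴸ-cong : ∀ k i → Congruent (Hᴸ k i)
    Hᴸ-cong k i f g = hecke-congᵁ (λ w → sucFirst (suc k) (toList w)) (swapValues (suc k)) i {f} {g}
      (unique-swapValues (suc k))

    H-congᵁ : ∀ k i → Congruent (H k i)
    H-congᵁ k i f g = hecke-congᵁ (descent? k) (swapAt k) i {f} {g} (unique-swapAt k)

    Aᴸ-cong : ∀ k m i → Congruent (Aᴸ k m i)
    Aᴸ-cong k zero    i f g e = e
    Aᴸ-cong k (suc m) i f g e = Aᴸ-cong (suc k) m i (Hᴸ k i f) (Hᴸ k i g) (Hᴸ-cong k i f g e)

    transᵁ : ∀ {f} g {h : X {n}} → f ≈ᵁ g → g ≈ᵁ h → f ≈ᵁ h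
    transᵁ g e e′ w u a = trans (e w u a) (e′ w u a)

    Hᴸ-central : ∀ k i → Central (Hᴸ k i)
    Hᴸ-central k i j l f w u = hecke-comm (descent? j) (swapAt j) l
      (λ v → sucFirst (suc k) (toList v)) (swapValues (suc k)) i f w (λ g → ∂-∂ᴸ j (suc k) g w u)

    Aᴸ-central : ∀ k m i → Central (Aᴸ k m i)
    Aᴸ-central k zero    i j l f = λ _ _ _ → refl
    Aᴸ-central k (suc m) i j l f = transᵁ (Aᴸ (suc k) m i (H j l (Hᴸ k i f)))
      (Aᴸ-central (suc k) m i j l (Hᴸ k i f))
      (Aᴸ-cong (suc k) m i (H j l (Hᴸ k i f)) (Hᴸ k i (H j l f)) (Hᴸ-central k i j l f))

  upFrom-fixed : ∀ p c n → suc p < c → swapValues p (upFrom c n) ≡ upFrom c n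
  upFrom-fixed p c zero    p<c = refl
  upFrom-fixed p c (suc n) p<c = cong₂ _∷_
    (swapValue-other p (λ e → <-irrefl (sym e) (ℕP.<-trans ≤-refl p<c))
                       (λ e → <-irrefl (sym e) p<c))
    (upFrom-fixed p (suc c) n (ℕP.m<n⇒m<1+n p<c))

  sucFirst-upFrom : ∀ p c n → sucFirst p (toList (upFrom c n)) ≡ false ⊎ c ≡ suc p
  sucFirst-upFrom p c zero    = inj₁ (sucFirst-[] p)
  sucFirst-upFrom p c (suc n) with classify p c
  ... | low refl    = inj₁ (sucFirst-low c _)
  ... | high e      = inj₂ e
  ... | other c≢p c≢sp with sucFirst-upFrom p (suc c) n
  ...   | inj₁ e    = inj₁ (trans (sucFirst-other p _ c≢p c≢sp) e)
  ...   | inj₂ refl = ⊥-elim (c≢p refl)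

  private
    record Simple (k p : ℕ) {n} (u : Vec ℕ n) : Set where
      field
        swaps    : swapAt k u ≡ swapValues p u
        ascent   : descent? k u ≡ false
        descent  : descent? k (swapAt k u) ≡ true
        descentᴸ : sucFirst p (toList (swapAt k u)) ≡ true

  simple : ∀ k c n → suc k < n → Simple k (k + c) (upFrom c n)
  simple zero    c (suc zero) (s≤s ())
  simple zero    c (suc (suc n)) _ = record
    { swaps    = cong₂ _∷_ (sym (swapValue-low c)) (cong₂ _∷_ (sym (swapValue-high c))
                   (sym (upFrom-fixed c (suc (suc c)) n ≤-refl)))
    ; ascent   = <ᵇ-asym c (suc c) (n<ᵇ1+n c)
    ; descent  = n<ᵇ1+n c
    ; descentᴸ = sucFirst-high c _ }
  simple (suc k) c (suc n) (s≤s k<n) = record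
    { swaps    = cong₂ _∷_ (sym (swapValue-other p (λ e → <-irrefl e c<p)
                                                   (λ e → <-irrefl e (ℕP.m<n⇒m<1+n c<p))))
                           (subst (λ q → swapAt k u ≡ swapValues q u) eq swaps)
    ; ascent   = ascent
    ; descent  = descent
    ; descentᴸ = trans (sucFirst-other p _ (λ e → <-irrefl e c<p)
                                           (λ e → <-irrefl e (ℕP.m<n⇒m<1+n c<p)))
                       (subst (λ q → sucFirst q (toList (swapAt k u)) ≡ true) eq descentᴸ) }
    where
    open Simple (simple k (suc c) n k<n)
    u = upFrom (suc c) n
    p = suc (k + c)
    eq : k + suc c ≡ p
    eq = +-suc k c
    c<p : c < p
    c<p = s≤s (m≤n+m c k)

  -- Positions `k`, `k+1` of the identity hold the values `k+1`, `k+2`, whence the `suc k` in `Hᴸ`.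
  -- Exchanging the positions or the values gives the same word `u`, and either operator sends
  -- `unit` to the function concentrated there.
  H-unit : ∀ k i → suc k < n → H k i unit ≈ Hᴸ k i (unit {n})
  H-unit k i k<n w a = cong (λ z → unit w a ℤ.+ z) (mulX-cong i generators a)
    where
    open Simple (subst (λ q → Simple k q (identity n)) (+-comm k 1) (simple k 1 n k<n))
    p = suc k
    u = swapAt k (identity n)
    _≟ᵂ_ = VecP.≡-dec ℕ._≟_
    ascentᴸ : sucFirst p (toList (identity n)) ≡ false
    ascentᴸ with sucFirst-upFrom p 1 n
    ... | inj₁ e = e
    ... | inj₂ ()
    unit-0 : ∀ v b → ¬ v ≡ identity n → unit v b ≡ 0ℤ
    unit-0 v b v≢ rewrite dec-false (v ≟ᵂ identity n) v≢ = refl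
    true≢false : ∀ {x : Bool} → x ≡ true → x ≡ false → ⊥
    true≢false refl ()
    vanishes : ∀ d s b → (w ≡ identity n → d ≡ false) → ¬ s ≡ identity n →
               (if d then unit s b ℤ.- unit w b else 0ℤ) ≡ 0ℤ
    vanishes false s b _ _  = refl
    vanishes true  s b d s≢ = cong₂ ℤ._-_ (unit-0 s b s≢) (unit-0 w b (λ e → true≢false refl (d e)))
    generators : ∀ b → demazure (descent? k) (swapAt k) unit w b ≡
                       demazure (λ v → sucFirst p (toList v)) (swapValues p) unit w b
    generators b with w ≟ᵂ u
    ... | yes refl rewrite descent | descentᴸ | swapAt-involutive k (identity n)
          | trans (cong (swapValues p) swaps) (swapValues-involutive p (identity n)) = refl
    ... | no w≢u = trans
      (vanishes (descent? k w) (swapAt k w) b (λ e → trans (cong (descent? k) e) ascent)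
        (λ e → w≢u (trans (sym (swapAt-involutive k w)) (cong (swapAt k) e))))
      (sym (vanishes (sucFirst p (toList w)) (swapValues p w) b
        (λ e → trans (cong (λ v → sucFirst p (toList v)) e) ascentᴸ)
        (λ e → w≢u (trans (trans (sym (swapValues-involutive p w)) (cong (swapValues p) e)) (sym swaps)))))

  private
    -- `Λ` collects the left factors of earlier blocks. A right factor commutes past it and past the
    -- left factors of its own block, turns into a left factor on reaching `unit`, and so lands
    -- innermost. This reverses the order of the factors, in the way `Product` is set up.
    A-unit : ∀ Λ → Congruent Λ → Central Λ → ∀ k m i → k + m < n → A k m i (Λ unit) ≈ᵁ Λ (Aᴸ k m i unit)
    A-unit Λ Λ-cong Λ-central k zero    i _     = λ _ _ _ → refl
    A-unit Λ Λ-cong Λ-central k (suc m) i k+m<n =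
      transᵁ (H k i (Λ g)) (H-congᵁ k i (A (suc k) m i (Λ unit)) (Λ g)
        (A-unit Λ Λ-cong Λ-central (suc k) m i (subst (_< n) (+-suc k m) k+m<n)))
      (transᵁ (Λ (H k i g)) (Λ-central k i g)
        (Λ-cong (H k i g) (Aᴸ k (suc m) i unit) (transᵁ (Aᴸ (suc k) m i (H k i unit))
          (Aᴸ-central (suc k) m i k i unit)
          (Aᴸ-cong (suc k) m i (H k i unit) (Hᴸ k i unit) (λ w _ → H-unit k i k<n w)))))
      where
      g = Aᴸ (suc k) m i unit
      k<n : suc k < n
      k<n = ≤-trans (s≤s (subst (suc k ≤_) (sym (+-suc k m)) (s≤s (m≤m+n k m)))) k+m<n

    A-congᵁ : ∀ k m i → Congruent (A k m i)
    A-congᵁ k zero    i f g e = e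
    A-congᵁ k (suc m) i f g e = H-congᵁ k i (A (suc k) m i f) (A (suc k) m i g) (A-congᵁ (suc k) m i f g e)

    B-congᵁ : ∀ k m → Congruent (B k m)
    B-congᵁ k zero    f g e = e
    B-congᵁ k (suc m) f g e =
      B-congᵁ (suc k) m (A k (suc m) k f) (A k (suc m) k g) (A-congᵁ k (suc m) k f g e)

  -- Generalised over `Λ`, since each converted block joins the left factors that later blocks have
  -- to pass.
  B-unit : ∀ Λ → Congruent Λ → Central Λ → ∀ k m → k + m < n → B k m (Λ unit) ≈ᵁ Λ (Bᴸ k m unit)
  B-unit Λ Λ-cong Λ-central k zero    _     = λ _ _ _ → refl
  B-unit Λ Λ-cong Λ-central k (suc m) k+m<n =
    transᵁ (B (suc k) m (Λ (Aᴸ k (suc m) k unit)))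
      (B-congᵁ (suc k) m (A k (suc m) k (Λ unit)) (Λ (Aᴸ k (suc m) k unit))
        (A-unit Λ Λ-cong Λ-central k (suc m) k k+m<n))
      (B-unit (Λ ∘ Aᴸ k (suc m) k)
        (λ f g e → Λ-cong (Aᴸ k (suc m) k f) (Aᴸ k (suc m) k g) (Aᴸ-cong k (suc m) k f g e))
        (λ j i f → transᵁ (Λ (H j i (Aᴸ k (suc m) k f))) (Λ-central j i (Aᴸ k (suc m) k f))
          (Λ-cong (H j i (Aᴸ k (suc m) k f)) (Aᴸ k (suc m) k (H j i f)) (Aᴸ-central k (suc m) k j i f)))
        (suc k) m (subst (_< n) (+-suc k m) k+m<n))

-- Right multiplication by generators starting from the unit is left multiplication.
𝔉-left : ∀ {n} → 𝔉 ≈ᵁ Product.Bᴸ (Hᴸ {suc n}) 0 n unit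
𝔉-left {n} = B-unit (λ f → f) (λ _ _ e → e) (λ _ _ _ _ _ _ → refl) 0 n ≤-refl

-- The longest permutation

Aᴸ-snoc : ∀ {Y : Set} (h : ℕ → ℕ → Y → Y) k m i g → let open Product h in
          Aᴸ k (suc m) i g ≡ h (k + m) i (Aᴸ k m i g)
Aᴸ-snoc h k zero    i g = cong (λ j → h j i g) (sym (+-identityʳ k))
Aᴸ-snoc h k (suc m) i g = trans (Aᴸ-snoc h (suc k) m i (h k i g))
  (cong (λ j → h j i (Product.Aᴸ h k (suc m) i g)) (sym (+-suc k m)))

map-suc-upFrom : ∀ c n → Vec.map suc (upFrom c n) ≡ upFrom (suc c) n
map-suc-upFrom c zero    = refl
map-suc-upFrom c (suc n) = cong (suc c ∷_) (map-suc-upFrom (suc c) n)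

map-suc-injective : ∀ {n} {v w : Vec ℕ n} → Vec.map suc v ≡ Vec.map suc w → v ≡ w
map-suc-injective {v = []}    {[]}    _ = refl
map-suc-injective {v = x ∷ v} {y ∷ w} e = cong₂ _∷_
  (ℕP.suc-injective (VecP.∷-injectiveˡ e)) (map-suc-injective (VecP.∷-injectiveʳ e))

-- Left factors of positive index and positive variable neither move a leading 1 nor introduce the
-- first variable. On words that begin with 1 they therefore repeat the product of one size less.
record Lifts {n} (g : X {suc n}) (g′ : X {n}) : Set where
  field
    at-zero : ∀ v α → g (1 ∷ Vec.map suc v) (zero ∷ α) ≡ g′ v α
    at-suc  : ∀ v a α → g (1 ∷ Vec.map suc v) (suc a ∷ α) ≡ 0ℤ
open Lifts

swapValue-> : ∀ p h → suc p < h → swapValue p h ≡ h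
swapValue-> p h sp<h = swapValue-other p
  (λ e → <-irrefl (sym e) (ℕP.<-trans ≤-refl sp<h)) (λ e → <-irrefl (sym e) sp<h)

-- The composite of the transpositions in one block: it sends `m+1` to 1 and raises each of 1, ...,
-- `m` by one.
cycle : ℕ → ℕ → ℕ
cycle zero    x = x
cycle (suc m) x = cycle m (swapValue (suc m) x)

cycle-> : ∀ m x → suc m < x → cycle m x ≡ x
cycle-> zero    x _  = refl
cycle-> (suc m) x lt = trans (cong (cycle m) (swapValue-> (suc m) x lt)) (cycle-> m x (ℕP.<-trans ≤-refl lt))

cycle-≤ : ∀ m x → x < m → cycle m (suc x) ≡ 2 + x
cycle-≤ (suc m) x (s≤s x≤m) with ℕP.m≤n⇒m<n∨m≡n x≤m
... | inj₂ refl = trans (cong (cycle x) (swapValue-low (suc x))) (cycle-> x (2 + x) ≤-refl)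
... | inj₁ x<m  = trans (cong (cycle m) (swapValue-other (suc m)
                    (λ e → <-irrefl (ℕP.suc-injective e) x<m)
                    (λ e → <-irrefl (ℕP.suc-injective e) (ℕP.m<n⇒m<1+n x<m))))
                  (cycle-≤ m x x<m)

cycle-w₀ : ∀ m k → k ≤ m → Vec.map (cycle m) (w₀ k) ≡ Vec.map suc (w₀ k)
cycle-w₀ m zero    _   = refl
cycle-w₀ m (suc k) k<m = cong₂ _∷_ (cycle-≤ m k k<m) (cycle-w₀ m k (ℕP.<⇒≤ k<m))

module _ {n : ℕ} where

  private
    module P = Product {Y = X {suc n}} Hᴸ
    module Q = Product {Y = X {n}} Hᴸ

  Hᴸ-lifts : ∀ k i {g} {g′ : X {n}} → Lifts g g′ → Lifts (Hᴸ (suc k) (suc i) g) (Hᴸ k i g′)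
  Hᴸ-lifts k i {g} {g′} l = record
    { at-zero = λ v α → cong₂ ℤ._+_ (at-zero l v α)
        (trans (mulX-suc i _ zero α) (mulX-cong i (λ b → trans (generator v (zero ∷ b)) (zero-case v b)) α))
    ; at-suc  = λ v a α → cong₂ ℤ._+_ (at-suc l v a α)
        (trans (mulX-suc i _ (suc a) α)
          (trans (mulX-cong i (λ b → trans (generator v (suc a ∷ b)) (suc-case v a b)) α) (mulX-0 i α))) }
    where
    generator : ∀ v b →
      demazure (λ w → sucFirst (2 + k) (toList w)) (swapValues (2 + k)) g (1 ∷ Vec.map suc v) b ≡
      (if sucFirst (suc k) (toList v) then
         g (1 ∷ Vec.map suc (swapValues (suc k) v)) b ℤ.- g (1 ∷ Vec.map suc v) b else 0ℤ)
    generator v b = cong₂ (λ d w → if d then g w b ℤ.- g (1 ∷ Vec.map suc v) b else 0ℤ)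
      (trans (sucFirst-other (2 + k) _ (λ ()) (λ ()))
        (trans (cong (sucFirst (2 + k)) (VecP.toList-map suc v)) (sucFirst-suc (suc k) (toList v))))
      (cong₂ _∷_ (swapValue-other (2 + k) (λ ()) (λ ()))
        (trans (sym (VecP.map-∘ _ _ v)) (trans (VecP.map-cong (swapValue-suc (suc k)) v) (VecP.map-∘ _ _ v))))
    zero-case : ∀ v b → (if sucFirst (suc k) (toList v) then
         g (1 ∷ Vec.map suc (swapValues (suc k) v)) (zero ∷ b) ℤ.- g (1 ∷ Vec.map suc v) (zero ∷ b) else 0ℤ) ≡
      demazure (λ w → sucFirst (suc k) (toList w)) (swapValues (suc k)) g′ v b
    zero-case v b = cong₂ (λ x y → if sucFirst (suc k) (toList v) then x ℤ.- y else 0ℤ)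
      (at-zero l (swapValues (suc k) v) b) (at-zero l v b)
    suc-case : ∀ v a b → (if sucFirst (suc k) (toList v) then
         g (1 ∷ Vec.map suc (swapValues (suc k) v)) (suc a ∷ b) ℤ.- g (1 ∷ Vec.map suc v) (suc a ∷ b) else 0ℤ) ≡ 0ℤ
    suc-case v a b with sucFirst (suc k) (toList v)
    ... | true  = cong₂ ℤ._-_ (at-suc l (swapValues (suc k) v) a b) (at-suc l v a b)
    ... | false = refl

  unit-lifts : Lifts (unit {suc n}) (unit {n})
  unit-lifts = record { at-zero = at-zero′ ; at-suc = at-suc′ }
    where
    at-zero′ : ∀ v α → unit (1 ∷ Vec.map suc v) (zero ∷ α) ≡ unit v α
    at-zero′ v α with VecP.≡-dec ℕ._≟_ v (identity n)
    ... | yes refl rewrite dec-true (VecP.≡-dec ℕ._≟_ (Vec.map suc (upFrom 1 n)) (upFrom 2 n)) (map-suc-upFrom 1 n)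
        = refl
    ... | no v≢ rewrite dec-false (VecP.≡-dec ℕ._≟_ (Vec.map suc v) (upFrom 2 n))
            (λ e → v≢ (map-suc-injective (trans e (sym (map-suc-upFrom 1 n))))) = refl
    at-suc′ : ∀ v a α → unit (1 ∷ Vec.map suc v) (suc a ∷ α) ≡ 0ℤ
    at-suc′ v a α with does (VecP.≡-dec ℕ._≟_ (1 ∷ Vec.map suc v) (identity (suc n)))
    ... | true  = refl
    ... | false = refl

  Aᴸ-lifts : ∀ k m i {g} {g′ : X {n}} → Lifts g g′ → Lifts (P.Aᴸ (suc k) m (suc i) g) (Q.Aᴸ k m i g′)
  Aᴸ-lifts k zero    i l = l
  Aᴸ-lifts k (suc m) i l = Aᴸ-lifts (suc k) m i (Hᴸ-lifts k i l)

  Bᴸ-lifts : ∀ k m → Lifts (P.Bᴸ (suc k) m unit) (Q.Bᴸ k m unit)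
  Bᴸ-lifts k zero    = unit-lifts
  Bᴸ-lifts k (suc m) = Aᴸ-lifts k (suc m) k (Bᴸ-lifts (suc k) m)

  Vanishes : ℕ → X {suc n} → Set
  Vanishes c g = ∀ h v a → c < h → g (h ∷ v) a ≡ 0ℤ

  Hᴸ-vanishes : ∀ c k i g → (∀ h → c < h → c < swapValue (suc k) h) → Vanishes c g → Vanishes c (Hᴸ k i g)
  Hᴸ-vanishes c k i g closed z h v a c<h = cong₂ ℤ._+_ (z h v a c<h)
    (trans (mulX-cong i pointwise a) (mulX-0 i a))
    where
    pointwise : ∀ b → demazure (λ w → sucFirst (suc k) (toList w)) (swapValues (suc k)) g (h ∷ v) b ≡ 0ℤ
    pointwise b with sucFirst (suc k) (toList (h ∷ v))
    ... | true  = cong₂ ℤ._-_ (z (swapValue (suc k) h) (swapValues (suc k) v) b (closed h c<h)) (z h v b c<h)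
    ... | false = refl

  unit-vanishes : Vanishes 1 unit
  unit-vanishes h v a 1<h rewrite dec-false (VecP.≡-dec ℕ._≟_ (h ∷ v) (identity (suc n)))
    (λ e → <-irrefl (sym (VecP.∷-injectiveˡ e)) 1<h) = refl

  swapValue->1 : ∀ k h → 1 < h → 1 < swapValue (2 + k) h
  swapValue->1 k h 1<h with classify (2 + k) h
  ... | low refl    = subst (1 <_) (sym (swapValue-low h)) (s≤s (s≤s z≤n))
  ... | high refl   = subst (1 <_) (sym (swapValue-high (2 + k))) (s≤s (s≤s z≤n))
  ... | other h≢ h≢′ = subst (1 <_) (sym (swapValue-other (2 + k) h≢ h≢′)) 1<h

  Aᴸ-vanishes : ∀ k m i g → Vanishes 1 g → Vanishes 1 (P.Aᴸ (suc k) m i g)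
  Aᴸ-vanishes k zero    i g z = z
  Aᴸ-vanishes k (suc m) i g z =
    Aᴸ-vanishes (suc k) m i (Hᴸ (suc k) i g) (Hᴸ-vanishes 1 (suc k) i g (swapValue->1 k) z)

  Bᴸ-vanishes : ∀ k m → Vanishes 1 (P.Bᴸ (suc k) m unit)
  Bᴸ-vanishes k zero    = unit-vanishes
  Bᴸ-vanishes k (suc m) = Aᴸ-vanishes k (suc m) (suc k) (P.Bᴸ (2 + k) m unit) (Bᴸ-vanishes (suc k) m)

  -- The `m` factors can carry a leading 1 no further than to `m+1`.
  block-vanishes : ∀ m g → Vanishes 1 g → Vanishes (suc m) (P.Aᴸ 0 m 0 g)
  block-vanishes zero    g z = z
  block-vanishes (suc m) g z rewrite Aᴸ-snoc (Hᴸ {suc n}) 0 m 0 g =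
    Hᴸ-vanishes (2 + m) m 0 (P.Aᴸ 0 m 0 g) (λ h lt → subst (2 + m <_) (sym (swapValue-> (suc m) h lt)) lt)
      (λ h v a lt → block-vanishes m g z h v a (ℕP.<-trans ≤-refl lt))

  x₀^ : ℕ → Poly (suc n) → Poly (suc n)
  x₀^ zero    f = f
  x₀^ (suc m) f = mulX 0 (x₀^ m f)

  x₀^-cong : ∀ m {f g : Poly (suc n)} → f ≈ₚ g → x₀^ m f ≈ₚ x₀^ m g
  x₀^-cong zero    e = e
  x₀^-cong (suc m) e = mulX-cong 0 (x₀^-cong m e)

  -- To reach `m+1`, the head must be moved by every one of the `m` factors, each at the price of
  -- one `x₀`. All competing terms have a head too large for the shorter block and vanish by
  -- `block-vanishes`.
  block-value : ∀ m g → Vanishes 1 g → ∀ v →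
                P.Aᴸ 0 m 0 g (suc m ∷ v) ≈ₚ x₀^ m (g (1 ∷ Vec.map (cycle m) v))
  block-value zero    g z v a = cong (λ u → g (1 ∷ u) a) (sym (VecP.map-id v))
  block-value (suc m) g z v a rewrite Aᴸ-snoc (Hᴸ {suc n}) 0 m 0 g =
    trans (cong₂ ℤ._+_ (block-vanishes m g z (2 + m) v a ≤-refl) (mulX-cong 0 pointwise a))
          (ℤP.+-identityˡ _)
    where
    pointwise : ∀ b →
      demazure (λ w → sucFirst (suc m) (toList w)) (swapValues (suc m)) (P.Aᴸ 0 m 0 g) (2 + m ∷ v) b ≡
      x₀^ m (g (1 ∷ Vec.map (cycle (suc m)) v)) b
    pointwise b rewrite sucFirst-high (suc m) (toList v) | swapValue-high (suc m) =
      trans (cong (λ y → P.Aᴸ 0 m 0 g (suc m ∷ swapValues (suc m) v) b ℤ.- y)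
                  (block-vanishes m g z (2 + m) v b ≤-refl))
      (trans (ℤP.+-identityʳ _) (trans (block-value m g z (swapValues (suc m) v) b)
        (x₀^-cong m (λ c → cong (λ u → g (1 ∷ u) c) (sym (VecP.map-∘ _ _ v))) b)))

  x₀^-monomial : ∀ m (f : Poly (suc n)) (γ : Mono n) →
                 (∀ α → f (zero ∷ α) ≡ monomial γ α) → (∀ a α → f (suc a ∷ α) ≡ 0ℤ) →
                 x₀^ m f ≈ₚ monomial (m ∷ γ)
  x₀^-monomial zero    f γ e z (zero ∷ α)  = e α
  x₀^-monomial zero    f γ e z (suc a ∷ α) = z a α
  x₀^-monomial (suc m) f γ e z (zero ∷ α)  = refl
  x₀^-monomial (suc m) f γ e z (suc a ∷ α) = x₀^-monomial m f γ e z (a ∷ α)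

-- The first block yields the power of `x₀` and cycles the remaining entries into the shorter
-- longest permutation raised by one. By `Lifts` the rest of the product involves no `x₀` there, so
-- the recursion is that of `δ`.
Bᴸ-w₀ : ∀ n → Product.Bᴸ (Hᴸ {suc n}) 0 n unit (w₀ (suc n)) ≈ₚ monomial (δ (suc n))
Bᴸ-w₀ zero    (zero ∷ [])  = refl
Bᴸ-w₀ zero    (suc a ∷ []) = refl
Bᴸ-w₀ (suc n) a = trans (block-value (suc n) g (Bᴸ-vanishes 0 n) (w₀ (suc n)) a)
  (trans (x₀^-cong (suc n) (λ b → cong (λ u → g (1 ∷ u) b) (cycle-w₀ (suc n) (suc n) ≤-refl)) a)
  (x₀^-monomial (suc n) (g (1 ∷ Vec.map suc (w₀ (suc n)))) (δ (suc n))
    (λ α → trans (at-zero (Bᴸ-lifts 0 n) (w₀ (suc n)) α) (Bᴸ-w₀ n α))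
    (λ b α → at-suc (Bᴸ-lifts 0 n) (w₀ (suc n)) b α) a))
  where
  g : X {2 + n}
  g = Product.Bᴸ Hᴸ 1 n unit

w₀-bounded : ∀ m n → n < m → All (λ v → ¬ m ≡ v) (toList (w₀ n))
w₀-bounded m zero    _   = []
w₀-bounded m (suc n) n<m = (λ e → <-irrefl (sym e) n<m) ∷ w₀-bounded m n (ℕP.<-trans ≤-refl n<m)

w₀-unique : ∀ n → Unique (toList (w₀ n))
w₀-unique zero    = []
w₀-unique (suc n) = w₀-bounded (suc n) n ≤-refl ∷ w₀-unique n

-- A derivation may choose any ascents: `𝔉` satisfies the recursion at all of them, and uniqueness
-- of the quotient forces agreement at each.
grothendieck-𝔉 : ∀ {n w f} → Grothendieck n w f → f ≈ₚ 𝔉 w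
grothendieck-𝔉 {zero}  top []  = refl
grothendieck-𝔉 {suc n} top a  =
  sym (trans (𝔉-left (w₀ (suc n)) (w₀-unique (suc n)) a) (Bᴸ-w₀ n a))
grothendieck-𝔉 {w = w} (step j asc G div) =
  isobaric-unique j (ascent-< j w asc) (grothendieck-𝔉 G) div (𝔉-isobaric j w asc)

-- Grassmannian permutations as 0-1 words

ones zeros word : ∀ {n} → ℕ → Vec Bool n → List ℕ
ones k []          = []
ones k (true ∷ β)  = k ∷ ones (suc k) β
ones k (false ∷ β) = ones (suc k) β
zeros k []          = []
zeros k (true ∷ β)  = zeros (suc k) β
zeros k (false ∷ β) = k ∷ zeros (suc k) β
-- Value v is a letter of the first increasing run iff its bit is set.
word k β = ones k β List.++ zeros k β

rise? : ∀ {n} → ℕ → Vec Bool n → Bool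
rise? zero    (false ∷ true ∷ β) = true
rise? zero    _                  = false
rise? (suc i) []                 = false
rise? (suc i) (b ∷ β)            = rise? i β

ones-≥ : ∀ {n} k (β : Vec Bool n) → All (k ≤_) (ones k β)
ones-≥ k []          = []
ones-≥ k (true ∷ β)  = ≤-refl ∷ All.map ℕP.<⇒≤ (ones-≥ (suc k) β)
ones-≥ k (false ∷ β) = All.map ℕP.<⇒≤ (ones-≥ (suc k) β)

zeros-≥ : ∀ {n} k (β : Vec Bool n) → All (k ≤_) (zeros k β)
zeros-≥ k []          = []
zeros-≥ k (true ∷ β)  = All.map ℕP.<⇒≤ (zeros-≥ (suc k) β)
zeros-≥ k (false ∷ β) = ≤-refl ∷ All.map ℕP.<⇒≤ (zeros-≥ (suc k) β)

sucFirst-skip : ∀ p vs us → All (suc p <_) vs → sucFirst p (vs List.++ us) ≡ sucFirst p us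
sucFirst-skip p []       us []       = refl
sucFirst-skip p (v ∷ vs) us (h ∷ hs) = trans
  (sucFirst-other p (vs List.++ us) (λ e → <-irrefl (sym e) (ℕP.<-trans ≤-refl h))
                                    (λ e → <-irrefl (sym e) h))
  (sucFirst-skip p vs us hs)

sucFirst-insert : ∀ p {k} vs us → k < p → sucFirst p (vs List.++ k ∷ us) ≡ sucFirst p (vs List.++ us)
sucFirst-insert p []       us k<p = sucFirst-other p us (λ e → <-irrefl e k<p)
                                                             (λ e → <-irrefl e (ℕP.m<n⇒m<1+n k<p))
sucFirst-insert p {k} (v ∷ vs) us k<p =
  sucFirst-∷ p v (vs List.++ k ∷ us) (vs List.++ us) (sucFirst-insert p vs us k<p)

map-swapValue-fixed : ∀ p vs → All (suc p <_) vs → List.map (swapValue p) vs ≡ vs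
map-swapValue-fixed p []       []       = refl
map-swapValue-fixed p (v ∷ vs) (h ∷ hs) = cong₂ List._∷_ (swapValue-> p v h) (map-swapValue-fixed p vs hs)

-- Both runs increase, so for p = i + k the value p+1 precedes p only if p+1 lies in the first run
-- and p in the second, that is, if bits `i`, `i+1` read 0, 1.
sucFirst-word : ∀ {n} i k (β : Vec Bool n) → sucFirst (i + k) (word k β) ≡ rise? i β
sucFirst-word zero    k []                  = sucFirst-[] k
sucFirst-word zero    k (true ∷ β)          = sucFirst-low k _
sucFirst-word zero    k (false ∷ [])        = sucFirst-low k _
sucFirst-word zero    k (false ∷ true ∷ β)  = sucFirst-high k _
sucFirst-word zero    k (false ∷ false ∷ β) =
  trans (sucFirst-skip k (ones (2 + k) β) _ (ones-≥ (2 + k) β)) (sucFirst-low k _)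
sucFirst-word (suc i) k []          = sucFirst-[] _
sucFirst-word (suc i) k (true ∷ β)  = trans
  (sucFirst-insert (suc (i + k)) [] (word (suc k) β) (s≤s (m≤n+m k i)))
  (trans (cong (λ p → sucFirst p (word (suc k) β)) (sym (+-suc i k))) (sucFirst-word i (suc k) β))
sucFirst-word (suc i) k (false ∷ β) = trans
  (sucFirst-insert (suc (i + k)) (ones (suc k) β) (zeros (suc k) β) (s≤s (m≤n+m k i)))
  (trans (cong (λ p → sucFirst p (word (suc k) β)) (sym (+-suc i k))) (sucFirst-word i (suc k) β))

swapValue-< : ∀ p k → k < p → swapValue p k ≡ k
swapValue-< p k k<p = swapValue-other p (λ e → <-irrefl e k<p) (λ e → <-irrefl e (ℕP.m<n⇒m<1+n k<p))

map-swapValue-ones : ∀ {n} i k (β : Vec Bool n) → rise? i β ≡ true →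
                     List.map (swapValue (i + k)) (ones k β) ≡ ones k (swapAt i β)
map-swapValue-ones zero k (false ∷ true ∷ β) _ =
  cong₂ List._∷_ (swapValue-high k) (map-swapValue-fixed k _ (ones-≥ (2 + k) β))
map-swapValue-ones (suc i) k (true ∷ β) e = cong₂ List._∷_ (swapValue-< (suc (i + k)) k (s≤s (m≤n+m k i)))
  (trans (cong (λ p → List.map (swapValue p) (ones (suc k) β)) (sym (+-suc i k)))
         (map-swapValue-ones i (suc k) β e))
map-swapValue-ones (suc i) k (false ∷ β) e =
  trans (cong (λ p → List.map (swapValue p) (ones (suc k) β)) (sym (+-suc i k)))
        (map-swapValue-ones i (suc k) β e)

map-swapValue-zeros : ∀ {n} i k (β : Vec Bool n) → rise? i β ≡ true →
                      List.map (swapValue (i + k)) (zeros k β) ≡ zeros k (swapAt i β)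
map-swapValue-zeros zero k (false ∷ true ∷ β) _ =
  cong₂ List._∷_ (swapValue-low k) (map-swapValue-fixed k _ (zeros-≥ (2 + k) β))
map-swapValue-zeros (suc i) k (false ∷ β) e = cong₂ List._∷_ (swapValue-< (suc (i + k)) k (s≤s (m≤n+m k i)))
  (trans (cong (λ p → List.map (swapValue p) (zeros (suc k) β)) (sym (+-suc i k)))
         (map-swapValue-zeros i (suc k) β e))
map-swapValue-zeros (suc i) k (true ∷ β) e =
  trans (cong (λ p → List.map (swapValue p) (zeros (suc k) β)) (sym (+-suc i k)))
        (map-swapValue-zeros i (suc k) β e)

none? sorted? : ∀ {n} → Vec Bool n → Bool
none? []          = true
none? (true ∷ β)  = false
none? (false ∷ β) = none? β
sorted? []          = true
sorted? (true ∷ β)  = sorted? β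
sorted? (false ∷ β) = none? β

none-ones : ∀ {n} k (β : Vec Bool n) → none? β ≡ true → ones k β ≡ []
none-ones k []          _ = refl
none-ones k (false ∷ β) e = none-ones (suc k) β e

none-zeros : ∀ {n} k (β : Vec Bool n) → none? β ≡ true → zeros k β ≡ toList (upFrom k n)
none-zeros k []          _ = refl
none-zeros k (false ∷ β) e = cong (k ∷_) (none-zeros (suc k) β e)

sorted-word : ∀ {n} k (β : Vec Bool n) → sorted? β ≡ true → word k β ≡ toList (upFrom k n)
sorted-word k []          _ = refl
sorted-word k (true ∷ β)  e = cong (k ∷_) (sorted-word (suc k) β e)
sorted-word k (false ∷ β) e rewrite none-ones (suc k) β e = cong (k ∷_) (none-zeros (suc k) β e)

ones-[] : ∀ {n} k (β : Vec Bool n) → ones k β ≡ [] → none? β ≡ true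
ones-[] k []          _ = refl
ones-[] k (false ∷ β) e = ones-[] (suc k) β e

word-sorted : ∀ {n} k (β : Vec Bool n) → word k β ≡ toList (upFrom k n) → sorted? β ≡ true
word-sorted k []          _ = refl
word-sorted k (true ∷ β)  e = word-sorted (suc k) β (ListP.∷-injectiveʳ e)
word-sorted k (false ∷ β) e with ones (suc k) β in eq | ones-≥ (suc k) β
... | []     | _       = ones-[] (suc k) β eq
... | v ∷ vs | k<v ∷ _ = ⊥-elim (<-irrefl (sym (ListP.∷-injectiveˡ e)) k<v)

-- Restricting the left action to 0-1 words

Xᴮ : ℕ → Set
Xᴮ n = Family (Vec Bool n) n

Hᴮ : ∀ {n} → ℕ → ℕ → Xᴮ n → Xᴮ n
Hᴮ k = hecke (rise? k) (swapAt k)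

-- The identity is `word 1 β` for every sorted `β`, whatever the number of its ones, so all of these
-- carry the value `one`.
unitᴮ : ∀ {n} → Xᴮ n
unitᴮ β a = if sorted? β then one a else 0ℤ

𝔉ᴮ : ∀ {n} → Vec Bool (suc n) → Poly (suc n)
𝔉ᴮ {n} = Product.Bᴸ Hᴮ 0 n unitᴮ

toList-injective : ∀ {n} (v w : Vec ℕ n) → toList v ≡ toList w → v ≡ w
toList-injective []      []      _ = refl
toList-injective (x ∷ v) (y ∷ w) e = cong₂ _∷_ (ListP.∷-injectiveˡ e) (toList-injective v w (ListP.∷-injectiveʳ e))

module _ {n : ℕ} where

  -- The left action does not leave the words `word 1 β`: at a rise it exchanges two bits, and
  -- elsewhere its operator gives 0.
  Restricts : X {n} → Xᴮ n → Set
  Restricts g g′ = ∀ w β → toList w ≡ word 1 β → g w ≈ₚ g′ β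

  Hᴸ-restricts : ∀ k i g g′ → Restricts g g′ → Restricts (Hᴸ k i g) (Hᴮ k i g′)
  Hᴸ-restricts k i g g′ r w β e a = cong₂ ℤ._+_ (r w β e a) (mulX-cong i pointwise a)
    where
    rise : sucFirst (suc k) (toList w) ≡ rise? k β
    rise = trans (cong₂ sucFirst (sym (+-comm k 1)) e) (sucFirst-word k 1 β)
    swapped : rise? k β ≡ true → toList (swapValues (suc k) w) ≡ word 1 (swapAt k β)
    swapped t = trans (VecP.toList-map (swapValue (suc k)) w)
      (trans (cong₂ (λ p → List.map (swapValue p)) (sym (+-comm k 1)) e)
      (trans (ListP.map-++ (swapValue (k + 1)) (ones 1 β) (zeros 1 β))
             (cong₂ List._++_ (map-swapValue-ones k 1 β t) (map-swapValue-zeros k 1 β t))))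
    pointwise : ∀ b → demazure (λ v → sucFirst (suc k) (toList v)) (swapValues (suc k)) g w b ≡
                      demazure (rise? k) (swapAt k) g′ β b
    pointwise b rewrite rise with rise? k β in eq
    ... | true  = cong₂ ℤ._-_ (r (swapValues (suc k) w) (swapAt k β) (swapped eq) b) (r w β e b)
    ... | false = refl

  unit-restricts : Restricts unit unitᴮ
  unit-restricts w β e a with VecP.≡-dec ℕ._≟_ w (identity n)
  ... | yes refl rewrite word-sorted 1 β (sym e) = refl
  ... | no w≢ with sorted? β in eq
  ...   | true  = ⊥-elim (w≢ (toList-injective w (identity n) (trans e (sorted-word 1 β eq))))
  ...   | false = refl

  private
    module P = Product {Y = X {n}} Hᴸ
    module Q = Product {Y = Xᴮ n} Hᴮ

  Aᴸ-restricts : ∀ k m i g g′ → Restricts g g′ → Restricts (P.Aᴸ k m i g) (Q.Aᴸ k m i g′)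
  Aᴸ-restricts k zero    i g g′ r = r
  Aᴸ-restricts k (suc m) i g g′ r =
    Aᴸ-restricts (suc k) m i (Hᴸ k i g) (Hᴮ k i g′) (Hᴸ-restricts k i g g′ r)

  Bᴸ-restricts : ∀ k m → Restricts (P.Bᴸ k m unit) (Q.Bᴸ k m unitᴮ)
  Bᴸ-restricts k zero    = unit-restricts
  Bᴸ-restricts k (suc m) = Aᴸ-restricts k (suc m) k (P.Bᴸ (suc k) m unit) (Q.Bᴸ (suc k) m unitᴮ)
                             (Bᴸ-restricts (suc k) m)

𝔉-𝔉ᴮ : ∀ {n} (w : Vec ℕ (suc n)) β → Unique (toList w) → toList w ≡ word 1 β → 𝔉 w ≈ₚ 𝔉ᴮ β
𝔉-𝔉ᴮ {n} w β u e a = trans (𝔉-left w u a) (Bᴸ-restricts 0 n w β e a)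

-- All terms contributing to one coefficient have the same sign

signed : ℕ → ℤ → ℤ
signed zero    z = z
signed (suc m) z = ℤ.- signed m z

signed-+ : ∀ m y z → signed m (y ℤ.+ z) ≡ signed m y ℤ.+ signed m z
signed-+ zero    y z = refl
signed-+ (suc m) y z = trans (cong ℤ.-_ (signed-+ m y z)) (ℤP.neg-distrib-+ (signed m y) (signed m z))

signed-0 : ∀ m z → signed m z ≡ 0ℤ → z ≡ 0ℤ
signed-0 zero    z e = e
signed-0 (suc m) z e = signed-0 m z (ℤP.neg-injective e)

0-signed : ∀ m → signed m 0ℤ ≡ 0ℤ
0-signed zero    = refl
0-signed (suc m) = cong ℤ.-_ (0-signed m)

count inversions : ∀ {n} → Vec Bool n → ℕ
count []          = 0
count (true ∷ β)  = suc (count β)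
count (false ∷ β) = count β
inversions []          = 0
inversions (true ∷ β)  = inversions β
inversions (false ∷ β) = count β + inversions β

count-swapAt : ∀ {n} k (β : Vec Bool n) → count (swapAt k β) ≡ count β
count-swapAt zero    []                   = refl
count-swapAt zero    (b ∷ [])             = refl
count-swapAt zero    (true ∷ true ∷ β)    = refl
count-swapAt zero    (true ∷ false ∷ β)   = refl
count-swapAt zero    (false ∷ true ∷ β)   = refl
count-swapAt zero    (false ∷ false ∷ β)  = refl
count-swapAt (suc k) []                   = refl
count-swapAt (suc k) (true ∷ β)           = cong suc (count-swapAt k β)
count-swapAt (suc k) (false ∷ β)          = count-swapAt k β

inversions-rise : ∀ {n} k (β : Vec Bool n) → rise? k β ≡ true → inversions β ≡ suc (inversions (swapAt k β))
inversions-rise zero    (false ∷ true ∷ β) _ = refl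
inversions-rise (suc k) (true ∷ β)         e = inversions-rise k β e
inversions-rise (suc k) (false ∷ β)        e = trans (cong (count β +_) (inversions-rise k β e))
  (trans (+-suc (count β) _) (cong (λ c → suc (c + inversions (swapAt k β))) (sym (count-swapAt k β))))

none-inversions : ∀ {n} (β : Vec Bool n) → none? β ≡ true → inversions β ≡ 0 × count β ≡ 0
none-inversions []          _ = refl , refl
none-inversions (false ∷ β) e with none-inversions β e
... | i , c = trans (cong₂ _+_ c i) refl , c

sorted-inversions : ∀ {n} (β : Vec Bool n) → sorted? β ≡ true → inversions β ≡ 0
sorted-inversions []          _ = refl
sorted-inversions (true ∷ β)  e = sorted-inversions β e
sorted-inversions (false ∷ β) e with none-inversions β e
... | i , c = cong₂ _+_ c i

decAt-sum : ∀ {n} i (a b : Mono n) → decAt i a ≡ just b → ∣ a ∣ₘ ≡ suc ∣ b ∣ₘ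
decAt-sum zero    (suc x ∷ a) .(x ∷ a) refl = refl
decAt-sum (suc i) (x ∷ a) b e with decAt i a in eq
decAt-sum (suc i) (x ∷ a) .(x ∷ c) refl | just c =
  trans (cong (x +_) (decAt-sum i a c eq)) (+-suc x _)

sum-replicate-0 : ∀ n → ∣ replicate n 0 ∣ₘ ≡ 0
sum-replicate-0 zero    = refl
sum-replicate-0 (suc n) = sum-replicate-0 n

Pred : ℕ → ℕ → Set₁
Pred b n = Vec Bool b → Mono n → Set

decreased : ∀ {n} → ℕ → (Mono n → Set) → Mono n → Set
decreased i P α = maybe P ⊥ (decAt i α)

-- The support of `Hᴮ k i g` when nothing cancels, which `Hᴮ-supports` justifies.
Hᴾ : ∀ {b n} → ℕ → ℕ → Pred b n → Pred b n
Hᴾ k i P β α = P β α ⊎ (rise? k β ≡ true × decreased i (λ α′ → P β α′ ⊎ P (swapAt k β) α′) α)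

Aᴾ : ∀ {b n} → ℕ → ℕ → ℕ → Pred b n → Pred b n
Aᴾ = Product.Aᴸ Hᴾ

Bᴾ : ∀ {b n} → ℕ → ℕ → Pred b n → Pred b n
Bᴾ = Product.Bᴸ Hᴾ

unitᴾ : ∀ {b n} → Pred b n
unitᴾ {n = n} β α = sorted? β ≡ true × α ≡ replicate n 0

-- The coefficient of α at β is (−1)^(inversions β + |α|) c with c a natural number, nonzero iff P β α.
Supports : ∀ {n} → Xᴮ n → Pred n n → Set
Supports g P = ∀ β α → Σ ℕ λ c → g β α ≡ signed (inversions β + ∣ α ∣ₘ) (ℤ.+ c)
                                × (¬ c ≡ 0 → P β α) × (P β α → ¬ c ≡ 0)

+-nonzero : ∀ m n → ¬ m + n ≡ 0 → ¬ m ≡ 0 ⊎ ¬ n ≡ 0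
+-nonzero zero    n h = inj₂ h
+-nonzero (suc m) n h = inj₁ λ ()

-- Let m be the sign exponent of `g (swapAt k β) α′`. That of `g β α` is m + 2, as a rise accounts
-- for one inversion and `α` for one more degree. That of `g β α′` is m + 1, which its minus sign
-- offsets. So the three natural numbers add up.
Hᴮ-supports : ∀ {n} k i (g : Xᴮ n) P → Supports g P → Supports (Hᴮ k i g) (Hᴾ k i P)
Hᴮ-supports k i g P s β α with rise? k β in rise | decAt i α in dec | s β α
... | false | nothing | c , e , to , from = c , trans (ℤP.+-identityʳ _) e , (λ h → inj₁ (to h)) ,
        λ { (inj₁ p) → from p ; (inj₂ (() , _)) }
... | false | just _  | c , e , to , from = c , trans (ℤP.+-identityʳ _) e , (λ h → inj₁ (to h)) ,
        λ { (inj₁ p) → from p ; (inj₂ (() , _)) }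
... | true  | nothing | c , e , to , from = c , trans (ℤP.+-identityʳ _) e , (λ h → inj₁ (to h)) ,
        λ { (inj₁ p) → from p ; (inj₂ (_ , ())) }
... | true  | just α′ | c , e , to , from with s β α′ | s (swapAt k β) α′
...   | c₁ , e₁ , to₁ , from₁ | c₂ , e₂ , to₂ , from₂ = c + (c₁ + c₂) , value , to′ , from′
  where
  m = inversions (swapAt k β) + ∣ α′ ∣ₘ
  inv : inversions β ≡ suc (inversions (swapAt k β))
  inv = inversions-rise k β rise
  lemma : ∀ x y z → ℤ.- (ℤ.- x) ℤ.+ (z ℤ.- (ℤ.- y)) ≡ x ℤ.+ (y ℤ.+ z)
  lemma = ℤS.solve-∀
  parity : signed (inversions β + ∣ α ∣ₘ) ≡ signed (2 + m)
  parity = cong signed (trans (cong₂ _+_ inv (decAt-sum i α α′ dec)) (cong suc (+-suc _ _)))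
  value : g β α ℤ.+ (g (swapAt k β) α′ ℤ.- g β α′) ≡
          signed (inversions β + ∣ α ∣ₘ) (ℤ.+ (c + (c₁ + c₂)))
  value = trans (cong₂ ℤ._+_ (trans e (cong (λ f → f (ℤ.+ c)) parity))
      (cong₂ ℤ._-_ e₂ (trans e₁ (cong (λ j → signed (j + ∣ α′ ∣ₘ) (ℤ.+ c₁)) inv))))
    (trans (lemma (signed m (ℤ.+ c)) (signed m (ℤ.+ c₁)) (signed m (ℤ.+ c₂)))
    (trans (sym (trans (signed-+ m (ℤ.+ c) (ℤ.+ (c₁ + c₂)))
                       (cong (λ z → signed m (ℤ.+ c) ℤ.+ z) (signed-+ m (ℤ.+ c₁) (ℤ.+ c₂)))))
    (trans (sym (ℤP.neg-involutive _)) (cong (λ f → f (ℤ.+ (c + (c₁ + c₂)))) (sym parity)))))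
  to′ : ¬ c + (c₁ + c₂) ≡ 0 → P β α ⊎ (true ≡ true × (P β α′ ⊎ P (swapAt k β) α′))
  to′ h with +-nonzero c (c₁ + c₂) h
  ... | inj₁ h₀ = inj₁ (to h₀)
  ... | inj₂ h′ with +-nonzero c₁ c₂ h′
  ...   | inj₁ h₁ = inj₂ (refl , inj₁ (to₁ h₁))
  ...   | inj₂ h₂ = inj₂ (refl , inj₂ (to₂ h₂))
  from′ : P β α ⊎ (true ≡ true × (P β α′ ⊎ P (swapAt k β) α′)) → ¬ c + (c₁ + c₂) ≡ 0
  from′ (inj₁ p)              z = from p (ℕP.m+n≡0⇒m≡0 c z)
  from′ (inj₂ (_ , inj₁ p))   z = from₁ p (ℕP.m+n≡0⇒m≡0 c₁ (ℕP.m+n≡0⇒n≡0 c z))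
  from′ (inj₂ (_ , inj₂ p))   z = from₂ p (ℕP.m+n≡0⇒n≡0 c₁ (ℕP.m+n≡0⇒n≡0 c z))

unitᴮ-supports : ∀ {n} → Supports {n} unitᴮ unitᴾ
unitᴮ-supports {n} β α with sorted? β in sorted | VecP.≡-dec ℕ._≟_ α (replicate n 0)
... | false | _ = 0 , sym (0-signed (inversions β + ∣ α ∣ₘ)) , (λ h → ⊥-elim (h refl)) , λ { (() , _) }
... | true | no α≢ = 0 , sym (0-signed (inversions β + ∣ α ∣ₘ)) , (λ h → ⊥-elim (h refl)) , λ { (_ , e) → ⊥-elim (α≢ e) }
... | true | yes refl = 1 , cong (λ m → signed m 1ℤ) (sym (cong₂ _+_ (sorted-inversions β sorted) (sum-replicate-0 n)))
        , (λ _ → refl , refl) , λ _ ()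

module _ {n : ℕ} where

  private
    module P = Product {Y = Xᴮ n} Hᴮ
    module Q = Product {Y = Pred n n} Hᴾ

  Aᴸ-supports : ∀ k m i g R → Supports g R → Supports (P.Aᴸ k m i g) (Q.Aᴸ k m i R)
  Aᴸ-supports k zero    i g R s = s
  Aᴸ-supports k (suc m) i g R s = Aᴸ-supports (suc k) m i (Hᴮ k i g) (Hᴾ k i R) (Hᴮ-supports k i g R s)

  Bᴸ-supports : ∀ k m → Supports (P.Bᴸ k m unitᴮ) (Q.Bᴸ k m unitᴾ)
  Bᴸ-supports k zero    = unitᴮ-supports
  Bᴸ-supports k (suc m) = Aᴸ-supports k (suc m) k (P.Bᴸ (suc k) m unitᴮ) (Q.Bᴸ (suc k) m unitᴾ)
                            (Bᴸ-supports (suc k) m)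

infix 3 _⇔_
_⇔_ : Set → Set → Set
A ⇔ B = (A → B) × (B → A)

𝔉ᴮ-support : ∀ {n} (β : Vec Bool (suc n)) α → InSupp (𝔉ᴮ β) α ⇔ Bᴾ 0 n unitᴾ β α
𝔉ᴮ-support {n} β α with Bᴸ-supports 0 n β α
... | c , e , to , from =
  (λ h → to (λ { refl → h (trans e (0-signed (inversions β + ∣ α ∣ₘ))) })) ,
  (λ p z → from p (ℤP.+-injective (signed-0 (inversions β + ∣ α ∣ₘ) (ℤ.+ c) (trans (sym e) z))))

-- Branching: splitting off the first variable

-- Effect of h_{n-1}(x) ⋯ h_1(x) on a 0-1 word, with the power of x: a set bit moves one place to the left (move),
-- or stays with weight 1 (keep) or −x (extra).
data Scan : ∀ {n} → Vec Bool n → Vec Bool n → ℕ → Set where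
  []    : Scan [] [] 0
  keep  : ∀ {n c} {β γ : Vec Bool n} b → Scan β γ c → Scan (b ∷ β) (b ∷ γ) c
  extra : ∀ {n c} {β : Vec Bool (suc n)} {γ} → Scan β (true ∷ γ) c → Scan (false ∷ β) (false ∷ true ∷ γ) (suc c)
  move  : ∀ {n c} {β : Vec Bool (suc n)} {γ} → Scan β (true ∷ γ) c → Scan (false ∷ β) (true ∷ false ∷ γ) (suc c)

module _ {b n : ℕ} where
  private
    module P = Product {Y = Pred (suc b) n} Hᴾ
    module Q = Product {Y = Pred b n} Hᴾ

  Aᴸ-shift : ∀ k m i (R : Pred (suc b) n) c β α →
             P.Aᴸ (suc k) m i R (c ∷ β) α ≡ Q.Aᴸ k m i (λ β′ → R (c ∷ β′)) β α
  Aᴸ-shift k zero    i R c β α = refl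
  Aᴸ-shift k (suc m) i R c β α = Aᴸ-shift (suc k) m i (Hᴾ (suc k) i R) c β α

-- The operator at bit 0 is innermost and meets the word after its tail has been scanned. This is
-- why `extra` and `move` look at the first bit of the scanned tail, and why one set bit can travel
-- several places within a block.
block-scan : ∀ {n} m (R : Pred (suc m) (suc n)) β a α → Aᴾ 0 m 0 R β (a ∷ α) ⇔
             (∃ λ γ → ∃ λ c → ∃ λ a′ → Scan β γ c × c + a′ ≡ a × R γ (a′ ∷ α))
block-scan zero R (b ∷ []) a α =
  (λ r → (b ∷ []) , 0 , a , keep b [] , refl , r) , λ { (_ , _ , _ , keep b [] , refl , r) → r }
block-scan (suc m) R (b ∷ β) a α rewrite Aᴸ-shift 0 m 0 (Hᴾ 0 0 R) b β (a ∷ α) = to , from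
  where
  R′ = λ β′ → Hᴾ 0 0 R (b ∷ β′)
  Result = ∃ λ γ → ∃ λ c → ∃ λ a′ → Scan (b ∷ β) γ c × c + a′ ≡ a × R γ (a′ ∷ α)
  classify-step : ∀ b γ c a′ → Scan β γ c → c + a′ ≡ a → Hᴾ 0 0 R (b ∷ γ) (a′ ∷ α) →
                  ∃ λ γ → ∃ λ c → ∃ λ a′ → Scan (b ∷ β) γ c × c + a′ ≡ a × R γ (a′ ∷ α)
  classify-step b     γ          c a′       s e (inj₁ r) = (b ∷ γ) , c , a′ , keep b s , e , r
  classify-step false (true ∷ γ) c (suc a′) s e (inj₂ (_ , inj₁ r)) =
    (false ∷ true ∷ γ) , suc c , a′ , extra s , trans (sym (+-suc c a′)) e , r
  classify-step false (true ∷ γ) c (suc a′) s e (inj₂ (_ , inj₂ r)) =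
    (true ∷ false ∷ γ) , suc c , a′ , move s , trans (sym (+-suc c a′)) e , r
  to : Aᴾ 0 m 0 R′ β (a ∷ α) → Result
  to p with proj₁ (block-scan m R′ β a α) p
  ... | γ , c , a′ , s , e , r = classify-step b γ c a′ s e r
  from : Result → Aᴾ 0 m 0 R′ β (a ∷ α)
  from (_ , c , a′ , keep _ s , e , r) = proj₂ (block-scan m R′ β a α) (_ , c , a′ , s , e , inj₁ r)
  from (_ , suc c , a′ , extra s , e , r) =
    proj₂ (block-scan m R′ β a α) (_ , c , suc a′ , s , trans (+-suc c a′) e , inj₂ (refl , inj₁ r))
  from (_ , suc c , a′ , move s , e , r) =
    proj₂ (block-scan m R′ β a α) (_ , c , suc a′ , s , trans (+-suc c a′) e , inj₂ (refl , inj₂ r))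

infix 4 _⊆_
_⊆_ : ∀ {b n} → Pred b n → Pred b n → Set
R ⊆ R′ = ∀ β α → R β α → R′ β α

Hᴾ-mono : ∀ {b n} k i (R R′ : Pred b n) → R ⊆ R′ → Hᴾ k i R ⊆ Hᴾ k i R′
Hᴾ-mono k i R R′ f β α (inj₁ r) = inj₁ (f β α r)
Hᴾ-mono k i R R′ f β α (inj₂ (e , d)) with decAt i α
... | just α′ with d
...   | inj₁ r = inj₂ (e , inj₁ (f β α′ r))
...   | inj₂ r = inj₂ (e , inj₂ (f (swapAt k β) α′ r))

module _ {b n : ℕ} where
  private
    module P = Product {Y = Pred b n} Hᴾ

  Aᴸ-mono : ∀ k m i (R R′ : Pred b n) → R ⊆ R′ → P.Aᴸ k m i R ⊆ P.Aᴸ k m i R′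
  Aᴸ-mono k zero    i R R′ f = f
  Aᴸ-mono k (suc m) i R R′ f = Aᴸ-mono (suc k) m i (Hᴾ k i R) (Hᴾ k i R′) (Hᴾ-mono k i R R′ f)

  Bᴸ-mono : ∀ k m (R R′ : Pred b n) → R ⊆ R′ → P.Bᴸ k m R ⊆ P.Bᴸ k m R′
  Bᴸ-mono k zero    R R′ f = f
  Bᴸ-mono k (suc m) R R′ f = Aᴸ-mono k (suc m) k (P.Bᴸ (suc k) m R) (P.Bᴸ (suc k) m R′) (Bᴸ-mono (suc k) m R R′ f)

  shift : Bool → ℕ → Pred (suc b) (suc n) → Pred b n
  shift c a R β α = R (c ∷ β) (a ∷ α)

  private
    module Q = Product {Y = Pred (suc b) (suc n)} Hᴾ

  Hᴾ-shift : ∀ k i R c a → shift c a (Hᴾ (suc k) (suc i) R) ⊆ Hᴾ k i (shift c a R)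
                         × Hᴾ k i (shift c a R) ⊆ shift c a (Hᴾ (suc k) (suc i) R)
  Hᴾ-shift k i R c a = to , from
    where
    to : shift c a (Hᴾ (suc k) (suc i) R) ⊆ Hᴾ k i (shift c a R)
    to β α (inj₁ r) = inj₁ r
    to β α (inj₂ (e , d)) with decAt i α
    ... | just α′ = inj₂ (e , d)
    from : Hᴾ k i (shift c a R) ⊆ shift c a (Hᴾ (suc k) (suc i) R)
    from β α (inj₁ r) = inj₁ r
    from β α (inj₂ (e , d)) with decAt i α
    ... | just α′ = inj₂ (e , d)

  Aᴸ-shift₂ : ∀ k m i R c a → shift c a (Q.Aᴸ (suc k) m (suc i) R) ⊆ P.Aᴸ k m i (shift c a R)
                            × P.Aᴸ k m i (shift c a R) ⊆ shift c a (Q.Aᴸ (suc k) m (suc i) R)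
  Aᴸ-shift₂ k zero    i R c a = (λ _ _ r → r) , (λ _ _ r → r)
  Aᴸ-shift₂ k (suc m) i R c a =
    (λ β α r → Aᴸ-mono (suc k) m i _ _ (proj₁ (Hᴾ-shift k i R c a)) β α (proj₁ ih β α r)) ,
    (λ β α r → proj₂ ih β α (Aᴸ-mono (suc k) m i _ _ (proj₂ (Hᴾ-shift k i R c a)) β α r))
    where
    ih = Aᴸ-shift₂ (suc k) m i (Hᴾ (suc k) (suc i) R) c a

  Bᴸ-shift : ∀ k m R c a → shift c a (Q.Bᴸ (suc k) m R) ⊆ P.Bᴸ k m (shift c a R)
                         × P.Bᴸ k m (shift c a R) ⊆ shift c a (Q.Bᴸ (suc k) m R)
  Bᴸ-shift k zero    R c a = (λ _ _ r → r) , (λ _ _ r → r)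
  Bᴸ-shift k (suc m) R c a =
    (λ β α r → Aᴸ-mono k (suc m) k _ _ (proj₁ (Bᴸ-shift (suc k) m R c a)) β α (proj₁ sh β α r)) ,
    (λ β α r → proj₂ sh β α (Aᴸ-mono k (suc m) k _ _ (proj₂ (Bᴸ-shift (suc k) m R c a)) β α r))
    where
    sh = Aᴸ-shift₂ k (suc m) k (Q.Bᴸ (2 + k) m R) c a

-- Later blocks touch neither bit 0 nor the first exponent. After the scan both are frozen, as
-- `shift` records, and a problem one size smaller remains.
Bᴸ-scan : ∀ m (R : Pred (2 + m) (2 + m)) β a α →
  Bᴾ 0 (suc m) R β (a ∷ α) ⇔
  (∃ λ b → ∃ λ γ → ∃ λ c → ∃ λ a′ → Scan β (b ∷ γ) c × c + a′ ≡ a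
     × Bᴾ 0 m (shift b a′ R) γ α)
Bᴸ-scan m R β a α = to , from
  where
  R′ : Pred (2 + m) (2 + m)
  R′ = Bᴾ 1 m R
  to : _
  to p with proj₁ (block-scan (suc m) R′ β a α) p
  ... | b ∷ γ , c , a′ , s , e , r = b , γ , c , a′ , s , e , proj₁ (Bᴸ-shift 0 m R b a′) γ α r
  from : _
  from (b , γ , c , a′ , s , e , r) =
    proj₂ (block-scan (suc m) R′ β a α) (b ∷ γ , c , a′ , s , e , proj₂ (Bᴸ-shift 0 m R b a′) γ α r)

-- The front bit after a scan is final, and `unitᴾ` asks for a sorted word. So this bit must be set,
-- unless no ones are left, and then no further variable occurs.
data S : ∀ {n} → Vec Bool n → Mono n → Set where
  none : ∀ {n} {β : Vec Bool n} → none? β ≡ true → S β (replicate n 0)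
  cons : ∀ {n a} {β : Vec Bool (suc n)} {γ} {α : Mono n} → Scan β (true ∷ γ) a → S γ α → S β (a ∷ α)

scan-refl : ∀ {n} (β : Vec Bool n) → Scan β β 0
scan-refl []      = []
scan-refl (b ∷ β) = keep b (scan-refl β)

scan-none : ∀ {n c} {β γ : Vec Bool n} → Scan β γ c → none? γ ≡ true → β ≡ γ × c ≡ 0
scan-none []             _ = refl , refl
scan-none (keep false s) e with scan-none s e
... | refl , refl = refl , refl

noneᴾ : ∀ {b n} → Pred b n
noneᴾ {n = n} β α = none? β ≡ true × α ≡ replicate n 0

module _ {b n : ℕ} where
  private
    module P = Product {Y = Pred b n} Hᴾ

    Nonempty : Pred b n → Set
    Nonempty R = ∃ λ β → ∃ λ α → R β α

    Hᴾ-nonempty : ∀ k i R β α → Hᴾ k i R β α → Nonempty R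
    Hᴾ-nonempty k i R β α (inj₁ r) = β , α , r
    Hᴾ-nonempty k i R β α (inj₂ (_ , d)) with decAt i α
    ... | just α′ with d
    ...   | inj₁ r = β , α′ , r
    ...   | inj₂ r = swapAt k β , α′ , r

    Aᴸ-nonempty : ∀ k m i R β α → P.Aᴸ k m i R β α → Nonempty R
    Aᴸ-nonempty k zero    i R β α r = β , α , r
    Aᴸ-nonempty k (suc m) i R β α r with Aᴸ-nonempty (suc k) m i (Hᴾ k i R) β α r
    ... | β′ , α′ , r′ = Hᴾ-nonempty k i R β′ α′ r′

  Bᴸ-nonempty : ∀ k m R β α → P.Bᴸ k m R β α → ∃ λ β′ → ∃ λ α′ → R β′ α′
  Bᴸ-nonempty k zero    R β α r = β , α , r
  Bᴸ-nonempty k (suc m) R β α r with Aᴸ-nonempty k (suc m) k (P.Bᴸ (suc k) m R) β α r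
  ... | β′ , α′ , r′ = Bᴸ-nonempty (suc k) m R β′ α′ r′

Bᴸ-none : ∀ m (β : Vec Bool (suc m)) (α : Mono (suc m)) → Bᴾ 0 m noneᴾ β α ⇔ noneᴾ β α
Bᴸ-none zero    β α = (λ r → r) , (λ r → r)
Bᴸ-none (suc m) β (a ∷ α) = to , from β
  where
  to : Bᴾ 0 (suc m) noneᴾ β (a ∷ α) → noneᴾ β (a ∷ α)
  to p with proj₁ (Bᴸ-scan m noneᴾ β a α) p
  ... | b , γ , c , a′ , s , e , r with Bᴸ-nonempty 0 m (shift b a′ noneᴾ) γ α r
  to p | false , γ , c , .0 , s , e , r | _ , _ , _ , refl
    with proj₁ (Bᴸ-none m γ α) (Bᴸ-mono 0 m (shift false 0 noneᴾ) noneᴾ (λ { _ _ (e , refl) → e , refl }) γ α r)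
  ... | eγ , refl with scan-none s eγ
  ...   | refl , refl = eγ , cong (_∷ replicate (suc m) 0) (sym e)
  from : ∀ β {a α} → noneᴾ β (a ∷ α) → Bᴾ 0 (suc m) noneᴾ β (a ∷ α)
  from (false ∷ γ) (e , refl) = proj₂ (Bᴸ-scan m noneᴾ (false ∷ γ) 0 (replicate (suc m) 0))
    (false , γ , 0 , 0 , scan-refl (false ∷ γ) , refl ,
     Bᴸ-mono 0 m noneᴾ (shift false 0 noneᴾ) (λ { _ _ (e , refl) → e , refl }) γ (replicate (suc m) 0)
       (proj₂ (Bᴸ-none m γ (replicate (suc m) 0)) (e , refl)))

Bᴸ-S : ∀ m (β : Vec Bool (suc m)) (α : Mono (suc m)) → Bᴾ 0 m unitᴾ β α ⇔ S β α
Bᴸ-S zero β α = to β α , from β α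
  where
  to : ∀ β α → unitᴾ β α → S β α
  to (true ∷ [])  _ (_ , refl) = cons (keep true []) (none refl)
  to (false ∷ []) _ (_ , refl) = none refl
  from : ∀ (β : Vec Bool 1) (α : Mono 1) → S β α → unitᴾ β α
  from (false ∷ []) _ (none _) = refl , refl
  from (true ∷ [])  _ (cons (keep true []) (none _)) = refl , refl
Bᴸ-S (suc m) β (a ∷ α) = to , from β
  where
  to : Bᴾ 0 (suc m) unitᴾ β (a ∷ α) → S β (a ∷ α)
  to p with proj₁ (Bᴸ-scan m unitᴾ β a α) p
  ... | b , γ , c , a′ , s , e , r with Bᴸ-nonempty 0 m (shift b a′ unitᴾ) γ α r
  to p | true , γ , c , .0 , s , e , r | _ , _ , _ , refl =
    subst (λ x → S β (x ∷ α)) (trans (sym (+-identityʳ c)) e)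
      (cons s (proj₁ (Bᴸ-S m γ α) (Bᴸ-mono 0 m (shift true 0 unitᴾ) unitᴾ (λ { _ _ (e , refl) → e , refl }) γ α r)))
  to p | false , γ , c , .0 , s , e , r | _ , _ , _ , refl
    with proj₁ (Bᴸ-none m γ α) (Bᴸ-mono 0 m (shift false 0 unitᴾ) noneᴾ (λ { _ _ (e , refl) → e , refl }) γ α r)
  ... | eγ , refl with scan-none s eγ
  ...   | refl , refl = subst (λ x → S β (x ∷ replicate (suc m) 0)) e (none eγ)
  from : ∀ β {a α} → S β (a ∷ α) → Bᴾ 0 (suc m) unitᴾ β (a ∷ α)
  from β {a} {α} (cons {γ = γ} s t) = proj₂ (Bᴸ-scan m unitᴾ β a α) (true , γ , a , 0 , s , +-identityʳ a ,
    Bᴸ-mono 0 m unitᴾ (shift true 0 unitᴾ) (λ { _ _ (e , refl) → e , refl }) γ α (proj₂ (Bᴸ-S m γ α) t))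
  from (false ∷ γ) (none e) = proj₂ (Bᴸ-scan m unitᴾ (false ∷ γ) 0 (replicate (suc m) 0))
    (false , γ , 0 , 0 , scan-refl (false ∷ γ) , refl ,
     Bᴸ-mono 0 m noneᴾ (shift false 0 unitᴾ) (λ { _ _ (e , refl) → e , refl }) γ (replicate (suc m) 0)
       (proj₂ (Bᴸ-none m γ (replicate (suc m) 0)) (e , refl)))

𝔉ᴮ-S : ∀ {n} (β : Vec Bool (suc n)) α → InSupp (𝔉ᴮ β) α ⇔ S β α
𝔉ᴮ-S {n} β α = (λ h → proj₁ (Bᴸ-S n β α) (proj₁ (𝔉ᴮ-support β α) h)) ,
               (λ s → proj₂ (𝔉ᴮ-support β α) (proj₂ (Bᴸ-S n β α) s))

-- The partition of a 0-1 word

-- Number of zeros before each one: the parts, in increasing order, of the partition of the Grassmannian permutation.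
parts : ∀ {n} → Vec Bool n → List ℕ
parts []          = []
parts (true ∷ β)  = 0 ∷ parts β
parts (false ∷ β) = List.map suc (parts β)

-- Row l loses t boxes, down to κ ≥ p, the next smaller part; a row that loses boxes may get one of them back (ε = 1).
data Br : ℕ → List ℕ → List ℕ → ℕ → Set where
  []  : ∀ {p} → Br p [] [] 0
  row : ∀ {p l m ℓ ms a b} κ t ε → l ≡ κ + t → m ≡ κ + ε → b ≡ t + a →
        p ≤ κ → ε ≤ 1 → ε ≤ t → Br l ℓ ms a → Br p (l ∷ ℓ) (m ∷ ms) b

-- The exponents of the symmetric Grothendieck polynomial of the partition ℓ, by branching on the first variable.
data SL : ∀ {r} → List ℕ → Vec ℕ r → Set where
  []   : SL [] []
  peel : ∀ {r l ℓ ms t a} {α : Vec ℕ r} → Br l ℓ ms t → a ≡ l + t → SL ms α → SL (l ∷ ℓ) (a ∷ α)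

-- Each row uses up one variable; those beyond the number of rows do not occur.
data Padded : ∀ {r n} → Vec ℕ r → Mono n → Set where
  []  : ∀ {n} → Padded [] (replicate n 0)
  _∷_ : ∀ {r n} a {α : Vec ℕ r} {α′ : Mono n} → Padded α α′ → Padded (a ∷ α) (a ∷ α′)

br-weaken : ∀ {p p′ ℓ ms a} → p′ ≤ p → Br p ℓ ms a → Br p′ ℓ ms a
br-weaken _ [] = []
br-weaken q (row κ t ε e e′ e″ p≤κ ε≤1 ε≤t b) = row κ t ε e e′ e″ (≤-trans q p≤κ) ε≤1 ε≤t b

br-suc : ∀ {p ℓ ms a} → Br p ℓ ms a → Br (suc p) (List.map suc ℓ) (List.map suc ms) a
br-suc [] = []
br-suc (row κ t ε e e′ e″ p≤κ ε≤1 ε≤t b) = row (suc κ) t ε (cong suc e) (cong suc e′) e″ (s≤s p≤κ) ε≤1 ε≤t (br-suc b)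

br-pred : ∀ {p} ℓ {ms a} → Br (suc p) (List.map suc ℓ) ms a → ∃ λ ms′ → ms ≡ List.map suc ms′ × Br p ℓ ms′ a
br-pred [] [] = [] , refl , []
br-pred (l ∷ ℓ) (row (suc κ) t ε e e′ e″ (s≤s p≤κ) ε≤1 ε≤t b) with br-pred ℓ b
... | ms′ , refl , b′ = (κ + ε) ∷ ms′ , cong (List._∷ List.map suc ms′) e′ ,
      row κ t ε (ℕP.suc-injective e) refl e″ p≤κ ε≤1 ε≤t b′

-- A set bit with `l` zeros before it is a row of length `l`, and a move takes off one box. An
-- `extra` step counts in the degree but leaves the bit behind a zero, where it can travel no
-- further. Hence at most one box comes back, and only to a row with `t` positive.
scan-br : ∀ {n c} {β γ : Vec Bool n} → Scan β γ c → Br 0 (parts β) (parts γ) c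
scan-br []              = []
scan-br (keep true s)   = row 0 0 0 refl refl refl z≤n z≤n z≤n (scan-br s)
scan-br (keep false s)  = br-weaken z≤n (br-suc (scan-br s))
scan-br (extra {β = β} s) with parts β | scan-br s
... | l ∷ ℓ | row zero t zero e refl e″ _ _ _ b =
      row 0 (suc t) 1 (cong suc e) refl (cong suc e″) z≤n ≤-refl (s≤s z≤n) (br-suc b)
scan-br (move {β = β} s) with parts β | scan-br s
... | l ∷ ℓ | row zero t zero e refl e″ _ _ _ b =
      row 0 (suc t) 0 (cong suc e) refl (cong suc e″) z≤n z≤n z≤n (br-suc b)

parts-0 : ∀ {n} (γ : Vec Bool n) {ms} → parts γ ≡ 0 ∷ ms → ∃ λ m → ∃ λ (γ′ : Vec Bool m) →
          Σ (n ≡ suc m) λ e → subst (Vec Bool) e γ ≡ true ∷ γ′ × parts γ′ ≡ ms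
parts-0 (true ∷ γ) refl = _ , γ , refl , refl , refl
parts-0 (false ∷ γ) e with parts γ
parts-0 (false ∷ γ) () | []
parts-0 (false ∷ γ) () | _ ∷ _

br-scan : ∀ {n} (β : Vec Bool n) {ms c} → Br 0 (parts β) ms c → ∃ λ γ → Scan β γ c × parts γ ≡ ms
br-scan [] [] = [] , [] , refl
br-scan (true ∷ β) (row zero zero zero _ refl refl _ _ _ b) with br-scan β b
... | γ , s , refl = true ∷ γ , keep true s , refl
br-scan (false ∷ β) {ms} {c} br = go (parts β) refl br
  where
  go : ∀ ℓ → parts β ≡ ℓ → Br 0 (List.map suc ℓ) ms c → ∃ λ γ → Scan (false ∷ β) γ c × parts γ ≡ ms
  go [] eq [] with br-scan β (subst (λ ℓ → Br 0 ℓ [] 0) (sym eq) [])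
  ... | γ , s , e = false ∷ γ , keep false s , cong (List.map suc) e
  go (l ∷ ℓ) eq (row κ t ε e e′ e″ p≤κ ε≤1 ε≤t b) with br-pred ℓ b
  go (l ∷ ℓ) eq (row (suc κ) t ε e e′ e″ p≤κ ε≤1 ε≤t b) | ms′ , refl , b′
    with br-scan β (subst (λ ℓ → Br 0 ℓ ((κ + ε) ∷ ms′) c) (sym eq)
                          (row κ t ε (ℕP.suc-injective e) refl e″ z≤n ε≤1 ε≤t b′))
  ... | γ , s , eγ = false ∷ γ , keep false s , trans (cong (List.map suc) eγ) (cong (List._∷ List.map suc ms′) (sym e′))
  -- The row falls all the way: in the scanned tail its bit already stands in front, and the added
  -- zero is passed by `move` or, if a box returns, met by `extra`.
  go (l ∷ ℓ) eq (row {a = a} zero .(suc l) ε refl e′ e″ p≤κ ε≤1 ε≤t b) | ms′ , refl , b′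
    with br-scan β (subst (λ ℓ → Br 0 ℓ (0 ∷ ms′) (l + a)) (sym eq) (row 0 l 0 refl refl refl z≤n z≤n z≤n b′))
  ... | γ , s , eγ with parts-0 γ eγ
  go (l ∷ ℓ) eq (row zero .(suc l) zero refl refl refl p≤κ ε≤1 ε≤t b) | ms′ , refl , b′
    | .(true ∷ γ′) , s , eγ | m , γ′ , refl , refl , refl = true ∷ false ∷ γ′ , move s , refl
  go (l ∷ ℓ) eq (row zero .(suc l) (suc zero) refl refl refl p≤κ ε≤1 ε≤t b) | ms′ , refl , b′
    | .(true ∷ γ′) , s , eγ | m , γ′ , refl , refl , refl = false ∷ true ∷ γ′ , extra s , refl
  go (l ∷ ℓ) eq (row zero .(suc l) (suc (suc ε)) refl e′ e″ p≤κ (s≤s ()) ε≤t b) | _ | _ | _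

none-parts : ∀ {n} (β : Vec Bool n) → none? β ≡ true → parts β ≡ []
none-parts []          _ = refl
none-parts (false ∷ β) e rewrite none-parts β e = refl

parts-none : ∀ {n} (β : Vec Bool n) → parts β ≡ [] → none? β ≡ true
parts-none []          _ = refl
parts-none (false ∷ β) e with parts β in eq
... | [] = parts-none β eq

-- `cons` wants the first one at the very front, so the shortest row loses all its `l` boxes and
-- regains none; the other rows stay at `l` or above.
S-SL : ∀ {n} {β : Vec Bool n} {α : Mono n} → S β α → ∃ λ r → ∃ λ (α₁ : Vec ℕ r) → SL (parts β) α₁ × Padded α₁ α
S-SL {β = β} (none e) rewrite none-parts β e = 0 , [] , [] , []
S-SL {β = β} (cons {a = a} s t) with S-SL t | parts β | scan-br s
... | r , α₁ , sl , pad | l ∷ ℓ | row zero t′ zero refl refl refl _ _ _ b =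
      suc r , a ∷ α₁ , peel b refl sl , a ∷ pad

SL-S : ∀ {n r} (β : Vec Bool n) {ℓ} {α₁ : Vec ℕ r} {α : Mono n} → parts β ≡ ℓ → SL ℓ α₁ → Padded α₁ α → S β α
SL-S β e [] [] = none (parts-none β e)
SL-S β e (peel {l = l} {ms = ms} {t = t} b refl sl) (.(l + t) ∷ pad)
  with br-scan β (subst (λ ℓ → Br 0 ℓ (0 ∷ ms) (l + t)) (sym e) (row 0 l 0 refl refl refl z≤n z≤n z≤n b))
... | γ , s , eγ with parts-0 γ eγ
...   | m , γ′ , refl , refl , eγ′ = cons s (SL-S γ′ eγ′ sl pad)

-- Grassmannian permutations and symmetry

upFrom-≥ : ∀ k n → All (k ≤_) (toList (upFrom k n))
upFrom-≥ k zero    = []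
upFrom-≥ k (suc n) = ≤-refl ∷ All.map ℕP.<⇒≤ (upFrom-≥ (suc k) n)

head-minimal : ∀ {k x xs} → AllPairs _≤_ (x ∷ xs) → k ∈ (x ∷ xs) → k ≤ x → x ≡ k
head-minimal _         (here e)   _   = sym e
head-minimal (x≤ ∷ _) (there k∈) k≤x = ℕP.≤-antisym (All.lookup x≤ k∈) k≤x

-- The least remaining value must head one of the two runs, and which one it heads is the next bit.
increasing-runs : ∀ n k xs ys → AllPairs _≤_ xs → AllPairs _≤_ ys → xs List.++ ys ↭ toList (upFrom k n) →
                  ∃ λ (β : Vec Bool n) → xs ≡ ones k β × ys ≡ zeros k β
increasing-runs zero k xs ys _ _ p with PermP.↭-empty-inv p
increasing-runs zero k [] [] _ _ p | _ = [] , refl , refl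
increasing-runs (suc n) k xs ys sx sy p with ∈P.∈-++⁻ xs {ys} (PermP.∈-resp-↭ (↭-sym p) (here refl))
increasing-runs (suc n) k (x ∷ xs) ys sx sy p | inj₁ k∈
  with head-minimal sx k∈ (All.lookup (upFrom-≥ k (suc n)) (PermP.∈-resp-↭ p (here refl)))
... | refl with increasing-runs n (suc k) xs ys (AllPairs.tail sx) sy (PermP.drop-∷ p)
...   | β , e , e′ = true ∷ β , cong (k ∷_) e , e′
increasing-runs (suc n) k xs (y ∷ ys) sx sy p | inj₂ k∈
  with head-minimal sy k∈ (All.lookup (upFrom-≥ k (suc n)) (PermP.∈-resp-↭ p (∈P.∈-++⁺ʳ xs (here refl))))
... | refl with increasing-runs n (suc k) xs ys sx (AllPairs.tail sy)
                  (PermP.drop-∷ (↭-trans (↭-sym (PermP.shift y xs ys)) p))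
...   | β , e , e′ = false ∷ β , e , cong (k ∷_) e′

<ᵇ-false : ∀ b a → (b ℕ.<ᵇ a) ≡ false → a ≤ b
<ᵇ-false b       zero    _ = z≤n
<ᵇ-false (suc b) (suc a) e = s≤s (<ᵇ-false b a e)

descents-0 : ∀ {n} (w : Vec ℕ n) → descents w ≡ 0 → AllPairs _≤_ (toList w)
descents-0 []          _ = []
descents-0 (a ∷ [])    _ = [] ∷ []
descents-0 (a ∷ b ∷ v) e with b ℕ.<ᵇ a in eq | descents-0 (b ∷ v)
... | false | ih with ih e
...   | b≤ ∷ s = (a≤b ∷ All.map (≤-trans a≤b) b≤) ∷ (b≤ ∷ s)
  where
  a≤b : a ≤ b
  a≤b = <ᵇ-false b a eq

descents-1 : ∀ {n} a (w : Vec ℕ n) → descents (a ∷ w) ≡ 1 →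
             ∃ λ xs → ∃ λ ys → toList (a ∷ w) ≡ (a ∷ xs) List.++ ys × AllPairs _≤_ (a ∷ xs) × AllPairs _≤_ ys
descents-1 a (b ∷ v) e with b ℕ.<ᵇ a in eq | descents-1 b v
... | true  | _  = [] , toList (b ∷ v) , refl , [] ∷ [] , descents-0 (b ∷ v) (ℕP.suc-injective e)
... | false | ih with ih e
...   | xs , ys , e′ , (b≤ ∷ s) , s′ =
        b ∷ xs , ys , cong (a ∷_) e′ , (a≤b ∷ All.map (≤-trans a≤b) b≤) ∷ (b≤ ∷ s) , s′
  where
  a≤b : a ≤ b
  a≤b = <ᵇ-false b a eq

applyUpTo-upFrom : ∀ (f : ℕ → ℕ) k n → (∀ i → f i ≡ i + k) → List.applyUpTo f n ≡ toList (upFrom k n)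
applyUpTo-upFrom f k zero    e = refl
applyUpTo-upFrom f k (suc n) e = cong₂ List._∷_ (e 0)
  (applyUpTo-upFrom (f ∘ suc) (suc k) n (λ i → trans (e (suc i)) (sym (+-suc i k))))

identity-range : ∀ n → List.map suc (List.upTo n) ≡ toList (identity n)
identity-range n = trans (ListP.map-upTo suc n) (applyUpTo-upFrom suc 1 n (λ i → sym (+-comm i 1)))

grassmannian-word : ∀ {n} (w : Vec ℕ n) → IsPermutation w → Grassmannian w →
                    ∃ λ (β : Vec Bool n) → toList w ≡ word 1 β
grassmannian-word {suc n} (a ∷ w) perm g with descents-1 a w g
... | xs , ys , e , s , s′
    with increasing-runs (suc n) 1 (a ∷ xs) ys s s′
           (subst₂ _↭_ e (identity-range (suc n)) perm)
...   | β , e₁ , e₂ = β , trans e (cong₂ List._++_ e₁ e₂)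

upFrom-unique : ∀ k n → Unique (toList (upFrom k n))
upFrom-unique k zero    = []
upFrom-unique k (suc n) = All.map (λ k<v e → <-irrefl e k<v) (upFrom-≥ (suc k) n) ∷ upFrom-unique (suc k) n

word-↭ : ∀ {n} k (β : Vec Bool n) → word k β ↭ toList (upFrom k n)
word-↭ k []          = ↭-reflexive refl
word-↭ k (true ∷ β)  = prep k (word-↭ (suc k) β)
word-↭ k (false ∷ β) = ↭-trans (PermP.shift k (ones (suc k) β) (zeros (suc k) β)) (prep k (word-↭ (suc k) β))

word-unique : ∀ {n} (β : Vec Bool n) → Unique (word 1 β)
word-unique {n} β = PermS.Unique-resp-↭ (setoid ℕ) (↭⇒↭ₛ (↭-sym (word-↭ 1 β))) (upFrom-unique 1 n)

toList-upFrom-length : ∀ k n → List.length (toList (upFrom k n)) ≡ n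
toList-upFrom-length k zero    = refl
toList-upFrom-length k (suc n) = cong suc (toList-upFrom-length (suc k) n)

toVec : ∀ n (xs : List ℕ) → List.length xs ≡ n → ∃ λ (w : Vec ℕ n) → toList w ≡ xs
toVec zero    []       _ = [] , refl
toVec (suc n) (x ∷ xs) e with toVec n xs (ℕP.suc-injective e)
... | w , eq = x ∷ w , cong (x ∷_) eq

word-vec : ∀ {n} (β : Vec Bool n) → ∃ λ (w : Vec ℕ n) → toList w ≡ word 1 β
word-vec {n} β = toVec n (word 1 β) (trans (PermP.↭-length (word-↭ 1 β)) (toList-upFrom-length 1 n))

ones-length : ∀ {n} k (β : Vec Bool n) → List.length (ones k β) ≡ List.length (parts β)
ones-length k []          = refl
ones-length k (true ∷ β)  = cong suc (ones-length (suc k) β)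
ones-length k (false ∷ β) = trans (ones-length (suc k) β) (sym (ListP.length-map suc (parts β)))

ones-ascending : ∀ {n} k (β : Vec Bool n) → AllPairs _<_ (ones k β)
ones-ascending k []          = []
ones-ascending k (true ∷ β)  = ones-≥ (suc k) β ∷ ones-ascending (suc k) β
ones-ascending k (false ∷ β) = ones-ascending (suc k) β

ascending-descent? : ∀ {n} j (w : Vec ℕ n) xs ys → toList w ≡ xs List.++ ys → AllPairs _<_ xs →
                     suc j < List.length xs → descent? j w ≡ false
ascending-descent? zero (a ∷ b ∷ w) (_ ∷ _ ∷ xs) ys e ((a<b ∷ _) ∷ _) _
  with ListP.∷-injectiveˡ e | ListP.∷-injectiveˡ (ListP.∷-injectiveʳ e)
... | refl | refl = <ᵇ-asym a b (dec-true (a ℕ.<? b) a<b)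
ascending-descent? zero w (x ∷ []) ys e s (s≤s ())
ascending-descent? (suc j) (a ∷ w) (x ∷ xs) ys e (_ ∷ s) (s≤s lt) =
  ascending-descent? j w xs ys (ListP.∷-injectiveʳ e) s lt

-- Branching singles out the first variable, so the symmetry is taken from the polynomial: the
-- permutation of `β` ascends along its ones, and there `𝔉-symmetric` applies.
S-symmetric : ∀ {n} j (β : Vec Bool n) α → suc j < List.length (parts β) → S β α → S β (swapAt j α)
S-symmetric {zero}  j []      α () s
S-symmetric {suc n} j β α lt s with word-vec β
... | w , e = proj₁ (𝔉ᴮ-S β (swapAt j α)) (λ z → proj₂ (𝔉ᴮ-S β α) s
    (trans (sym (agree α)) (trans (sym (symmetric α)) (trans (agree (swapAt j α)) z))))
  where
  unique : Unique (toList w)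
  unique = subst Unique (sym e) (word-unique β)
  agree : 𝔉 w ≈ₚ 𝔉ᴮ β
  agree = 𝔉-𝔉ᴮ w β unique e
  lt′ : suc j < List.length (ones 1 β)
  lt′ = subst (suc j <_) (sym (ones-length 1 β)) lt
  j<n : suc j < suc n
  j<n = ℕP.<-≤-trans lt′ (≤-trans (m≤m+n _ (List.length (zeros 1 β)))
    (≤-reflexive (trans (sym (ListP.length-++ (ones 1 β)))
      (trans (PermP.↭-length (word-↭ 1 β)) (toList-upFrom-length 1 (suc n))))))
  symmetric : swapVars j (𝔉 w) ≈ₚ 𝔉 w
  symmetric = 𝔉-symmetric j w j<n
    (ascending-descent? j w (ones 1 β) (zeros 1 β) e (ones-ascending 1 β) lt′)

data Ascending : ℕ → List ℕ → Set where
  []  : ∀ {p} → Ascending p []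
  _∷_ : ∀ {p l ℓ} → p ≤ l → Ascending l ℓ → Ascending p (l ∷ ℓ)

ascending-suc : ∀ {p ℓ} → Ascending p ℓ → Ascending (suc p) (List.map suc ℓ)
ascending-suc []       = []
ascending-suc (p≤ ∷ s) = s≤s p≤ ∷ ascending-suc s

ascending-weaken : ∀ {p p′ ℓ} → p′ ≤ p → Ascending p ℓ → Ascending p′ ℓ
ascending-weaken _ []       = []
ascending-weaken q (p≤ ∷ s) = ≤-trans q p≤ ∷ s

parts-ascending : ∀ {n} (β : Vec Bool n) → Ascending 0 (parts β)
parts-ascending []          = []
parts-ascending (true ∷ β)  = z≤n ∷ parts-ascending β
parts-ascending (false ∷ β) = ascending-weaken z≤n (ascending-suc (parts-ascending β))

replicate-parts : ∀ d {n} (β : Vec Bool n) → ∃ λ m → ∃ λ (γ : Vec Bool m) → parts γ ≡ List.map (d +_) (parts β)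
replicate-parts zero    β = _ , β , sym (ListP.map-id (parts β))
replicate-parts (suc d) β with replicate-parts d β
... | m , γ , e = suc m , false ∷ γ , trans (cong (List.map suc) e) (sym (ListP.map-∘ (parts β)))

-- Peeling leads to new partitions; each has to come from a 0-1 word for the symmetry of its
-- exponents to be available.
parts-surjective : ∀ {p ℓ} → Ascending p ℓ → ∃ λ n → ∃ λ (β : Vec Bool n) → List.map (p +_) (parts β) ≡ ℓ
parts-surjective [] = 0 , [] , refl
parts-surjective {p} (_∷_ {l = l} {ℓ = ℓ} p≤l s) with parts-surjective s
... | n , β , e with replicate-parts (l ∸ p) (true ∷ β)
...   | m , γ , e′ = m , γ , trans (cong (List.map (p +_)) e′) (cong₂ List._∷_
          (trans (cong (p +_) (+-identityʳ (l ∸ p))) (ℕP.m+[n∸m]≡n p≤l))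
          (trans (sym (ListP.map-∘ (parts β))) (trans (ListP.map-cong
            (λ x → trans (sym (+-assoc p (l ∸ p) x)) (cong (_+ x) (ℕP.m+[n∸m]≡n p≤l))) (parts β)) e)))

br-length : ∀ {p ℓ ms a} → Br p ℓ ms a → List.length ms ≡ List.length ℓ
br-length []                        = refl
br-length (row _ _ _ _ _ _ _ _ _ b) = cong suc (br-length b)

SL-length : ∀ {r ℓ} {α : Vec ℕ r} → SL ℓ α → List.length ℓ ≡ r
SL-length []            = refl
SL-length (peel b _ sl) = cong suc (trans (sym (br-length b)) (SL-length sl))

pad : ∀ {r n} (α : Vec ℕ r) → r ≤ n → ∃ λ (α′ : Mono n) → Padded α α′
pad []      _         = _ , []
pad (a ∷ α) (s≤s r≤n) with pad α r≤n
... | α′ , p = a ∷ α′ , a ∷ p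

padded-swapAt : ∀ {r n} j {α : Vec ℕ r} {α′ : Mono n} → suc j < r → Padded α α′ → Padded (swapAt j α) (swapAt j α′)
padded-swapAt zero    _        (a ∷ b ∷ p) = b ∷ a ∷ p
padded-swapAt zero    (s≤s ()) (a ∷ [])
padded-swapAt (suc j) (s≤s lt) (a ∷ p)     = a ∷ padded-swapAt j lt p

padded-injective : ∀ {r n} {α γ : Vec ℕ r} {α′ : Mono n} → Padded α α′ → Padded γ α′ → α ≡ γ
padded-injective []      []       = refl
padded-injective (a ∷ p) (.a ∷ q) = cong (a ∷_) (padded-injective p q)

swapAt-beyond : ∀ {A : Set} {r} j (v : Vec A r) → r ≤ suc j → swapAt j v ≡ v
swapAt-beyond zero    []          _        = refl
swapAt-beyond zero    (x ∷ [])    _        = refl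
swapAt-beyond zero    (x ∷ y ∷ v) (s≤s ())
swapAt-beyond (suc j) []          _        = refl
swapAt-beyond (suc j) (x ∷ v)     (s≤s le) = cong (x ∷_) (swapAt-beyond j v le)

parts-length : ∀ {n} (β : Vec Bool n) → List.length (parts β) ≤ n
parts-length []          = z≤n
parts-length (true ∷ β)  = s≤s (parts-length β)
parts-length (false ∷ β) = ℕP.m≤n⇒m≤1+n (subst (_≤ _) (sym (ListP.length-map suc (parts β))) (parts-length β))

SL-swap : ∀ {r} j {ℓ} {α : Vec ℕ r} → Ascending 0 ℓ → SL ℓ α → SL ℓ (swapAt j α)
SL-swap {r} j {ℓ} {α} asc sl with ℕP.<-≤-connex (suc j) r
... | inj₂ r≤j rewrite swapAt-beyond j α r≤j = sl
... | inj₁ j<r with parts-surjective asc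
...   | n , β , e with pad α (subst (_≤ n) (SL-length (subst (λ ℓ → SL ℓ α) (sym parts≡) sl)) (parts-length β))
  where
  parts≡ : parts β ≡ ℓ
  parts≡ = trans (sym (ListP.map-id (parts β))) e
...     | α′ , p with S-SL (S-symmetric j β α′ (subst (suc j <_) (sym (SL-length sl′)) j<r) (SL-S β refl sl′ p))
  where
  sl′ : SL (parts β) α
  sl′ = subst (λ ℓ → SL ℓ α) (sym (trans (sym (ListP.map-id (parts β))) e)) sl
...       | r′ , γ , sl″ , p′ with trans (sym (SL-length sl″)) (SL-length sl′)
  where
  sl′ : SL (parts β) α
  sl′ = subst (λ ℓ → SL ℓ α) (sym (trans (sym (ListP.map-id (parts β))) e)) sl
...         | refl with padded-injective p′ (padded-swapAt j j<r p)
...           | refl = subst (λ ℓ → SL ℓ (swapAt j α)) (trans (sym (ListP.map-id (parts β))) e) sl″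

-- The combinatorics of SL

data Step : ∀ {r} → Vec ℕ r → Vec ℕ r → Set where
  here  : ∀ {r p q p′ q′} {v : Vec ℕ r} → p + q ≡ p′ + q′ → p ≤ p′ → p′ ≤ q → Step (p ∷ q ∷ v) (p′ ∷ q′ ∷ v)
  there : ∀ {r x} {v v′ : Vec ℕ r} → Step v v′ → Step (x ∷ v) (x ∷ v′)

br-ascending : ∀ {p p₀ ℓ ms t} → Br p ℓ ms t → p₀ ≤ p → Ascending p₀ ms
br-ascending [] _ = []
br-ascending (row κ t ε refl refl _ p≤κ _ ε≤t b) q =
  ≤-trans (≤-trans q p≤κ) (m≤m+n κ ε) ∷ br-ascending b (+-monoʳ-≤ κ ε≤t)

-- By symmetry a third variable can be brought to the front and peeled off, which changes the
-- partition but not the pair. In the end two variables and two rows remain, where `SL` is explicit.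
SL-between : ∀ {r ℓ p q p′ q′} (v : Vec ℕ r) → Ascending 0 ℓ → p + q ≡ p′ + q′ → p ≤ p′ → p′ ≤ q →
             SL ℓ (p ∷ q ∷ v) → SL ℓ (p′ ∷ q′ ∷ v)
SL-between {ℓ = ℓ} {p} {q} {p′} {q′} (x ∷ v) asc e l u sl =
  SL-swap 1 asc (SL-swap 0 asc (behind (SL-swap 0 asc (SL-swap 1 asc sl))))
  where
  behind : SL ℓ (x ∷ p ∷ q ∷ v) → SL ℓ (x ∷ p′ ∷ q′ ∷ v)
  behind (peel b e′ sl) = peel b e′ (SL-between v (br-ascending b z≤n) e l u sl)
SL-between {p′ = p′} {q′ = q′} [] asc e l u
        (peel {l = l₁} (row {l = l₂} κ t ε refl refl refl l₁≤κ ε≤1 ε≤t []) refl (peel [] refl [])) =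
  peel (row κ′ t′ ε total refl refl l₁≤κ′ ε≤1 ε≤t′ []) a′≡ (peel [] b′≡ [])
  where
  -- `ε` is kept, since it is the excess of the sum of both entries over the sum of both rows; `t′`
  -- and `κ′` are then forced. The bound `l` on `p′` yields `ε ≤ t′`, and the bound `u` yields
  -- `l₁ ≤ κ′`.
  t′ = p′ ∸ l₁
  κ′ = q′ ∸ ε
  t+l₁≤p′ : t + l₁ ≤ p′
  t+l₁≤p′ = ≤-trans (≤-reflexive (trans (+-comm t l₁) (cong (l₁ +_) (sym (+-identityʳ t))))) l
  t≤t′ : t ≤ t′
  t≤t′ = ℕP.m+n≤o⇒m≤o∸n t t+l₁≤p′
  ε≤t′ : ε ≤ t′
  ε≤t′ = ≤-trans ε≤t t≤t′
  p≤q′ : l₁ + (t + 0) ≤ q′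
  p≤q′ = ℕP.+-cancelʳ-≤ p′ (l₁ + (t + 0)) q′ (≤-trans (+-monoʳ-≤ (l₁ + (t + 0)) u)
           (≤-reflexive (trans e (+-comm p′ q′))))
  l₁+ε≤q′ : l₁ + ε ≤ q′
  l₁+ε≤q′ = ≤-trans (+-monoʳ-≤ l₁ (≤-trans ε≤t (m≤m+n t 0))) p≤q′
  l₁≤κ′ : l₁ ≤ κ′
  l₁≤κ′ = ℕP.m+n≤o⇒m≤o∸n l₁ l₁+ε≤q′
  q′≡ : q′ ≡ κ′ + ε
  q′≡ = sym (ℕP.m∸n+n≡m (≤-trans (m≤n+m ε l₁) l₁+ε≤q′))
  p′≡ : p′ ≡ t′ + l₁
  p′≡ = sym (ℕP.m∸n+n≡m (≤-trans (m≤n+m l₁ t) t+l₁≤p′))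
  a′≡ : p′ ≡ l₁ + (t′ + 0)
  a′≡ = trans p′≡ (trans (+-comm t′ l₁) (cong (l₁ +_) (sym (+-identityʳ t′))))
  b′≡ : q′ ≡ κ′ + ε + 0
  b′≡ = trans q′≡ (sym (+-identityʳ _))
  total : κ + t ≡ κ′ + t′
  total = ℕP.+-cancelʳ-≡ (l₁ + ε) (κ + t) (κ′ + t′) (trans (left l₁ t κ ε) (trans e (trans (cong₂ _+_ p′≡ q′≡) (right t′ l₁ κ′ ε))))
    where
    left : ∀ l₁ t κ ε → κ + t + (l₁ + ε) ≡ l₁ + (t + 0) + (κ + ε + 0)
    left = ℕS.solve-∀
    right : ∀ t l₁ κ ε → t + l₁ + (κ + ε) ≡ κ + t + (l₁ + ε)
    right = ℕS.solve-∀

SL-step : ∀ {r ℓ} {α α′ : Vec ℕ r} → Ascending 0 ℓ → Step α α′ → SL ℓ α → SL ℓ α′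
SL-step asc (here {v = v} e l u) sl = SL-between v asc e l u sl
SL-step asc (there s) (peel b e sl) = peel b e (SL-step (br-ascending b z≤n) s sl)

-- Reversing vectors, and boxes above a partition

end : ∀ {A : Set} {r} → Vec A (suc r) → A
end (x ∷ [])    = x
end (x ∷ y ∷ v) = end (y ∷ v)

front : ∀ {A : Set} {r} → Vec A (suc r) → Vec A r
front (x ∷ [])    = []
front (x ∷ y ∷ v) = x ∷ front (y ∷ v)

rev : ∀ {A : Set} {r} → Vec A r → Vec A r
rev {r = zero}  v = []
rev {r = suc r} v = end v ∷ rev (front v)

module _ {A : Set} where

  SwapClosed : ∀ {r} → (Vec A r → Set) → Set
  SwapClosed C = ∀ j {v} → C v → C (swapAt j v)

  swapClosed-tail : ∀ {r} (C : Vec A (suc r) → Set) x → SwapClosed C → SwapClosed (λ v → C (x ∷ v))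
  swapClosed-tail C x closed j = closed (suc j)

  move-to-end : ∀ {r} (C : Vec A (suc r) → Set) → SwapClosed C → ∀ v → C (end v ∷ front v) → C v
  move-to-end C closed (x ∷ [])    c = c
  move-to-end C closed (x ∷ y ∷ v) c =
    move-to-end (λ u → C (x ∷ u)) (swapClosed-tail C x closed) (y ∷ v) (closed 0 c)

  unreverse : ∀ {r} (C : Vec A r → Set) → SwapClosed C → ∀ v → C (rev v) → C v
  unreverse {zero}  C closed [] c = c
  unreverse {suc r} C closed v  c = move-to-end C closed v
    (unreverse (λ u → C (end v ∷ u)) (swapClosed-tail C (end v) closed) (front v) c)

-- In increasing order, `l + List.length ℓ` is the bound λ_j + j - 1; the minimum over j follows
-- because the entries ascend.
data Box : ℕ → ∀ {r} → List ℕ → Vec ℕ r → Set where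
  []  : ∀ {p} → Box p [] []
  box : ∀ {p r l ℓ n} {ns : Vec ℕ r} → p ≤ n → l ≤ n → n ≤ l + List.length ℓ → Box n ℓ ns →
        Box p (l ∷ ℓ) (n ∷ ns)

-- Peel the largest entry: every row drops to the next smaller part, and gets one box back if it needs it.
box-peel : ∀ {r p ℓ n} {ns : Vec ℕ r} → Ascending p ℓ → p ≤ n → n ≤ p + List.length ℓ → Box n ℓ ns →
           ∃ λ ms → ∃ λ t → Br p ℓ ms t × (∀ {q} → q ≤ n → Box q ms (front (n ∷ ns))) × end (n ∷ ns) ≡ p + t
box-peel {p = p} [] p≤n n≤p [] = [] , 0 , [] , (λ _ → []) ,
  ℕP.≤-antisym n≤p (≤-trans (≤-reflexive (+-identityʳ p)) p≤n)
box-peel {p = p} {n = n} {ns = _ ∷ ns} (_∷_ {l = l} {ℓ = ℓ} p≤l asc) p≤n n≤ (box {n = n′} n≤n′ l≤n′ n′≤ b)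
  with box-peel asc l≤n′ n′≤ b
... | ms , t , br , boxes , e = choose
  where
  lengths : List.length ms ≡ List.length ℓ
  lengths = br-length br
  Goal = ∃ λ ms → ∃ λ t → Br p (l ∷ ℓ) ms t
           × (∀ {q} → q ≤ n → Box q ms (n ∷ front (n′ ∷ ns))) × end (n′ ∷ ns) ≡ p + t
  build : ∀ ε → ε ≤ 1 → ε ≤ l ∸ p → p + ε ≤ n → n ≤ p + ε + List.length ms → Goal
  build ε ε≤1 ε≤t m≤n n≤m = (p + ε) ∷ ms , (l ∸ p) + t ,
    row p (l ∸ p) ε (sym (ℕP.m+[n∸m]≡n p≤l)) refl refl ≤-refl ε≤1 ε≤t br ,
    (λ q≤n → box q≤n m≤n n≤m (boxes n≤n′)) ,
    trans e (trans (cong (_+ t) (sym (ℕP.m+[n∸m]≡n p≤l))) (+-assoc p (l ∸ p) t))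
  choose : Goal
  -- Peeling leaves one row fewer, so the permitted excess shrinks by one, and a returned box makes
  -- up for it. None is needed if `p ≡ n`. None can return if `p ≡ l`, but then
  -- `n ≤ n′ ≤ l + List.length ℓ` is already strong enough.
  choose with ℕP.m≤n⇒m<n∨m≡n p≤n | ℕP.m≤n⇒m<n∨m≡n p≤l
  ... | inj₂ refl | _ = build 0 z≤n z≤n (≤-reflexive (+-identityʳ p))
          (≤-trans (m≤m+n p 0) (m≤m+n (p + 0) (List.length ms)))
  ... | inj₁ _ | inj₂ refl = build 0 z≤n z≤n (≤-trans (≤-reflexive (+-identityʳ p)) p≤n)
          (≤-trans n≤n′ (≤-trans n′≤ (≤-reflexive (cong₂ _+_ (sym (+-identityʳ p)) (sym lengths)))))
  ... | inj₁ p<n | inj₁ p<l = build 1 ≤-refl (ℕP.m<n⇒0<n∸m p<l) (≤-trans (≤-reflexive (+-comm p 1)) p<n)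
          (≤-trans n≤ (≤-reflexive (trans (cong (λ k → p + suc k) (sym lengths)) (sym (+-assoc p 1 _)))))

box-SL-reverse : ∀ {r ℓ} {ν : Vec ℕ r} → Ascending 0 ℓ → Box 0 ℓ ν → SL ℓ (rev ν)
box-SL-reverse {zero} [] [] = []
box-SL-reverse {suc r} (_ ∷ asc) (box _ l≤n n≤ b) with box-peel asc l≤n n≤ b
... | ms , t , br , boxes , e = peel br e (box-SL-reverse (br-ascending br z≤n) (boxes z≤n))

-- `box-peel` takes the entries from the largest down, which gives the reversed vector; symmetry
-- turns it round.
box-SL : ∀ {r ℓ} {ν : Vec ℕ r} → Ascending 0 ℓ → Box 0 ℓ ν → SL ℓ ν
box-SL {ℓ = ℓ} {ν} asc b = unreverse (SL ℓ) (λ j → SL-swap j asc) ν (box-SL-reverse asc b)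

capHead : ℕ → List ℕ → ℕ
capHead l []       = l
capHead l (l′ ∷ ℓ) = (l + suc (List.length ℓ)) ℕ.⊓ capHead l′ ℓ

-- The largest vector of a Box, i.e. the partition indexing the top-degree Schur component.
caps : List ℕ → List ℕ
caps []      = []
caps (l ∷ ℓ) = capHead l ℓ ∷ caps ℓ

-- Bounds on partial sums of exponents

sumN : ∀ {r} → Vec Bool r → Vec ℕ r → ℕ
sumN []          []      = 0
sumN (true ∷ I)  (a ∷ α) = a + sumN I α
sumN (false ∷ I) (a ∷ α) = sumN I α

lowSum : ℕ → List ℕ → ℕ
lowSum k xs = sum (List.take k xs)

highSum : ℕ → List ℕ → ℕ
highSum k xs = sum (List.drop (List.length xs ∸ k) xs)

count-≤ : ∀ {r} (I : Vec Bool r) → count I ≤ r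
count-≤ []          = z≤n
count-≤ (true ∷ I)  = s≤s (count-≤ I)
count-≤ (false ∷ I) = ℕP.m≤n⇒m≤1+n (count-≤ I)

br-low : ∀ {p ℓ ms t} k → Br p ℓ ms t → k ≤ List.length ms → lowSum k (p ∷ ℓ) ≤ lowSum k ms
br-low zero    _ _ = z≤n
br-low (suc k) (row κ t ε refl refl _ p≤κ _ _ b) (s≤s k≤) =
  +-mono-≤ (≤-trans p≤κ (m≤m+n κ ε)) (br-low k b k≤)

br-low-+ : ∀ {p ℓ ms t} k → Br p ℓ ms t → lowSum k ℓ ≤ t + lowSum k ms
br-low-+ zero    _  = z≤n
br-low-+ (suc k) [] = z≤n
br-low-+ (suc k) (row {ℓ = ℓ} {ms = ms} {a = a} κ t ε refl refl refl _ _ _ b) = begin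
  κ + t + lowSum k ℓ             ≤⟨ +-monoʳ-≤ (κ + t) (br-low-+ k b) ⟩
  κ + t + (a + lowSum k ms)      ≤⟨ +-monoʳ-≤ (κ + t) (m≤n+m _ ε) ⟩
  κ + t + (ε + (a + lowSum k ms)) ≡⟨ lemma κ t ε a (lowSum k ms) ⟩
  t + a + (κ + ε + lowSum k ms)  ∎
  where
  open ℕP.≤-Reasoning
  lemma : ∀ κ t ε a x → κ + t + (ε + (a + x)) ≡ t + a + (κ + ε + x)
  lemma = ℕS.solve-∀

-- If the first variable is outside `I`, interlacing makes the new rows dominate the old ones,
-- shortest included. If it is inside, its exponent pays for the shortest row and for every box
-- taken from the others.
SL-lower : ∀ {r ℓ} {α : Vec ℕ r} → SL ℓ α → ∀ I → lowSum (count I) ℓ ≤ sumN I α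
SL-lower [] [] = z≤n
SL-lower (peel {ms = ms} {α = α} b refl sl) (false ∷ I) = ≤-trans
  (br-low (count I) b (≤-trans (count-≤ I) (≤-reflexive (sym (SL-length sl)))))
  (SL-lower sl I)
SL-lower (peel {l = l} {ms = ms} {t = t} b refl sl) (true ∷ I) = ≤-trans
  (+-monoʳ-≤ l (br-low-+ (count I) b))
  (≤-trans (≤-reflexive (sym (+-assoc l t _))) (+-monoʳ-≤ (l + t) (SL-lower sl I)))

highSum-keep : ∀ k x xs → k ≤ List.length xs → highSum k (x ∷ xs) ≡ highSum k xs
highSum-keep k x xs k≤ rewrite ℕP.+-∸-assoc 1 k≤ = refl

highSum-all : ∀ k xs → k ≡ List.length xs → highSum k xs ≡ sum xs
highSum-all k xs refl rewrite ℕP.n∸n≡0 (List.length xs) = refl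

length-caps : ∀ ℓ → List.length (caps ℓ) ≡ List.length ℓ
length-caps []      = refl
length-caps (l ∷ ℓ) = cong suc (length-caps ℓ)

capHead-≤ : ∀ l ℓ → capHead l ℓ ≤ l + List.length ℓ
capHead-≤ l []       = m≤m+n l 0
capHead-≤ l (l′ ∷ ℓ) = ℕP.m⊓n≤m _ _

br-capHead : ∀ {p ℓ ms t l m} → Br p ℓ ms t → m ≤ l → capHead m ms ≤ capHead l ℓ
br-capHead [] m≤l = m≤l
br-capHead (row κ t ε refl refl _ _ _ ε≤t b) m≤l = ℕP.⊓-mono-≤
  (+-mono-≤ m≤l (s≤s (≤-reflexive (br-length b)))) (br-capHead b (+-monoʳ-≤ κ ε≤t))

br-high : ∀ {p ℓ ms t} k → Br p ℓ ms t → highSum k (caps ms) ≤ highSum k (caps ℓ)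
br-high {ℓ = ℓ} {ms} k b rewrite length-caps ms | length-caps ℓ | br-length b = drops (List.length ℓ ∸ k) b
  where
  drops : ∀ {p ℓ ms t} j → Br p ℓ ms t → sum (List.drop j (caps ms)) ≤ sum (List.drop j (caps ℓ))
  drops zero    [] = z≤n
  drops (suc j) [] = z≤n
  drops zero    (row κ t ε refl refl _ _ _ ε≤t b) =
    +-mono-≤ (br-capHead b (+-monoʳ-≤ κ ε≤t)) (drops zero b)
  drops (suc j) (row _ _ _ _ _ _ _ _ _ b) = drops j b

-- While a row stays outside the top sum, the first row drops out and `p ≤ κ` passes the estimate on
-- to the next row, `l = κ + t`. When all rows count, `capHead p` is a minimum: its first term
-- suffices because a row regains at most one box, its second because caps are monotone under
-- branching.
br-high-+ : ∀ {p ℓ ms t} k → Br p ℓ ms t → k ≤ List.length ℓ →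
            p + t + highSum k (caps ms) ≤ highSum (suc k) (caps (p ∷ ℓ))
br-high-+ {p} .0 [] z≤n = ≤-reflexive (+-identityʳ (p + 0))
br-high-+ {p} k (row {l = l} {m} {ℓ} {ms} {a} κ t ε refl refl refl p≤κ ε≤1 ε≤t b) k≤ with ℕP.m≤n⇒m<n∨m≡n k≤
... | inj₁ (s≤s k≤ℓ) = begin
  p + (t + a) + highSum k (caps (m ∷ ms))
    ≡⟨ cong (p + (t + a) +_) (highSum-keep k (capHead m ms) (caps ms)
         (subst (k ≤_) (sym (trans (length-caps ms) (br-length b))) k≤ℓ)) ⟩
  p + (t + a) + highSum k (caps ms)
    ≤⟨ ℕP.+-monoˡ-≤ (highSum k (caps ms)) (ℕP.+-monoˡ-≤ (t + a) p≤κ) ⟩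
  κ + (t + a) + highSum k (caps ms)
    ≡⟨ cong (_+ highSum k (caps ms)) (sym (+-assoc κ t a)) ⟩
  κ + t + a + highSum k (caps ms)
    ≤⟨ br-high-+ k b k≤ℓ ⟩
  highSum (suc k) (caps (l ∷ ℓ))
    ≡⟨ highSum-keep (suc k) (capHead p (l ∷ ℓ)) (caps (l ∷ ℓ))
         (s≤s (subst (k ≤_) (sym (length-caps ℓ)) k≤ℓ)) ⟨
  highSum (suc k) (caps (p ∷ l ∷ ℓ)) ∎
  where open ℕP.≤-Reasoning
... | inj₂ refl = begin
  p + (t + a) + highSum k (caps (m ∷ ms))
    ≡⟨ cong (p + (t + a) +_) (highSum-all k (caps (m ∷ ms)) (cong suc (sym (trans (length-caps ms) (br-length b))))) ⟩
  p + (t + a) + (capHead m ms + sum (caps ms))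
    ≡⟨ regroup p t a (capHead m ms) (sum (caps ms)) ⟩
  p + t + capHead m ms + (a + sum (caps ms))
    ≤⟨ ℕP.+-monoˡ-≤ _ heads ⟩
  κ + t + capHead p (l ∷ ℓ) + (a + sum (caps ms))
    ≡⟨ regroup′ (κ + t) (capHead p (l ∷ ℓ)) a (sum (caps ms)) ⟩
  capHead p (l ∷ ℓ) + (κ + t + a + sum (caps ms))
    ≤⟨ +-monoʳ-≤ (capHead p (l ∷ ℓ)) total ⟩
  sum (caps (p ∷ l ∷ ℓ))
    ≡⟨ highSum-all (suc k) (caps (p ∷ l ∷ ℓ)) (cong (2 +_) (sym (length-caps ℓ))) ⟨
  highSum (suc k) (caps (p ∷ l ∷ ℓ)) ∎
  where
  open ℕP.≤-Reasoning
  regroup : ∀ p t a c s → p + (t + a) + (c + s) ≡ p + t + c + (a + s)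
  regroup = ℕS.solve-∀
  regroup′ : ∀ x c a s → x + c + (a + s) ≡ c + (x + a + s)
  regroup′ = ℕS.solve-∀
  total : κ + t + a + sum (caps ms) ≤ sum (caps (l ∷ ℓ))
  total = subst₂ _≤_
    (cong (κ + t + a +_) (highSum-all (List.length ℓ) (caps ms) (sym (trans (length-caps ms) (br-length b)))))
    (highSum-all (suc (List.length ℓ)) (caps (l ∷ ℓ)) (cong suc (sym (length-caps ℓ))))
    (br-high-+ (List.length ℓ) b ≤-refl)
  p+t≤ : p + t ≤ κ + t
  p+t≤ = ℕP.+-monoˡ-≤ t p≤κ
  first : p + t + capHead m ms ≤ κ + t + (p + suc (List.length ℓ))
  first = ≤-trans (+-monoʳ-≤ (p + t) (≤-trans (capHead-≤ m ms)
      (+-mono-≤ (+-monoʳ-≤ κ ε≤1) (≤-reflexive (br-length b)))))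
    (≤-reflexive (arrange p t κ (List.length ℓ)))
    where
    arrange : ∀ p t κ n → p + t + (κ + 1 + n) ≡ κ + t + (p + suc n)
    arrange = ℕS.solve-∀
  heads : p + t + capHead m ms ≤ κ + t + capHead p (l ∷ ℓ)
  heads with ℕP.⊓-sel (p + suc (List.length ℓ)) (capHead l ℓ)
  ... | inj₁ e = subst (λ c → p + t + capHead m ms ≤ κ + t + c) (sym e) first
  ... | inj₂ e = subst (λ c → p + t + capHead m ms ≤ κ + t + c) (sym e)
                   (+-mono-≤ p+t≤ (br-capHead b (+-monoʳ-≤ κ ε≤t)))

SL-upper : ∀ {r ℓ} {α : Vec ℕ r} → SL ℓ α → ∀ I → sumN I α ≤ highSum (count I) (caps ℓ)
SL-upper [] [] = z≤n
SL-upper (peel {l = l} {ℓ = ℓ} {ms = ms} b refl sl) (false ∷ I) = begin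
  sumN I _                            ≤⟨ SL-upper sl I ⟩
  highSum (count I) (caps ms)            ≤⟨ br-high (count I) b ⟩
  highSum (count I) (caps ℓ)             ≡⟨ highSum-keep (count I) (capHead l ℓ) (caps ℓ) bound ⟨
  highSum (count I) (caps (l ∷ ℓ))  ∎
  where
  open ℕP.≤-Reasoning
  bound : count I ≤ List.length (caps ℓ)
  bound = ≤-trans (count-≤ I) (≤-reflexive (sym (trans (length-caps ℓ) (trans (sym (br-length b)) (SL-length sl)))))
SL-upper (peel {l = l} {ℓ = ℓ} {ms = ms} {t = t} b refl sl) (true ∷ I) = ≤-trans
  (+-monoʳ-≤ (l + t) (SL-upper sl I))
  (br-high-+ (count I) b (≤-trans (count-≤ I) (≤-reflexive (trans (sym (SL-length sl)) (br-length b)))))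

-- Majorization in an ordered abelian group

complement : ∀ {r} → Vec Bool r → Vec Bool r
complement = Vec.map not

count-complement : ∀ {r} (I : Vec Bool r) → count I + count (complement I) ≡ r
count-complement []          = refl
count-complement (true ∷ I)  = cong suc (count-complement I)
count-complement (false ∷ I) = trans (+-suc (count I) _) (cong suc (count-complement I))

count-true : ∀ r → count (replicate r true) ≡ r
count-true zero    = refl
count-true (suc r) = cong suc (count-true r)

count-false : ∀ r → count (replicate r false) ≡ 0
count-false zero    = refl
count-false (suc r) = count-false r

record OrderedGroup : Set₁ where
  infixl 6 _⊕_
  infix  8 ⊖_
  infix  4 _≼_
  field
    Carrier        : Set
    _⊕_            : Carrier → Carrier → Carrier
    0#             : Carrier
    ⊖_             : Carrier → Carrier
    _≼_            : Carrier → Carrier → Set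
    isAbelianGroup : IsAbelianGroup _≡_ _⊕_ 0# ⊖_
    isTotalOrder   : IsTotalOrder _≡_ _≼_
    ⊕-monoʳ-≼      : ∀ z {x y} → x ≼ y → z ⊕ x ≼ z ⊕ y
    ι              : ℕ → Carrier
    ι-0            : ι 0 ≡ 0#
    ι-+            : ∀ m n → ι (m + n) ≡ ι m ⊕ ι n

  open IsAbelianGroup isAbelianGroup public using (assoc; comm; identityˡ; identityʳ; inverseˡ; inverseʳ)
  open IsTotalOrder isTotalOrder public using (total) renaming (trans to ≼-trans; reflexive to ≼-reflexive; antisym to ≼-antisym; refl to ≼-refl)

  sub-add : ∀ x y → (x ⊕ ⊖ y) ⊕ y ≡ x
  sub-add x y = trans (assoc x (⊖ y) y) (trans (cong (x ⊕_) (inverseˡ y)) (identityʳ x))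

  add-sub : ∀ x y → y ⊕ (x ⊕ ⊖ y) ≡ x
  add-sub x y = trans (comm y (x ⊕ ⊖ y)) (sub-add x y)

  cancelˡ : ∀ z x → ⊖ z ⊕ (z ⊕ x) ≡ x
  cancelˡ z x = trans (sym (assoc (⊖ z) z x)) (trans (cong (_⊕ x) (inverseˡ z)) (identityˡ x))

  ⊕-cancelˡ : ∀ z {x y} → z ⊕ x ≡ z ⊕ y → x ≡ y
  ⊕-cancelˡ z {x} {y} e = trans (sym (cancelˡ z x)) (trans (cong (⊖ z ⊕_) e) (cancelˡ z y))

  ⊕-cancelˡ-≼ : ∀ z {x y} → z ⊕ x ≼ z ⊕ y → x ≼ y
  ⊕-cancelˡ-≼ z {x} {y} le = subst₂ _≼_ (cancelˡ z x) (cancelˡ z y) (⊕-monoʳ-≼ (⊖ z) le)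

  ⊕-cancelʳ-≼ : ∀ z {x y} → x ⊕ z ≼ y ⊕ z → x ≼ y
  ⊕-cancelʳ-≼ z {x} {y} le = ⊕-cancelˡ-≼ z (subst₂ _≼_ (comm x z) (comm y z) le)

  swap-last : ∀ x y z → (x ⊕ y) ⊕ z ≡ (x ⊕ z) ⊕ y
  swap-last x y z = trans (assoc x y z) (trans (cong (x ⊕_) (comm y z)) (sym (assoc x z y)))

module Majorization (G : OrderedGroup) where
  open OrderedGroup G

  total-sum : ∀ {r} → Vec Carrier r → Carrier
  total-sum []      = 0#
  total-sum (x ∷ v) = x ⊕ total-sum v

  prefix : ∀ {r} → ℕ → Vec Carrier r → Carrier
  prefix zero    v       = 0#
  prefix (suc k) []      = 0#
  prefix (suc k) (x ∷ v) = x ⊕ prefix k v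

  sumOn : ∀ {r} → Vec Bool r → Vec Carrier r → Carrier
  sumOn []          []      = 0#
  sumOn (true ∷ I)  (x ∷ v) = x ⊕ sumOn I v
  sumOn (false ∷ I) (x ∷ v) = sumOn I v

  sumOn-true : ∀ {r} (v : Vec Carrier r) → sumOn (replicate r true) v ≡ total-sum v
  sumOn-true []      = refl
  sumOn-true (x ∷ v) = cong (x ⊕_) (sumOn-true v)

  sumOn-false : ∀ {r} (v : Vec Carrier r) → sumOn (replicate r false) v ≡ 0#
  sumOn-false []      = refl
  sumOn-false (x ∷ v) = sumOn-false v

  sumOn-complement : ∀ {r} I (v : Vec Carrier r) → sumOn I v ⊕ sumOn (complement I) v ≡ total-sum v
  sumOn-complement []          []      = identityˡ 0#
  sumOn-complement (true ∷ I)  (x ∷ v) = trans (assoc x _ _) (cong (x ⊕_) (sumOn-complement I v))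
  sumOn-complement (false ∷ I) (x ∷ v) = trans (sym (assoc (sumOn I v) x _))
    (trans (cong (_⊕ sumOn (complement I) v) (comm (sumOn I v) x))
    (trans (assoc x _ _) (cong (x ⊕_) (sumOn-complement I v))))

  data Move : ∀ {r} → Vec Carrier r → Vec Carrier r → Set where
    here  : ∀ {r p q p′ q′} {v : Vec Carrier r} → p ⊕ q ≡ p′ ⊕ q′ → p ≼ p′ → p′ ≼ q →
            Move (p ∷ q ∷ v) (p′ ∷ q′ ∷ v)
    there : ∀ {r x} {v v′ : Vec Carrier r} → Move v v′ → Move (x ∷ v) (x ∷ v′)

  Closed : ∀ {r} → (Vec Carrier r → Set) → Set
  Closed C = ∀ {v v′} → Move v v′ → C v → C v′

  -- What remains of a vector once `a` has been taken out: the first adjacent pair `p`, `q` with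
  -- `a ≼ q` is traded for `a` and `p + q − a`.
  merge : ∀ {r} → Carrier → Vec Carrier (suc r) → Vec Carrier r
  merge a (p ∷ [])    = []
  merge a (p ∷ q ∷ ν) with total a q
  ... | inj₁ _ = ((p ⊕ q) ⊕ ⊖ a) ∷ ν
  ... | inj₂ _ = p ∷ merge a (q ∷ ν)

  private
    -- The second condition bounds `a` by the last entry; if `merge` gets that far, `a` is that
    -- entry.
    Fits : ∀ {r} → Carrier → Vec Carrier (suc r) → Set
    Fits {r} a ν = Vec.head ν ≼ a × prefix r ν ⊕ a ≼ total-sum ν

    fits-singleton : ∀ {a p} → Fits a (p ∷ []) → a ≡ p
    fits-singleton {a} {p} (p≼a , a≼p) = ≼-antisym (subst₂ _≼_ (identityˡ a) (identityʳ p) a≼p) p≼a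

    fits-tail : ∀ {r a p q} (ν : Vec Carrier r) → Fits a (p ∷ q ∷ ν) → q ≼ a → Fits a (q ∷ ν)
    fits-tail {a = a} {p} {q} ν (_ , le) q≼a = q≼a ,
      ⊕-cancelˡ-≼ p (subst (_≼ p ⊕ total-sum (q ∷ ν)) (assoc p _ a) le)

  merge-closed : ∀ {r} (C : Vec Carrier (suc r) → Set) → Closed C → ∀ a ν → Fits a ν → C ν → C (a ∷ merge a ν)
  merge-closed C closed a (p ∷ []) fits c = subst (λ x → C (x ∷ [])) (sym (fits-singleton fits)) c
  merge-closed C closed a (p ∷ q ∷ ν) fits c with total a q
  ... | inj₁ a≼q = closed (here (sym (add-sub (p ⊕ q) a)) (proj₁ fits) a≼q) c
  ... | inj₂ q≼a = closed (here (comm p a) (proj₁ fits) ≼-refl)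
        (merge-closed (λ v → C (p ∷ v)) (λ m → closed (there m)) a (q ∷ ν) (fits-tail ν fits q≼a) c)

  prefix-[] : ∀ k → prefix k [] ≡ 0#
  prefix-[] zero    = refl
  prefix-[] (suc k) = refl

  -- Before the transfer a prefix is untouched; after it, the prefix is one entry longer with `a`
  -- removed. In `majorize` the two cases call for the hypothesis at a set without and with the
  -- first coordinate.
  merge-prefix : ∀ {r} a (ν : Vec Carrier (suc r)) → Fits a ν → ∀ m →
                 prefix m (merge a ν) ≡ prefix m ν ⊎ prefix m (merge a ν) ⊕ a ≡ prefix (suc m) ν
  merge-prefix a ν fits zero = inj₁ refl
  merge-prefix a (p ∷ []) fits (suc m) =
    inj₂ (trans (comm 0# a) (cong (_⊕ 0#) (fits-singleton fits)))
  merge-prefix a (p ∷ q ∷ ν) fits (suc m) with total a q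
  ... | inj₁ _ = inj₂ (trans (swap-last ((p ⊕ q) ⊕ ⊖ a) (prefix m ν) a)
                   (trans (cong (_⊕ prefix m ν) (sub-add (p ⊕ q) a)) (assoc p q _)))
  ... | inj₂ q≼a with merge-prefix a (q ∷ ν) (fits-tail ν fits q≼a) m
  ...   | inj₁ e = inj₁ (cong (p ⊕_) e)
  ...   | inj₂ e = inj₂ (trans (assoc p _ a) (cong (p ⊕_) e))

  merge-total : ∀ {r} a (ν : Vec Carrier (suc r)) → Fits a ν → a ⊕ total-sum (merge a ν) ≡ total-sum ν
  merge-total a (p ∷ []) fits = cong (_⊕ 0#) (fits-singleton fits)
  merge-total a (p ∷ q ∷ ν) fits with total a q
  ... | inj₁ _ = trans (sym (assoc a _ _)) (trans (cong (_⊕ total-sum ν) (add-sub (p ⊕ q) a)) (assoc p q _))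
  ... | inj₂ q≼a = trans (sym (assoc a p _)) (trans (cong (_⊕ total-sum (merge a (q ∷ ν))) (comm a p))
        (trans (assoc p a _) (cong (p ⊕_) (merge-total a (q ∷ ν) (fits-tail ν fits q≼a)))))

  -- Hardy–Littlewood–Pólya: match the first coordinate of t by one transfer, then recurse on the others.
  majorize : ∀ {r} (C : Vec Carrier r → Set) → Closed C → ∀ ν t →
             (∀ I → prefix (count I) ν ≼ sumOn I t) → total-sum t ≡ total-sum ν → C ν → C t
  majorize C closed [] [] _ _ c = c
  majorize {suc r} C closed (p ∷ ν) (a ∷ t) lower eq c =
    majorize (λ v → C (a ∷ v)) (λ m → closed (there m)) (merge a (p ∷ ν)) t lower′ eq′
      (merge-closed C closed a (p ∷ ν) fits c)
    where
    p≼a : p ≼ a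
    p≼a = subst₂ _≼_
      (trans (cong (λ k → p ⊕ prefix k ν) (count-false r)) (identityʳ p))
      (trans (cong (a ⊕_) (sumOn-false t)) (identityʳ a)) (lower (true ∷ replicate r false))
    fits : Fits a (p ∷ ν)
    fits = p≼a , subst₂ _≼_ (comm a _) eq (⊕-monoʳ-≼ a (subst₂ (λ k s → prefix k (p ∷ ν) ≼ s)
      (count-true r) (sumOn-true t) (lower (false ∷ replicate r true))))
    lower′ : ∀ I → prefix (count I) (merge a (p ∷ ν)) ≼ sumOn I t
    lower′ I with merge-prefix a (p ∷ ν) fits (count I)
    ... | inj₁ e = subst (_≼ sumOn I t) (sym e) (lower (false ∷ I))
    ... | inj₂ e = ⊕-cancelˡ-≼ a (subst (_≼ a ⊕ sumOn I t) (trans (sym e) (comm _ a)) (lower (true ∷ I)))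
    eq′ : total-sum t ≡ total-sum (merge a (p ∷ ν))
    eq′ = ⊕-cancelˡ a (trans eq (sym (merge-total a (p ∷ ν) fits)))

  data Caps : ∀ {r} → List ℕ → Vec Carrier r → Set where
    []  : Caps [] []
    _∷_ : ∀ {r us} {ν : Vec Carrier r} u → Caps us ν → Caps (u ∷ us) (ι u ∷ ν)

  -- The most spread-out vectors within the bounds: lower bounds, then at most one free entry, then
  -- caps. Their prefix sums are the least that the bounds permit for the given total.
  data Threshold : ∀ {r} → List ℕ → List ℕ → Vec Carrier r → Set where
    []    : Threshold [] [] []
    fixed : ∀ {r l u ℓ us} {ν : Vec Carrier r} → Threshold ℓ us ν → Threshold (l ∷ ℓ) (u ∷ us) (ι l ∷ ν)
    bend  : ∀ {r l u d ℓ us} {ν : Vec Carrier r} → ι l ≼ d → d ≼ ι u → Caps us ν → Threshold (l ∷ ℓ) (u ∷ us) (d ∷ ν)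

  capVec : ∀ us → ∃ λ (ν : Vec Carrier (List.length us)) → Caps us ν
  capVec []       = [] , []
  capVec (u ∷ us) = ι u ∷ proj₁ (capVec us) , u ∷ proj₂ (capVec us)

  caps-total : ∀ {r us} {ν : Vec Carrier r} → Caps us ν → total-sum ν ≡ ι (sum us)
  caps-total []      = sym ι-0
  caps-total (u ∷ c) = trans (cong (ι u ⊕_) (caps-total c)) (sym (ι-+ u _))

  caps-prefix : ∀ {r us} {ν : Vec Carrier r} → Caps us ν → ∀ k → prefix k ν ⊕ ι (sum (List.drop k us)) ≡ ι (sum us)
  caps-prefix c       zero    = identityˡ _
  caps-prefix []      (suc k) = identityˡ _
  caps-prefix (u ∷ c) (suc k) = trans (assoc (ι u) _ _) (trans (cong (ι u ⊕_) (caps-prefix c k)) (sym (ι-+ u _)))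

  -- The bend is the first row at which `l` and all later caps fit into what is left of `D`; that
  -- entry takes the surplus. Up to it prefix sums are those of the lower bounds, beyond it they are
  -- `D` less the remaining caps.
  fill : ∀ ℓ us → List.length ℓ ≡ List.length us → ∀ D → ι (sum ℓ) ≼ D → D ≼ ι (sum us) →
         ∃ λ (ν : Vec Carrier (List.length us)) → Threshold ℓ us ν × total-sum ν ≡ D ×
           (∀ k → prefix k ν ≡ ι (lowSum k ℓ) ⊎ prefix k ν ⊕ ι (sum (List.drop k us)) ≡ D)
  fill [] [] _ D l u = [] , [] , trans (sym ι-0) (≼-antisym l u) ,
    λ k → inj₁ (trans (prefix-[] k) (trans (sym ι-0) (cong ι (empty k))))
    where
    empty : ∀ k → 0 ≡ lowSum k []
    empty zero    = refl
    empty (suc k) = refl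
  fill (l ∷ ℓ) (u ∷ us) e D lower upper with total (ι l ⊕ ι (sum us)) D
  ... | inj₁ le = D ⊕ ⊖ s ∷ proj₁ (capVec us) ,
        bend (⊕-cancelʳ-≼ s (subst (ι l ⊕ s ≼_) (sym (sub-add D s)) le))
             (⊕-cancelʳ-≼ s (subst₂ _≼_ (sym (sub-add D s)) (ι-+ u (sum us)) upper))
             (proj₂ (capVec us)) ,
        trans (cong ((D ⊕ ⊖ s) ⊕_) (caps-total (proj₂ (capVec us)))) (sub-add D s) ,
        λ { zero    → inj₁ (sym ι-0)
          ; (suc k) → inj₂ (trans (assoc _ _ _) (trans (cong ((D ⊕ ⊖ s) ⊕_) (caps-prefix (proj₂ (capVec us)) k)) (sub-add D s))) }
    where
    s = ι (sum us)
  ... | inj₂ ge with fill ℓ us (ℕP.suc-injective e) (D ⊕ ⊖ ι l)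
                     (⊕-cancelˡ-≼ (ι l) (subst₂ _≼_ (ι-+ l (sum ℓ)) (sym (add-sub D (ι l))) lower))
                     (⊕-cancelˡ-≼ (ι l) (subst (_≼ ι l ⊕ ι (sum us)) (sym (add-sub D (ι l))) ge))
  ...   | ν , thr , eq , pre = ι l ∷ ν , fixed thr , trans (cong (ι l ⊕_) eq) (add-sub D (ι l)) , pre′
    where
    pre′ : ∀ k → prefix k (ι l ∷ ν) ≡ ι (lowSum k (l ∷ ℓ))
               ⊎ prefix k (ι l ∷ ν) ⊕ ι (sum (List.drop k (u ∷ us))) ≡ D
    pre′ zero = inj₁ (sym ι-0)
    pre′ (suc k) with pre k
    ... | inj₁ e′ = inj₁ (trans (cong (ι l ⊕_) e′) (sym (ι-+ l (lowSum k ℓ))))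
    ... | inj₂ e′ = inj₂ (trans (assoc (ι l) _ _) (trans (cong (ι l ⊕_) e′) (add-sub D (ι l))))

  Bounded : ∀ {r} → List ℕ → List ℕ → Vec Carrier r → Set
  Bounded ℓ us t = ∀ I → ι (lowSum (count I) ℓ) ≼ sumOn I t × sumOn I t ≼ ι (highSum (count I) us)

  lowSum-all : ∀ xs → lowSum (List.length xs) xs ≡ sum xs
  lowSum-all []       = refl
  lowSum-all (x ∷ xs) = cong (x +_) (lowSum-all xs)

  -- The threshold vector with the same total as t lies below t in the majorization order.
  bounded-closed : ∀ {r} ℓ us → List.length ℓ ≡ r → List.length us ≡ r → (C : Vec Carrier r → Set) → Closed C →
                   (∀ ν → Threshold ℓ us ν → C ν) → ∀ t → Bounded ℓ us t → C t
  bounded-closed ℓ us eℓ refl C closed thresholds t bounded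
    with fill ℓ us eℓ (total-sum t)
           (subst₂ _≼_ (cong ι (trans (cong (λ k → lowSum k ℓ) (trans (count-true _) (sym eℓ))) (lowSum-all ℓ)))
             (sumOn-true t) (proj₁ (bounded (replicate _ true))))
           (subst₂ _≼_ (sumOn-true t) (cong ι (highSum-all _ us (count-true _))) (proj₂ (bounded (replicate _ true))))
  ... | ν , thr , eq , pre = majorize C closed ν t lower (sym eq) (thresholds ν thr)
    where
    lower : ∀ I → prefix (count I) ν ≼ sumOn I t
    lower I with pre (count I)
    ... | inj₁ e = subst (_≼ sumOn I t) (sym e) (proj₁ (bounded I))
    ... | inj₂ e = ⊕-cancelʳ-≼ (ι (sum (List.drop (count I) us)))
      (subst₂ _≼_ (trans (sumOn-complement I t) (sym e))
        (cong (λ k → sumOn I t ⊕ ι (sum (List.drop k us))) complement-index)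
        (⊕-monoʳ-≼ (sumOn I t) (proj₂ (bounded (complement I)))))
      where
      complement-index : List.length us ∸ count (complement I) ≡ count I
      complement-index = trans (cong (_∸ count (complement I)) (sym (count-complement I)))
        (ℕP.m+n∸n≡m (count I) (count (complement I)))

-- Rational vectors and Newton polytopes

ℤ-group : OrderedGroup
ℤ-group = record
  { Carrier = ℤ ; _⊕_ = ℤ._+_ ; 0# = 0ℤ ; ⊖_ = ℤ.-_ ; _≼_ = ℤ._≤_
  ; isAbelianGroup = ℤP.+-0-isAbelianGroup
  ; isTotalOrder = ℤP.≤-isTotalOrder
  ; ⊕-monoʳ-≼ = λ z → ℤP.+-monoʳ-≤ z
  ; ι = λ n → ℤ.+ n ; ι-0 = refl ; ι-+ = λ m n → refl }

toℚᵘ-intToℚ : ∀ x → ℚ.toℚᵘ (intToℚ x) ℚᵘ.≃ ℚᵘ.mkℚᵘ x 0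
toℚᵘ-intToℚ x = ℚP.toℚᵘ-fromℚᵘ (ℚᵘ.mkℚᵘ x 0)

intToℚ-+ : ∀ x y → intToℚ (x ℤ.+ y) ≡ intToℚ x ℚ.+ intToℚ y
intToℚ-+ x y = ℚP.toℚᵘ-injective (begin-equality
  ℚ.toℚᵘ (intToℚ (x ℤ.+ y))                       ≃⟨ toℚᵘ-intToℚ (x ℤ.+ y) ⟩
  ℚᵘ.mkℚᵘ (x ℤ.+ y) 0                             ≃⟨ ℚᵘ.*≡* (lemma x y) ⟩
  ℚᵘ.mkℚᵘ x 0 ℚᵘ.+ ℚᵘ.mkℚᵘ y 0                    ≃⟨ ℚᵘP.+-cong (toℚᵘ-intToℚ x) (toℚᵘ-intToℚ y) ⟨
  ℚ.toℚᵘ (intToℚ x) ℚᵘ.+ ℚ.toℚᵘ (intToℚ y)        ≃⟨ ℚP.toℚᵘ-homo-+ (intToℚ x) (intToℚ y) ⟨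
  ℚ.toℚᵘ (intToℚ x ℚ.+ intToℚ y)                  ∎)
  where
  open ℚᵘP.≤-Reasoning
  lemma : ∀ x y → (x ℤ.+ y) ℤ.* 1ℤ ≡ (x ℤ.* 1ℤ ℤ.+ y ℤ.* 1ℤ) ℤ.* 1ℤ
  lemma = ℤS.solve-∀

intToℚ-mono-≤ : ∀ {x y} → x ℤ.≤ y → intToℚ x ℚ.≤ intToℚ y
intToℚ-mono-≤ {x} {y} x≤y = ℚP.toℚᵘ-cancel-≤ (ℚᵘP.≤-respˡ-≃ (ℚᵘP.≃-sym (toℚᵘ-intToℚ x))
  (ℚᵘP.≤-respʳ-≃ (ℚᵘP.≃-sym (toℚᵘ-intToℚ y))
    (ℚᵘ.*≤* (subst₂ ℤ._≤_ (sym (ℤP.*-identityʳ x)) (sym (ℤP.*-identityʳ y)) x≤y))))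

intToℚ-cancel-≤ : ∀ {x y} → intToℚ x ℚ.≤ intToℚ y → x ℤ.≤ y
intToℚ-cancel-≤ {x} {y} le = cancel (ℚᵘP.≤-respˡ-≃ (toℚᵘ-intToℚ x)
  (ℚᵘP.≤-respʳ-≃ (toℚᵘ-intToℚ y) (ℚP.toℚᵘ-mono-≤ le)))
  where
  cancel : ℚᵘ.mkℚᵘ x 0 ℚᵘ.≤ ℚᵘ.mkℚᵘ y 0 → x ℤ.≤ y
  cancel (ℚᵘ.*≤* le′) = subst₂ ℤ._≤_ (ℤP.*-identityʳ x) (ℤP.*-identityʳ y) le′

ℕtoℚ : ℕ → ℚ
ℕtoℚ k = intToℚ (ℤ.+ k)

ℕtoℚ-mono-≤ : ∀ {m n} → m ≤ n → ℕtoℚ m ℚ.≤ ℕtoℚ n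
ℕtoℚ-mono-≤ m≤n = intToℚ-mono-≤ (ℤ.+≤+ m≤n)

ℚ-group : OrderedGroup
ℚ-group = record
  { Carrier = ℚ ; _⊕_ = ℚ._+_ ; 0# = ℚ.0ℚ ; ⊖_ = ℚ.-_ ; _≼_ = ℚ._≤_
  ; isAbelianGroup = ℚP.+-0-isAbelianGroup
  ; isTotalOrder = ℚP.≤-isTotalOrder
  ; ⊕-monoʳ-≼ = λ z → ℚP.+-monoʳ-≤ z
  ; ι = ℕtoℚ ; ι-0 = refl ; ι-+ = λ m n → intToℚ-+ (ℤ.+ m) (ℤ.+ n) }

module Mℤ = Majorization ℤ-group
module Mℚ = Majorization ℚ-group

sumOver-sumOn : ∀ {n} (I : Vec Bool n) t → sumOver I t ≡ Mℚ.sumOn I t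
sumOver-sumOn []          []      = refl
sumOver-sumOn (true ∷ I)  (x ∷ t) = cong (x ℚ.+_) (sumOver-sumOn I t)
sumOver-sumOn (false ∷ I) (x ∷ t) = trans (ℚP.+-identityˡ _) (sumOver-sumOn I t)

segment : ∀ {p x q} → p ℚ.≤ x → x ℚ.≤ q →
          ∃ λ s → ∃ λ t → ℚ.0ℚ ℚ.≤ s × ℚ.0ℚ ℚ.≤ t × s ℚ.+ t ≡ ℚ.1ℚ × s ℚ.* p ℚ.+ t ℚ.* q ≡ x
segment {p} {x} {q} p≤x x≤q with p ℚP.≟ q
... | yes refl = ℚ.1ℚ , ℚ.0ℚ , ℚP.nonNegative⁻¹ ℚ.1ℚ , ℚP.≤-refl , refl ,
      trans (trans (cong₂ ℚ._+_ (ℚP.*-identityˡ p) (ℚP.*-zeroˡ p)) (ℚP.+-identityʳ p)) (ℚP.≤-antisym p≤x x≤q)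
... | no p≢q = (q ℚ.- x) ℚ.* i , (x ℚ.- p) ℚ.* i , scaled x≤q , scaled p≤x ,
      trans (solve 4 (λ p x q i → (q :- x) :* i :+ (x :- p) :* i := (q :- p) :* i) refl p x q i) inverse ,
      trans (solve 4 (λ p x q i → ((q :- x) :* i) :* p :+ ((x :- p) :* i) :* q := x :* ((q :- p) :* i)) refl p x q i)
            (trans (cong (x ℚ.*_) inverse) (ℚP.*-identityʳ x))
  where
  open +-*-Solver
  d = q ℚ.- p
  difference : ∀ {x y} → x ℚ.≤ y → ℚ.0ℚ ℚ.≤ y ℚ.- x
  difference {x} {y} x≤y = subst (ℚ._≤ y ℚ.- x) (ℚP.+-inverseʳ x) (ℚP.+-monoˡ-≤ (ℚ.- x) x≤y)
  instance
    d-positive : ℚ.Positive d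
    d-positive = ℚ.positive (ℚP.≰⇒> (λ d≤0 → p≢q (sym
      (trans (sym (trans (ℚP.+-assoc q (ℚ.- p) p) (trans (cong (q ℚ.+_) (ℚP.+-inverseˡ p)) (ℚP.+-identityʳ q))))
        (trans (cong (ℚ._+ p) (ℚP.≤-antisym d≤0 (difference (ℚP.≤-trans p≤x x≤q)))) (ℚP.+-identityˡ p))))))
    d-nonZero : ℚ.NonZero d
    d-nonZero = ℚP.pos⇒nonZero d
  i : ℚ
  i = ℚ.1/ d
  inverse : d ℚ.* i ≡ ℚ.1ℚ
  inverse = ℚP.*-inverseʳ d
  i-nonNegative : ℚ.NonNegative i
  i-nonNegative = ℚP.pos⇒nonNeg i {{ℚP.1/pos⇒pos d}}
  scaled : ∀ {x y} → x ℚ.≤ y → ℚ.0ℚ ℚ.≤ (y ℚ.- x) ℚ.* i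
  scaled {x} {y} x≤y = subst (ℚ._≤ (y ℚ.- x) ℚ.* i) (ℚP.*-zeroˡ i)
    (ℚP.*-monoʳ-≤-nonNeg i {{i-nonNegative}} (difference x≤y))

scale : ∀ {n} → ℚ → Vec ℚ n → Vec ℚ n
scale c = Vec.map (c ℚ.*_)

mix : ∀ {n} → ℚ → ℚ → Vec ℚ n → Vec ℚ n → Vec ℚ n
mix s t u v = zipWith ℚ._+_ (scale s u) (scale t v)

module _ {n : ℕ} where

  Weighted : Set
  Weighted = List (ℚ × Mono n)

  mass : Weighted → ℚ
  mass []             = ℚ.0ℚ
  mass ((c , α) ∷ cs) = c ℚ.+ mass cs

  barycentre : Weighted → Vec ℚ n
  barycentre []             = replicate n ℚ.0ℚ
  barycentre ((c , α) ∷ cs) = zipWith ℚ._+_ (scale c (toℚ α)) (barycentre cs)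

  -- `InNewton` with both sums given by recursion on the list of weighted points, for the inductions
  -- below.
  Hull : Poly n → Vec ℚ n → Set
  Hull f t = ∃ λ cs → All (λ x → ℚ.0ℚ ℚ.≤ proj₁ x × InSupp f (proj₂ x)) cs × mass cs ≡ ℚ.1ℚ × barycentre cs ≡ t

  private
    mass-sum : ∀ (g : ℚ × Mono n → ℚ) → (∀ x → g x ≡ proj₁ x) → ∀ cs → sumℚ (List.map g cs) ≡ mass cs
    mass-sum g e []       = refl
    mass-sum g e (x ∷ cs) = cong₂ ℚ._+_ (e x) (mass-sum g e cs)

    barycentre-combo : ∀ (g : ℚ × Mono n → ℚ × Vec ℚ n) → (∀ x → g x ≡ (proj₁ x , toℚ (proj₂ x))) →
                       ∀ cs → combo (List.map g cs) ≡ barycentre cs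
    barycentre-combo g e [] = refl
    barycentre-combo g e (x ∷ cs) rewrite e x = cong (zipWith ℚ._+_ (scale (proj₁ x) (toℚ (proj₂ x)))) (barycentre-combo g e cs)

  newton⇒hull : ∀ {f t} → InNewton f t → Hull f t
  newton⇒hull (cs , nonneg , m , b) = cs , All.map (λ { {c , α} p → p }) nonneg ,
    trans (sym (mass-sum _ (λ { (c , α) → refl }) cs)) m ,
    trans (sym (barycentre-combo _ (λ { (c , α) → refl }) cs)) b

  hull⇒newton : ∀ {f t} → Hull f t → InNewton f t
  hull⇒newton (cs , nonneg , m , b) = cs , All.map (λ { {c , α} p → p }) nonneg ,
    trans (mass-sum _ (λ { (c , α) → refl }) cs) m ,
    trans (barycentre-combo _ (λ { (c , α) → refl }) cs) b

  reweight : ℚ → Weighted → Weighted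
  reweight s = List.map (λ x → s ℚ.* proj₁ x , proj₂ x)

  mass-++ : ∀ cs ds → mass (cs List.++ ds) ≡ mass cs ℚ.+ mass ds
  mass-++ []             ds = sym (ℚP.+-identityˡ (mass ds))
  mass-++ ((c , _) ∷ cs) ds = trans (cong (c ℚ.+_) (mass-++ cs ds)) (sym (ℚP.+-assoc c (mass cs) (mass ds)))

  mass-reweight : ∀ s cs → mass (reweight s cs) ≡ s ℚ.* mass cs
  mass-reweight s []             = sym (ℚP.*-zeroʳ s)
  mass-reweight s ((c , _) ∷ cs) =
    trans (cong ((s ℚ.* c) ℚ.+_) (mass-reweight s cs)) (sym (ℚP.*-distribˡ-+ s c (mass cs)))

  barycentre-++ : ∀ cs ds → barycentre (cs List.++ ds) ≡ zipWith ℚ._+_ (barycentre cs) (barycentre ds)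
  barycentre-++ []             ds = sym (VecP.zipWith-identityˡ ℚP.+-identityˡ (barycentre ds))
  barycentre-++ ((c , α) ∷ cs) ds = trans (cong (zipWith ℚ._+_ (scale c (toℚ α))) (barycentre-++ cs ds))
    (sym (VecP.zipWith-assoc ℚP.+-assoc (scale c (toℚ α)) (barycentre cs) (barycentre ds)))

  scale-+ : ∀ {m} s (u v : Vec ℚ m) → scale s (zipWith ℚ._+_ u v) ≡ zipWith ℚ._+_ (scale s u) (scale s v)
  scale-+ s []      []      = refl
  scale-+ s (x ∷ u) (y ∷ v) = cong₂ _∷_ (ℚP.*-distribˡ-+ s x y) (scale-+ s u v)

  barycentre-reweight : ∀ s cs → barycentre (reweight s cs) ≡ scale s (barycentre cs)
  barycentre-reweight s [] = sym (trans (VecP.map-replicate (s ℚ.*_) ℚ.0ℚ n) (cong (replicate n) (ℚP.*-zeroʳ s)))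
  barycentre-reweight s ((c , α) ∷ cs) = trans (cong₂ (zipWith ℚ._+_)
      (trans (VecP.map-cong (λ x → ℚP.*-assoc s c x) (toℚ α)) (VecP.map-∘ (s ℚ.*_) (c ℚ.*_) (toℚ α)))
      (barycentre-reweight s cs))
    (sym (scale-+ s (scale c (toℚ α)) (barycentre cs)))

  hull-point : ∀ {f α} → InSupp f α → Hull f (toℚ α)
  hull-point {α = α} h = (ℚ.1ℚ , α) ∷ [] , (ℚP.nonNegative⁻¹ ℚ.1ℚ , h) ∷ [] , refl ,
    trans (VecP.zipWith-identityʳ ℚP.+-identityʳ (scale ℚ.1ℚ (toℚ α)))
          (trans (VecP.map-cong ℚP.*-identityˡ (toℚ α)) (VecP.map-id (toℚ α)))

  hull-mix : ∀ {f s t u v} → ℚ.0ℚ ℚ.≤ s → ℚ.0ℚ ℚ.≤ t → s ℚ.+ t ≡ ℚ.1ℚ →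
             Hull f u → Hull f v → Hull f (mix s t u v)
  hull-mix {f} {s} {t} 0≤s 0≤t s+t≡1 (cs , p , m , refl) (ds , q , m′ , refl) =
    reweight s cs List.++ reweight t ds ,
    AllP.++⁺ (weights 0≤s p) (weights 0≤t q) ,
    trans (mass-++ (reweight s cs) (reweight t ds)) (trans (cong₂ ℚ._+_
      (trans (mass-reweight s cs) (trans (cong (s ℚ.*_) m) (ℚP.*-identityʳ s)))
      (trans (mass-reweight t ds) (trans (cong (t ℚ.*_) m′) (ℚP.*-identityʳ t)))) s+t≡1) ,
    trans (barycentre-++ (reweight s cs) (reweight t ds))
          (cong₂ (zipWith ℚ._+_) (barycentre-reweight s cs) (barycentre-reweight t ds))
    where
    weights : ∀ {s cs} → ℚ.0ℚ ℚ.≤ s → All (λ x → ℚ.0ℚ ℚ.≤ proj₁ x × InSupp f (proj₂ x)) cs →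
              All (λ x → ℚ.0ℚ ℚ.≤ proj₁ x × InSupp f (proj₂ x)) (reweight s cs)
    weights {s} 0≤s p = AllP.map⁺ (All.map (λ { {c , α} (0≤c , h) →
      subst (ℚ._≤ s ℚ.* c) (ℚP.*-zeroʳ s) (ℚP.*-monoˡ-≤-nonNeg s {{ℚ.nonNegative 0≤s}} 0≤c) , h }) p)

  swapAt-zipWith : ∀ {A B C : Set} (g : A → B → C) {m} j (u : Vec A m) (v : Vec B m) →
                   swapAt j (zipWith g u v) ≡ zipWith g (swapAt j u) (swapAt j v)
  swapAt-zipWith g zero    []          []          = refl
  swapAt-zipWith g zero    (x ∷ [])    (y ∷ [])    = refl
  swapAt-zipWith g zero    (x ∷ _ ∷ u) (y ∷ _ ∷ v) = refl
  swapAt-zipWith g (suc j) []          []          = refl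
  swapAt-zipWith g (suc j) (x ∷ u)     (y ∷ v)     = cong (g x y ∷_) (swapAt-zipWith g j u v)

  hull-swapAt : ∀ {f t} j → (∀ α → InSupp f α → InSupp f (swapAt j α)) → Hull f t → Hull f (swapAt j t)
  hull-swapAt {f} j closed (cs , p , m , refl) = swapped , AllP.map⁺ (All.map (λ { (0≤c , h) → 0≤c , closed _ h }) p) ,
    trans (same-mass cs) m , barycentres cs
    where
    swapped = List.map (λ x → proj₁ x , swapAt j (proj₂ x)) cs
    same-mass : ∀ cs → mass (List.map (λ x → proj₁ x , swapAt j (proj₂ x)) cs) ≡ mass cs
    same-mass []             = refl
    same-mass ((c , _) ∷ cs) = cong (c ℚ.+_) (same-mass cs)
    barycentres : ∀ cs → barycentre (List.map (λ x → proj₁ x , swapAt j (proj₂ x)) cs) ≡ swapAt j (barycentre cs)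
    barycentres [] = sym (swapAt-replicate j n ℚ.0ℚ)
    barycentres ((c , α) ∷ cs) = trans
      (cong₂ (zipWith ℚ._+_) (trans (cong (scale c) (sym (swapAt-map j ℕtoℚ α))) (sym (swapAt-map j (c ℚ.*_) (toℚ α))))
             (barycentres cs))
      (sym (swapAt-zipWith ℚ._+_ j (scale c (toℚ α)) (barycentre cs)))

  sumOn-+ : ∀ {m} (I : Vec Bool m) u v → Mℚ.sumOn I (zipWith ℚ._+_ u v) ≡ Mℚ.sumOn I u ℚ.+ Mℚ.sumOn I v
  sumOn-+ []          []      []      = refl
  sumOn-+ (true ∷ I)  (x ∷ u) (y ∷ v) = trans (cong ((x ℚ.+ y) ℚ.+_) (sumOn-+ I u v))
    (solve 4 (λ x y a b → (x :+ y) :+ (a :+ b) := (x :+ a) :+ (y :+ b)) refl x y (Mℚ.sumOn I u) (Mℚ.sumOn I v))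
    where open +-*-Solver
  sumOn-+ (false ∷ I) (x ∷ u) (y ∷ v) = sumOn-+ I u v

  sumOn-scale : ∀ {m} (I : Vec Bool m) s u → Mℚ.sumOn I (scale s u) ≡ s ℚ.* Mℚ.sumOn I u
  sumOn-scale []          s []      = sym (ℚP.*-zeroʳ s)
  sumOn-scale (true ∷ I)  s (x ∷ u) = trans (cong ((s ℚ.* x) ℚ.+_) (sumOn-scale I s u)) (sym (ℚP.*-distribˡ-+ s x _))
  sumOn-scale (false ∷ I) s (x ∷ u) = sumOn-scale I s u

  sumOn-0 : ∀ {m} (I : Vec Bool m) → Mℚ.sumOn I (replicate m ℚ.0ℚ) ≡ ℚ.0ℚ
  sumOn-0 []          = refl
  sumOn-0 (true ∷ I)  = trans (ℚP.+-identityˡ _) (sumOn-0 I)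
  sumOn-0 (false ∷ I) = sumOn-0 I

  hull-lower : ∀ {f t} I b → (∀ α → InSupp f α → b ℚ.≤ Mℚ.sumOn I (toℚ α)) → Hull f t → b ℚ.≤ Mℚ.sumOn I t
  hull-lower {f} I b h (cs , p , m , refl) = subst (ℚ._≤ Mℚ.sumOn I (barycentre cs))
    (trans (cong (ℚ._* b) m) (ℚP.*-identityˡ b)) (go cs p)
    where
    go : ∀ cs → All (λ x → ℚ.0ℚ ℚ.≤ proj₁ x × InSupp f (proj₂ x)) cs → mass cs ℚ.* b ℚ.≤ Mℚ.sumOn I (barycentre cs)
    go [] [] = ℚP.≤-reflexive (trans (ℚP.*-zeroˡ b) (sym (sumOn-0 I)))
    go ((c , α) ∷ cs) ((0≤c , hα) ∷ p) = subst₂ ℚ._≤_ (sym (ℚP.*-distribʳ-+ b c (mass cs)))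
      (sym (trans (sumOn-+ I (scale c (toℚ α)) (barycentre cs)) (cong (ℚ._+ _) (sumOn-scale I c (toℚ α)))))
      (ℚP.+-mono-≤ (ℚP.*-monoˡ-≤-nonNeg c {{ℚ.nonNegative 0≤c}} (h α hα)) (go cs p))

  hull-upper : ∀ {f t} I b → (∀ α → InSupp f α → Mℚ.sumOn I (toℚ α) ℚ.≤ b) → Hull f t → Mℚ.sumOn I t ℚ.≤ b
  hull-upper {f} I b h (cs , p , m , refl) = subst (Mℚ.sumOn I (barycentre cs) ℚ.≤_)
    (trans (cong (ℚ._* b) m) (ℚP.*-identityˡ b)) (go cs p)
    where
    go : ∀ cs → All (λ x → ℚ.0ℚ ℚ.≤ proj₁ x × InSupp f (proj₂ x)) cs → Mℚ.sumOn I (barycentre cs) ℚ.≤ mass cs ℚ.* b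
    go [] [] = ℚP.≤-reflexive (trans (sumOn-0 I) (sym (ℚP.*-zeroˡ b)))
    go ((c , α) ∷ cs) ((0≤c , hα) ∷ p) = subst₂ ℚ._≤_
      (sym (trans (sumOn-+ I (scale c (toℚ α)) (barycentre cs)) (cong (ℚ._+ _) (sumOn-scale I c (toℚ α)))))
      (sym (ℚP.*-distribʳ-+ b c (mass cs)))
      (ℚP.+-mono-≤ (ℚP.*-monoˡ-≤-nonNeg c {{ℚ.nonNegative 0≤c}} (h α hα)) (go cs p))

-- Submodularity

-- Coordinates beyond the `r`-th vanish on the support, so the bounds see a set only through its
-- part in the first `r`.
countFirst : ∀ {n} → ℕ → Vec Bool n → ℕ
countFirst zero    I           = 0
countFirst (suc r) []          = 0
countFirst (suc r) (true ∷ I)  = suc (countFirst r I)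
countFirst (suc r) (false ∷ I) = countFirst r I

countFirst-≤ : ∀ {n} r (I : Vec Bool n) → countFirst r I ≤ r
countFirst-≤ zero    I           = z≤n
countFirst-≤ (suc r) []          = z≤n
countFirst-≤ (suc r) (true ∷ I)  = s≤s (countFirst-≤ r I)
countFirst-≤ (suc r) (false ∷ I) = ℕP.m≤n⇒m≤1+n (countFirst-≤ r I)

countFirst-split : ∀ {n} r (I J : Vec Bool n) → countFirst r I ≡ countFirst r (I ∩ J) + countFirst r (I ─ J)
countFirst-split zero    I           J           = refl
countFirst-split (suc r) []          []          = refl
countFirst-split (suc r) (true ∷ I)  (true ∷ J)  = cong suc (countFirst-split r I J)
countFirst-split (suc r) (true ∷ I)  (false ∷ J) = trans (cong suc (countFirst-split r I J)) (sym (+-suc _ _))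
countFirst-split (suc r) (false ∷ I) (true ∷ J)  = countFirst-split r I J
countFirst-split (suc r) (false ∷ I) (false ∷ J) = countFirst-split r I J

countFirst-split′ : ∀ {n} r (I J : Vec Bool n) → countFirst r J ≡ countFirst r (I ∩ J) + countFirst r (J ─ I)
countFirst-split′ r I J = trans (countFirst-split r J I)
  (cong (λ K → countFirst r K + countFirst r (J ─ I)) (∩-comm J I))

countFirst-∪ : ∀ {n} r (I J : Vec Bool n) →
  countFirst r (I ∪ J) ≡ countFirst r (I ∩ J) + (countFirst r (I ─ J) + countFirst r (J ─ I))
countFirst-∪ zero    I           J           = refl
countFirst-∪ (suc r) []          []          = refl
countFirst-∪ (suc r) (true ∷ I)  (true ∷ J)  = cong suc (countFirst-∪ r I J)
countFirst-∪ (suc r) (true ∷ I)  (false ∷ J) = trans (cong suc (countFirst-∪ r I J)) (sym (+-suc _ _))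
countFirst-∪ (suc r) (false ∷ I) (true ∷ J)  = trans (cong suc (countFirst-∪ r I J))
  (trans (sym (+-suc _ _)) (cong (countFirst r (I ∩ J) +_) (sym (+-suc _ _))))
countFirst-∪ (suc r) (false ∷ I) (false ∷ J) = countFirst-∪ r I J

lowSum-shift : ∀ {p x} k xs → Ascending p (x ∷ xs) → k ≤ List.length xs → lowSum k (x ∷ xs) ≤ lowSum k xs
lowSum-shift zero    xs              _             _        = z≤n
lowSum-shift (suc k) (y ∷ ys) (_ ∷ x≤y ∷ asc) (s≤s k≤) = +-mono-≤ x≤y (lowSum-shift k ys (x≤y ∷ asc) k≤)

lowSum-drop : ∀ {p} j k xs → Ascending p xs → j + k ≤ List.length xs → lowSum k xs ≤ lowSum k (List.drop j xs)
lowSum-drop zero    k xs            _           _        = ≤-refl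
lowSum-drop (suc j) k (x ∷ xs) (p≤x ∷ asc) (s≤s le) = ≤-trans
  (lowSum-shift k xs (p≤x ∷ asc) (≤-trans (m≤n+m k j) le)) (lowSum-drop j k xs asc le)

ascending-drop : ∀ {p} j xs → Ascending p xs → Ascending 0 (List.drop j xs)
ascending-drop zero    xs            asc       = ascending-weaken z≤n asc
ascending-drop (suc j) []       asc       = []
ascending-drop (suc j) (x ∷ xs) (_ ∷ asc) = ascending-drop j xs asc

lowSum-+ : ∀ i j xs → lowSum (i + j) xs ≡ lowSum i xs + lowSum j (List.drop i xs)
lowSum-+ zero    j       xs            = refl
lowSum-+ (suc i) zero    []       = refl
lowSum-+ (suc i) (suc j) []       = refl
lowSum-+ (suc i) j       (x ∷ xs) = trans (cong (x +_) (lowSum-+ i j xs)) (sym (+-assoc x _ _))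

sum-split : ∀ j xs → sum xs ≡ lowSum j xs + sum (List.drop j xs)
sum-split zero    xs            = refl
sum-split (suc j) []       = refl
sum-split (suc j) (x ∷ xs) = trans (cong (x +_) (sum-split j xs)) (sym (+-assoc x _ _))

drop-+ : ∀ i j (xs : List ℕ) → List.drop j (List.drop i xs) ≡ List.drop (i + j) xs
drop-+ zero    j       xs            = refl
drop-+ (suc i) zero    []       = refl
drop-+ (suc i) (suc j) []       = refl
drop-+ (suc i) j       (x ∷ xs) = drop-+ i j xs

lowSum-drop-+ : ∀ i j k xs → Ascending 0 xs → i + (j + k) ≤ List.length xs →
                lowSum k (List.drop i xs) ≤ lowSum k (List.drop (i + j) xs)
lowSum-drop-+ i j k xs asc le = subst (λ ys → lowSum k (List.drop i xs) ≤ lowSum k ys) (drop-+ i j xs)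
  (lowSum-drop j k (List.drop i xs) (ascending-drop i xs asc)
    (subst (j + k ≤_) (sym (ListP.length-drop i xs)) (ℕP.m+n≤o⇒m≤o∸n (j + k) (subst (_≤ List.length xs) (+-comm i (j + k)) le))))

-- Here `v`, `a`, `b` are the sizes of the intersection and of the two differences. The increments
-- are sums over windows of length `b`, starting after `v` and after `v + a` entries, and in an
-- ascending list the later window is at least as large.
lowSum-supermodular : ∀ v a b xs → Ascending 0 xs → v + (a + b) ≤ List.length xs →
  lowSum (v + a) xs + lowSum (v + b) xs ≤ lowSum (v + (a + b)) xs + lowSum v xs
lowSum-supermodular v a b xs asc le = begin
  lowSum (v + a) xs + lowSum (v + b) xs
    ≡⟨ cong (lowSum (v + a) xs +_) (lowSum-+ v b xs) ⟩
  lowSum (v + a) xs + (lowSum v xs + lowSum b (List.drop v xs))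
    ≤⟨ +-monoʳ-≤ (lowSum (v + a) xs) (+-monoʳ-≤ (lowSum v xs) (lowSum-drop-+ v a b xs asc le)) ⟩
  lowSum (v + a) xs + (lowSum v xs + lowSum b (List.drop (v + a) xs))
    ≡⟨ lemma (lowSum (v + a) xs) (lowSum v xs) (lowSum b (List.drop (v + a) xs)) ⟩
  lowSum (v + a) xs + lowSum b (List.drop (v + a) xs) + lowSum v xs
    ≡⟨ cong (_+ lowSum v xs) (lowSum-+ (v + a) b xs) ⟨
  lowSum (v + a + b) xs + lowSum v xs
    ≡⟨ cong (λ k → lowSum k xs + lowSum v xs) (+-assoc v a b) ⟩
  lowSum (v + (a + b)) xs + lowSum v xs ∎
  where
  open ℕP.≤-Reasoning
  lemma : ∀ x y z → x + (y + z) ≡ x + z + y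
  lemma = ℕS.solve-∀

highSum-drop : ∀ i k xs → i + k ≡ List.length xs → highSum k xs ≡ sum (List.drop i xs)
highSum-drop i k xs e = cong (λ j → sum (List.drop j xs)) (trans (cong (_∸ k) (sym e)) (ℕP.m+n∸n≡m i k))

module _ (v a b : ℕ) (xs : List ℕ) (le : v + (a + b) ≤ List.length xs) where
  private
    c = List.length xs ∸ (v + (a + b))
    c-length : c + (v + (a + b)) ≡ List.length xs
    c-length = ℕP.m∸n+n≡m le

  highSum-v : highSum v xs ≡ sum (List.drop (c + b + a) xs)
  highSum-v = highSum-drop (c + b + a) v xs (trans (lemma c v a b) c-length)
    where
    lemma : ∀ c v a b → c + b + a + v ≡ c + (v + (a + b))
    lemma = ℕS.solve-∀

  highSum-v+a : highSum (v + a) xs ≡ sum (List.drop (c + b) xs)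
  highSum-v+a = highSum-drop (c + b) (v + a) xs (trans (lemma c v a b) c-length)
    where
    lemma : ∀ c v a b → c + b + (v + a) ≡ c + (v + (a + b))
    lemma = ℕS.solve-∀

  highSum-v+b : highSum (v + b) xs ≡ sum (List.drop (c + a) xs)
  highSum-v+b = highSum-drop (c + a) (v + b) xs (trans (lemma c v a b) c-length)
    where
    lemma : ∀ c v a b → c + a + (v + b) ≡ c + (v + (a + b))
    lemma = ℕS.solve-∀

  highSum-a : highSum a xs ≡ sum (List.drop (c + b + v) xs)
  highSum-a = highSum-drop (c + b + v) a xs (trans (lemma c v a b) c-length)
    where
    lemma : ∀ c v a b → c + b + v + a ≡ c + (v + (a + b))
    lemma = ℕS.solve-∀

  -- `c` entries lie below the top `v + (a + b)`. The increments to compare are windows of length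
  -- `a`, starting at `c` and at `c + b`.
  highSum-submodular : Ascending 0 xs →
    highSum (v + (a + b)) xs + highSum v xs ≤ highSum (v + a) xs + highSum (v + b) xs
  highSum-submodular asc = begin
    highSum (v + (a + b)) xs + highSum v xs
      ≡⟨ cong₂ _+_ (sum-split a (List.drop c xs)) highSum-v ⟩
    lowSum a (List.drop c xs) + sum (List.drop a (List.drop c xs)) + sum (List.drop (c + b + a) xs)
      ≤⟨ ℕP.+-monoˡ-≤ _ (ℕP.+-monoˡ-≤ _ (lowSum-drop-+ c b a xs asc bound)) ⟩
    lowSum a (List.drop (c + b) xs) + sum (List.drop a (List.drop c xs)) + sum (List.drop (c + b + a) xs)
      ≡⟨ cong₂ (λ ys zs → lowSum a (List.drop (c + b) xs) + sum ys + sum zs) (drop-+ c a xs) (sym (drop-+ (c + b) a xs)) ⟩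
    lowSum a (List.drop (c + b) xs) + sum (List.drop (c + a) xs) + sum (List.drop a (List.drop (c + b) xs))
      ≡⟨ lemma (lowSum a (List.drop (c + b) xs)) (sum (List.drop (c + a) xs)) (sum (List.drop a (List.drop (c + b) xs))) ⟩
    lowSum a (List.drop (c + b) xs) + sum (List.drop a (List.drop (c + b) xs)) + sum (List.drop (c + a) xs)
      ≡⟨ cong₂ _+_ (trans (sym (sum-split a (List.drop (c + b) xs))) (sym highSum-v+a)) (sym highSum-v+b) ⟩
    highSum (v + a) xs + highSum (v + b) xs ∎
    where
    open ℕP.≤-Reasoning
    bound : c + (b + a) ≤ List.length xs
    bound = ≤-trans (+-monoʳ-≤ c (≤-trans (≤-reflexive (+-comm b a)) (m≤n+m (a + b) v)))
                       (≤-reflexive c-length)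
    lemma : ∀ x y z → x + y + z ≡ x + z + y
    lemma = ℕS.solve-∀

  -- Now windows of length `v` are compared: at `b` in the lower list and at `c + b` in the upper
  -- one. `below` passes from one list to the other, and the upper list ascends.
  highSum-lowSum : ∀ ys → Ascending 0 xs → (∀ i j → lowSum i (List.drop j ys) ≤ lowSum i (List.drop j xs)) →
    highSum a xs + lowSum (v + b) ys ≤ highSum (v + a) xs + lowSum b ys
  highSum-lowSum ys asc below = begin
    highSum a xs + lowSum (v + b) ys
      ≡⟨ cong₂ _+_ highSum-a (trans (cong (λ k → lowSum k ys) (+-comm v b)) (lowSum-+ b v ys)) ⟩
    sum (List.drop (c + b + v) xs) + (lowSum b ys + lowSum v (List.drop b ys))
      ≤⟨ +-monoʳ-≤ (sum (List.drop (c + b + v) xs)) (+-monoʳ-≤ (lowSum b ys) (≤-trans (below v b)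
           (subst (λ j → lowSum v (List.drop b xs) ≤ lowSum v (List.drop j xs)) (+-comm b c)
             (lowSum-drop-+ b c v xs asc bound)))) ⟩
    sum (List.drop (c + b + v) xs) + (lowSum b ys + lowSum v (List.drop (c + b) xs))
      ≡⟨ lemma (sum (List.drop (c + b + v) xs)) (lowSum b ys) (lowSum v (List.drop (c + b) xs)) ⟩
    lowSum v (List.drop (c + b) xs) + sum (List.drop (c + b + v) xs) + lowSum b ys
      ≡⟨ cong (_+ lowSum b ys) (trans (cong (λ zs → lowSum v (List.drop (c + b) xs) + sum zs) (sym (drop-+ (c + b) v xs)))
           (trans (sym (sum-split v (List.drop (c + b) xs))) (sym highSum-v+a))) ⟩
    highSum (v + a) xs + lowSum b ys ∎
    where
    open ℕP.≤-Reasoning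
    lemma : ∀ x y z → x + (y + z) ≡ z + x + y
    lemma = ℕS.solve-∀
    lemma′ : ∀ c v a b → c + (v + (a + b)) ≡ b + (c + v) + a
    lemma′ = ℕS.solve-∀
    bound : b + (c + v) ≤ List.length xs
    bound = ≤-trans (m≤m+n _ a) (≤-reflexive (trans (sym (lemma′ c v a b)) c-length))

capHead-≥ : ∀ {l ℓ} → Ascending l ℓ → l ≤ capHead l ℓ
capHead-≥ []                = ≤-refl
capHead-≥ (l≤l′ ∷ asc) = ℕP.⊓-glb (m≤m+n _ _) (≤-trans l≤l′ (capHead-≥ asc))

caps-ascending : ∀ {p ℓ} → Ascending p ℓ → Ascending 0 (caps ℓ)
caps-ascending []        = []
caps-ascending (_ ∷ asc) = z≤n ∷ tail asc
  where
  tail : ∀ {l ℓ} → Ascending l ℓ → Ascending (capHead l ℓ) (caps ℓ)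
  tail []        = []
  tail (_ ∷ asc) = ℕP.m⊓n≤n _ _ ∷ tail asc

lowSum-caps : ∀ {p ℓ} → Ascending p ℓ → ∀ i j → lowSum i (List.drop j ℓ) ≤ lowSum i (List.drop j (caps ℓ))
lowSum-caps []        i       zero    = ≤-refl
lowSum-caps []        i       (suc j) = ≤-refl
lowSum-caps (_ ∷ asc) zero    zero    = z≤n
lowSum-caps (_ ∷ asc) (suc i) zero    = +-mono-≤ (capHead-≥ asc) (lowSum-caps asc i 0)
lowSum-caps (_ ∷ asc) i       (suc j) = lowSum-caps asc i j

module Paramodularity (r : ℕ) {ℓ : List ℕ} (asc : Ascending 0 ℓ) (length-ℓ : List.length ℓ ≡ r) where

  module _ {n : ℕ} where

    lower upper : Vec Bool n → ℚ
    lower I = ℕtoℚ (lowSum (countFirst r I) ℓ)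
    upper I = ℕtoℚ (highSum (countFirst r I) (caps ℓ))

    private
      bound : ∀ (I J : Vec Bool n) → countFirst r (I ∩ J) + (countFirst r (I ─ J) + countFirst r (J ─ I)) ≤ List.length ℓ
      bound I J = subst₂ _≤_ (countFirst-∪ r I J) (sym length-ℓ) (countFirst-≤ r (I ∪ J))

      bound′ : ∀ (I J : Vec Bool n) → countFirst r (I ∩ J) + (countFirst r (I ─ J) + countFirst r (J ─ I)) ≤ List.length (caps ℓ)
      bound′ I J = ≤-trans (bound I J) (≤-reflexive (sym (length-caps ℓ)))

      +-mono : ∀ a b c d → a + b ≤ c + d → ℕtoℚ a ℚ.+ ℕtoℚ b ℚ.≤ ℕtoℚ c ℚ.+ ℕtoℚ d
      +-mono a b c d le = subst₂ ℚ._≤_ (OrderedGroup.ι-+ ℚ-group a b) (OrderedGroup.ι-+ ℚ-group c d) (ℕtoℚ-mono-≤ le)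

    lower-supermodular : Supermodular lower
    lower-supermodular I J = subst₂ ℚ._≤_ (ℚP.neg-distrib-+ (lower (I ∪ J)) (lower (I ∩ J)))
      (ℚP.neg-distrib-+ (lower I) (lower J)) (ℚP.neg-antimono-≤ (+-mono (lowSum (countFirst r I) ℓ) (lowSum (countFirst r J) ℓ)
        (lowSum (countFirst r (I ∪ J)) ℓ) (lowSum (countFirst r (I ∩ J)) ℓ) le))
      where
      le : lowSum (countFirst r I) ℓ + lowSum (countFirst r J) ℓ ≤ lowSum (countFirst r (I ∪ J)) ℓ + lowSum (countFirst r (I ∩ J)) ℓ
      le rewrite countFirst-∪ r I J | countFirst-split r I J | countFirst-split′ r I J =
        lowSum-supermodular (countFirst r (I ∩ J)) (countFirst r (I ─ J)) (countFirst r (J ─ I)) ℓ asc (bound I J)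

    upper-submodular : Submodular upper
    upper-submodular I J = +-mono (highSum (countFirst r (I ∪ J)) us) (highSum (countFirst r (I ∩ J)) us)
        (highSum (countFirst r I) us) (highSum (countFirst r J) us) le
      where
      us = caps ℓ
      le : highSum (countFirst r (I ∪ J)) us + highSum (countFirst r (I ∩ J)) us ≤ highSum (countFirst r I) us + highSum (countFirst r J) us
      le rewrite countFirst-∪ r I J | countFirst-split r I J | countFirst-split′ r I J =
        highSum-submodular (countFirst r (I ∩ J)) (countFirst r (I ─ J)) (countFirst r (J ─ I)) us (bound′ I J) (caps-ascending asc)

    lower-upper : ∀ I J → upper (I ─ J) ℚ.- lower (J ─ I) ℚ.≤ upper I ℚ.- lower J
    lower-upper I J = transpose (upper (I ─ J)) (lower (J ─ I)) (upper I) (lower J)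
        (+-mono (highSum (countFirst r (I ─ J)) us) (lowSum (countFirst r J) ℓ)
                (highSum (countFirst r I) us) (lowSum (countFirst r (J ─ I)) ℓ) le)
      where
      us = caps ℓ
      le : highSum (countFirst r (I ─ J)) us + lowSum (countFirst r J) ℓ ≤ highSum (countFirst r I) us + lowSum (countFirst r (J ─ I)) ℓ
      le rewrite countFirst-split r I J | countFirst-split′ r I J =
        highSum-lowSum (countFirst r (I ∩ J)) (countFirst r (I ─ J)) (countFirst r (J ─ I)) us (bound′ I J) ℓ
          (caps-ascending asc) (lowSum-caps asc)
      transpose : ∀ a b c d → a ℚ.+ d ℚ.≤ c ℚ.+ b → a ℚ.- b ℚ.≤ c ℚ.- d
      transpose a b c d le = subst₂ ℚ._≤_
        (solve 3 (λ a b d → (a :+ d) :+ ((:- b) :+ (:- d)) := a :+ (:- b)) refl a b d)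
        (solve 3 (λ b c d → (c :+ b) :+ ((:- b) :+ (:- d)) := c :+ (:- d)) refl b c d)
        (ℚP.+-monoˡ-≤ (ℚ.- b ℚ.+ ℚ.- d) le)
        where open +-*-Solver

    paramodular : Paramodular lower upper
    paramodular = lower-supermodular , upper-submodular , lower-upper

-- Lattice points and rational points of the generalized polymatroid

module Padding (G : OrderedGroup) where
  open OrderedGroup G
  open Majorization G

  sumOn-++ : ∀ {r k} (I : Vec Bool r) (J : Vec Bool k) u v → sumOn (I Vec.++ J) (u Vec.++ v) ≡ sumOn I u ⊕ sumOn J v
  sumOn-++ []          J []      v = sym (identityˡ _)
  sumOn-++ (true ∷ I)  J (x ∷ u) v = trans (cong (x ⊕_) (sumOn-++ I J u v)) (sym (assoc x _ _))
  sumOn-++ (false ∷ I) J (x ∷ u) v = sumOn-++ I J u v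

  sumOn-ι : ∀ {r} (I : Vec Bool r) α → sumOn I (Vec.map ι α) ≡ ι (sumN I α)
  sumOn-ι []          []      = sym ι-0
  sumOn-ι (true ∷ I)  (a ∷ α) = trans (cong (ι a ⊕_) (sumOn-ι I α)) (sym (ι-+ a _))
  sumOn-ι (false ∷ I) (a ∷ α) = sumOn-ι I α

  countFirst-++ : ∀ {r k} (I : Vec Bool r) (J : Vec Bool k) → countFirst r (I Vec.++ J) ≡ count I
  countFirst-++ []          J = refl
  countFirst-++ (true ∷ I)  J = cong suc (countFirst-++ I J)
  countFirst-++ (false ∷ I) J = countFirst-++ I J

  zero-vector : ∀ {k} (v : Vec Carrier k) → (∀ J → sumOn J v ≡ 0#) → v ≡ replicate k 0#
  zero-vector []      h = refl
  zero-vector (x ∷ v) h = cong₂ _∷_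
    (trans (sym (trans (cong (x ⊕_) (sumOn-false v)) (identityʳ x))) (h (true ∷ replicate _ false)))
    (zero-vector v (λ J → h (false ∷ J)))

  module _ {r k : ℕ} (ℓ us : List ℕ) where

    Constraints : Vec Carrier (r + k) → Set
    Constraints t = ∀ I → ι (lowSum (countFirst r I) ℓ) ≼ sumOn I t × sumOn I t ≼ ι (highSum (countFirst r I) us)

    constraints-head : ∀ u v → Constraints (u Vec.++ v) → Bounded ℓ us u
    constraints-head u v h I = subst₂ (λ c s → ι (lowSum c ℓ) ≼ s) e e′ (proj₁ (h (I Vec.++ replicate k false))) ,
                               subst₂ (λ c s → s ≼ ι (highSum c us)) e e′ (proj₂ (h (I Vec.++ replicate k false)))
      where
      e : countFirst r (I Vec.++ replicate k false) ≡ count I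
      e = countFirst-++ I (replicate k false)
      e′ : sumOn (I Vec.++ replicate k false) (u Vec.++ v) ≡ sumOn I u
      e′ = trans (sumOn-++ I (replicate k false) u v) (trans (cong (sumOn I u ⊕_) (sumOn-false v)) (identityʳ _))

    -- A set away from the first `r` coordinates has both bounds 0, and one-element sets then settle
    -- each entry.
    constraints-tail : ∀ u v → Constraints (u Vec.++ v) → v ≡ replicate k 0#
    constraints-tail u v h = zero-vector v λ J → ≼-antisym
      (subst₂ (λ c s → s ≼ ι (highSum c us)) (e J) (e′ J) (proj₂ (h (replicate r false Vec.++ J))) ⟫ empty)
      (subst (_≼ sumOn J v) ι-0 (subst₂ (λ c s → ι (lowSum c ℓ) ≼ s) (e J) (e′ J) (proj₁ (h (replicate r false Vec.++ J)))))
      where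
      _⟫_ : ∀ {x y z} → x ≼ y → y ≡ z → x ≼ z
      le ⟫ refl = le
      e : ∀ J → countFirst r (replicate r false Vec.++ J) ≡ 0
      e J = trans (countFirst-++ (replicate r false) J) (count-false r)
      e′ : ∀ J → sumOn (replicate r false Vec.++ J) (u Vec.++ v) ≡ sumOn J v
      e′ J = trans (sumOn-++ (replicate r false) J u v) (trans (cong (_⊕ sumOn J v) (sumOn-false u)) (identityˡ _))
      empty : ι (highSum 0 us) ≡ 0#
      empty = trans (cong (λ xs → ι (sum xs)) (ListP.drop-all (List.length us) us ≤-refl)) ι-0

    point-constraints : ∀ {α : Vec ℕ r} → (∀ I → lowSum (count I) ℓ ≤ sumN I α × sumN I α ≤ highSum (count I) us) →
                        (∀ {m n} → m ≤ n → ι m ≼ ι n) → Constraints (Vec.map ι (α Vec.++ replicate k 0))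
    point-constraints {α} h mono I with Vec.splitAt r I
    ... | I₁ , I₂ , refl = subst₂ (λ c s → ι (lowSum c ℓ) ≼ s) (sym e) (sym e′) (mono (proj₁ (h I₁))) ,
                           subst₂ (λ c s → s ≼ ι (highSum c us)) (sym e) (sym e′) (mono (proj₂ (h I₁)))
      where
      e : countFirst r (I₁ Vec.++ I₂) ≡ count I₁
      e = countFirst-++ I₁ I₂
      sumN-0 : ∀ {k} (J : Vec Bool k) → sumN J (replicate k 0) ≡ 0
      sumN-0 []          = refl
      sumN-0 (true ∷ J)  = sumN-0 J
      sumN-0 (false ∷ J) = sumN-0 J
      e′ : sumOn (I₁ Vec.++ I₂) (Vec.map ι (α Vec.++ replicate k 0)) ≡ ι (sumN I₁ α)
      e′ = trans (cong (sumOn (I₁ Vec.++ I₂)) (VecP.map-++ ι α (replicate k 0)))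
        (trans (sumOn-++ I₁ I₂ (Vec.map ι α) (Vec.map ι (replicate k 0)))
        (trans (cong₂ _⊕_ (sumOn-ι I₁ α) (trans (sumOn-ι I₂ (replicate k 0)) (trans (cong ι (sumN-0 I₂)) ι-0)))
               (identityʳ _)))

  caps-box : ∀ {r l ℓ} {ν : Vec Carrier r} → Ascending l ℓ → Caps (caps ℓ) ν →
             ∃ λ α → ν ≡ Vec.map ι α × (∀ {q} → q ≤ capHead l ℓ → Box q ℓ α)
  caps-box [] [] = [] , refl , λ _ → []
  caps-box {ℓ = l ∷ ℓ} (_ ∷ asc) (_ ∷ c) with caps-box asc c
  ... | α , e , boxes = capHead l ℓ ∷ α , cong (ι (capHead l ℓ) ∷_) e , λ q≤ →
        box (≤-trans q≤ (ℕP.m⊓n≤n _ _)) (capHead-≥ asc) (capHead-≤ l ℓ) (boxes ≤-refl)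

module Pℤ = Padding ℤ-group
module Pℚ = Padding ℚ-group

threshold-box : ∀ {r p ℓ} {ν : Vec ℤ r} → Ascending p ℓ → Mℤ.Threshold ℓ (caps ℓ) ν →
                ∃ λ α → ν ≡ Vec.map ℤ.+_ α × Box p ℓ α
threshold-box [] Mℤ.[] = [] , refl , []
threshold-box {ℓ = l ∷ ℓ} (p≤l ∷ asc) (Mℤ.fixed thr) with threshold-box asc thr
... | α , e , b = l ∷ α , cong (ℤ.+ l ∷_) e , box p≤l ≤-refl (m≤m+n l _) b
threshold-box {ℓ = l ∷ ℓ} (p≤l ∷ asc) (Mℤ.bend (ℤ.+≤+ l≤d) (ℤ.+≤+ d≤u) c) with Pℤ.caps-box asc c
... | α , e , boxes = _ ∷ α , cong (_ ∷_) e ,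
      box (≤-trans p≤l l≤d) l≤d (≤-trans d≤u (capHead-≤ l ℓ)) (boxes d≤u)

move-step : ∀ {r} {v v′ : Vec ℤ r} α → v ≡ Vec.map ℤ.+_ α → Mℤ.Move v v′ → ∃ λ α′ → v′ ≡ Vec.map ℤ.+_ α′ × Step α α′
move-step (a ∷ b ∷ α) refl (Mℤ.here {p′ = ℤ.+ a′} {q′ = q′} e (ℤ.+≤+ a≤a′) (ℤ.+≤+ a′≤b)) =
  a′ ∷ (a + b ∸ a′) ∷ α , cong (λ q → ℤ.+ a′ ∷ q ∷ Vec.map ℤ.+_ α) q′≡ ,
  here (sym (ℕP.m+[n∸m]≡n a′≤a+b)) a≤a′ a′≤b
  where
  a′≤a+b : a′ ≤ a + b
  a′≤a+b = ≤-trans a′≤b (m≤n+m b a)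
  q′≡ : q′ ≡ ℤ.+ (a + b ∸ a′)
  q′≡ = OrderedGroup.⊕-cancelˡ ℤ-group (ℤ.+ a′) (trans (sym e) (cong ℤ.+_ (sym (ℕP.m+[n∸m]≡n a′≤a+b))))
move-step (a ∷ α) refl (Mℤ.there m) with move-step α refl m
... | α′ , refl , s = a ∷ α′ , refl , there s

-- Integer thresholds are boxes and integer moves are steps, so the passage from threshold to `t`
-- stays among vectors of naturals, although `t` is only assumed integral.
lattice-SL : ∀ {r ℓ} → Ascending 0 ℓ → List.length ℓ ≡ r → (t : Vec ℤ r) → Mℤ.Bounded ℓ (caps ℓ) t →
             ∃ λ α → t ≡ Vec.map ℤ.+_ α × SL ℓ α
lattice-SL {ℓ = ℓ} asc e = Mℤ.bounded-closed ℓ (caps ℓ) e (trans (length-caps ℓ) e)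
  (λ v → ∃ λ α → v ≡ Vec.map ℤ.+_ α × SL ℓ α) closed thresholds
  where
  closed : Mℤ.Closed (λ v → ∃ λ α → v ≡ Vec.map ℤ.+_ α × SL ℓ α)
  closed m (α , eq , sl) with move-step α eq m
  ... | α′ , eq′ , s = α′ , eq′ , SL-step asc s sl
  thresholds : ∀ ν → Mℤ.Threshold ℓ (caps ℓ) ν → ∃ λ α → ν ≡ Vec.map ℤ.+_ α × SL ℓ α
  thresholds ν thr with threshold-box asc thr
  ... | α , eq , b = α , eq , box-SL asc b

mix-scalar : ∀ s t x → s ℚ.+ t ≡ ℚ.1ℚ → s ℚ.* x ℚ.+ t ℚ.* x ≡ x
mix-scalar s t x e = trans (sym (ℚP.*-distribʳ-+ x s t)) (trans (cong (ℚ._* x) e) (ℚP.*-identityˡ x))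

mix-same : ∀ {r} s t → s ℚ.+ t ≡ ℚ.1ℚ → (v : Vec ℚ r) → mix s t v v ≡ v
mix-same s t e []      = refl
mix-same s t e (x ∷ v) = cong₂ _∷_ (mix-scalar s t x e) (mix-same s t e v)

mix-++ : ∀ {r k} s t (u v : Vec ℚ r) (w : Vec ℚ k) → s ℚ.+ t ≡ ℚ.1ℚ → mix s t (u Vec.++ w) (v Vec.++ w) ≡ mix s t u v Vec.++ w
mix-++ s t []      []      w e = mix-same s t e w
mix-++ s t (x ∷ u) (y ∷ v) w e = cong (s ℚ.* x ℚ.+ t ℚ.* y ∷_) (mix-++ s t u v w e)

-- Only the bend can be fractional. Replacing it by `l` or by its cap gives a box either way, so the
-- threshold lies on the segment between two lattice points.
threshold-mix : ∀ {r p ℓ} {ν : Vec ℚ r} → Ascending p ℓ → Mℚ.Threshold ℓ (caps ℓ) ν →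
  ∃ λ s → ∃ λ t → ∃ λ α → ∃ λ γ → ℚ.0ℚ ℚ.≤ s × ℚ.0ℚ ℚ.≤ t × s ℚ.+ t ≡ ℚ.1ℚ
    × Box p ℓ α × Box p ℓ γ × mix s t (toℚ α) (toℚ γ) ≡ ν
threshold-mix [] Mℚ.[] = ℚ.1ℚ , ℚ.0ℚ , [] , [] , ℚP.nonNegative⁻¹ ℚ.1ℚ , ℚP.≤-refl , refl , [] , [] , refl
threshold-mix {ℓ = l ∷ ℓ} (p≤l ∷ asc) (Mℚ.fixed thr) with threshold-mix asc thr
... | s , t , α , γ , 0≤s , 0≤t , e , b , b′ , eq = s , t , l ∷ α , l ∷ γ , 0≤s , 0≤t , e ,
      box p≤l ≤-refl (m≤m+n l _) b , box p≤l ≤-refl (m≤m+n l _) b′ ,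
      cong₂ _∷_ (mix-scalar s t (ℕtoℚ l) e) eq
threshold-mix {ℓ = l ∷ ℓ} (p≤l ∷ asc) (Mℚ.bend l≤d d≤u c) with segment l≤d d≤u | Pℚ.caps-box asc c
... | s , t , 0≤s , 0≤t , e , eq | α , refl , boxes =
      s , t , l ∷ α , capHead l ℓ ∷ α , 0≤s , 0≤t , e ,
      box p≤l ≤-refl (m≤m+n l _) (boxes (capHead-≥ asc)) ,
      box (≤-trans p≤l (capHead-≥ asc)) (capHead-≥ asc) (capHead-≤ l ℓ) (boxes ≤-refl) ,
      cong₂ _∷_ eq (mix-same s t e (toℚ α))

-- A balancing of (p, q) lies on the segment from (p, q) to (q, p). So the convex hull of a
-- symmetric support is closed under moves.
move-mix : ∀ {r} {v v′ : Vec ℚ r} → Mℚ.Move v v′ →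
  ∃ λ j → ∃ λ s → ∃ λ t → suc j < r × ℚ.0ℚ ℚ.≤ s × ℚ.0ℚ ℚ.≤ t × s ℚ.+ t ≡ ℚ.1ℚ × mix s t v (swapAt j v) ≡ v′
move-mix (Mℚ.here {p = p} {q} {p′} {q′} {v} e p≤p′ p′≤q) with segment p≤p′ p′≤q
... | s , t , 0≤s , 0≤t , e′ , eq = 0 , s , t , s≤s (s≤s z≤n) , 0≤s , 0≤t , e′ ,
      cong₂ _∷_ eq (cong₂ _∷_ other-entry (mix-same s t e′ v))
  where
  open +-*-Solver
  other-entry : s ℚ.* q ℚ.+ t ℚ.* p ≡ q′
  other-entry = OrderedGroup.⊕-cancelˡ ℚ-group p′ (trans (cong (ℚ._+ (s ℚ.* q ℚ.+ t ℚ.* p)) (sym eq))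
    (trans (solve 4 (λ s t p q → (s :* p :+ t :* q) :+ (s :* q :+ t :* p) := (s :+ t) :* (p :+ q)) refl s t p q)
    (trans (cong (ℚ._* (p ℚ.+ q)) e′) (trans (ℚP.*-identityˡ (p ℚ.+ q)) e))))
move-mix (Mℚ.there {x = x} m) with move-mix m
... | j , s , t , j< , 0≤s , 0≤t , e , eq = suc j , s , t , s≤s j< , 0≤s , 0≤t , e ,
      cong₂ _∷_ (mix-scalar s t x e) eq

swapAt-++ : ∀ {A : Set} {r k} j (v : Vec A r) (w : Vec A k) → suc j < r → swapAt j (v Vec.++ w) ≡ swapAt j v Vec.++ w
swapAt-++ zero    (x ∷ [])    w (s≤s ())
swapAt-++ zero    (x ∷ y ∷ v) w _        = refl
swapAt-++ (suc j) (x ∷ v)     w (s≤s lt) = cong (x ∷_) (swapAt-++ j v w lt)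

-- Raising a smallest coordinate

data Bump (m : ℕ) : ∀ {r} → Vec ℕ r → Vec ℕ r → Set where
  here  : ∀ {r} {α : Vec ℕ r} → Bump m (m ∷ α) (suc m ∷ α)
  there : ∀ {r a} {α β : Vec ℕ r} → Bump m α β → Bump m (a ∷ α) (a ∷ β)

bump-minimum : ∀ {r} (α : Vec ℕ (suc r)) → ∃ λ m → ∃ λ β → Bump m α β × (∀ J → count J ℕ.* m ≤ sumN J α)
bump-minimum (a ∷ []) = a , suc a ∷ [] , here , least
  where
  least : ∀ J → count J ℕ.* a ≤ sumN J (a ∷ [])
  least (true ∷ [])  = ≤-refl
  least (false ∷ []) = z≤n
bump-minimum (a ∷ α@(_ ∷ _)) with bump-minimum α
... | m , β , b , least with ℕP.≤-total a m
...   | inj₁ a≤m = a , suc a ∷ α , here , least′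
  where
  least′ : ∀ J → count J ℕ.* a ≤ sumN J (a ∷ α)
  least′ (true ∷ J)  = +-monoʳ-≤ a (≤-trans (ℕP.*-monoʳ-≤ (count J) a≤m) (least J))
  least′ (false ∷ J) = ≤-trans (ℕP.*-monoʳ-≤ (count J) a≤m) (least J)
...   | inj₂ m≤a = m , a ∷ β , there b , least′
  where
  least′ : ∀ J → count J ℕ.* m ≤ sumN J (a ∷ α)
  least′ (true ∷ J)  = +-mono-≤ m≤a (least J)
  least′ (false ∷ J) = least J

-- `I′` is `I` without the raised coordinate; `bump-upper` compares the bounds of the two sets.
bump-sumN : ∀ {m r} {α β : Vec ℕ r} → Bump m α β → ∀ I → sumN I β ≡ sumN I α
            ⊎ (sumN I β ≡ suc (sumN I α) × ∃ λ I′ → count I ≡ suc (count I′) × sumN I α ≡ m + sumN I′ α)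
bump-sumN here (true ∷ I)  = inj₂ (refl , false ∷ I , refl , refl)
bump-sumN here (false ∷ I) = inj₁ refl
bump-sumN {m} (there {a = a} {α = α} b) (true ∷ I) with bump-sumN b I
... | inj₁ e = inj₁ (cong (a +_) e)
... | inj₂ (e , I′ , c , e′) = inj₂ (trans (cong (a +_) e) (+-suc a _) , true ∷ I′ , cong suc c ,
      trans (cong (a +_) e′) (lemma a m (sumN I′ α)))
  where
  lemma : ∀ a m s → a + (m + s) ≡ m + (a + s)
  lemma = ℕS.solve-∀
bump-sumN (there b) (false ∷ I) with bump-sumN b I
... | inj₁ e = inj₁ e
... | inj₂ (e , I′ , c , e′) = inj₂ (e , false ∷ I′ , c , e′)

bump-sum : ∀ {m r k} {α β : Vec ℕ r} {γ : Vec ℕ k} → Bump m α β → ∣ β Vec.++ γ ∣ₘ ≡ suc ∣ α Vec.++ γ ∣ₘ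
bump-sum here              = refl
bump-sum (there {a = a} b) = trans (cong (a +_) (bump-sum b)) (+-suc a _)

bump-< : ∀ {m r k} {α β : Vec ℕ r} {γ : Vec ℕ k} → Bump m α β → (α Vec.++ γ) <ₘ (β Vec.++ γ)
bump-< {γ = γ} b = pointwise b , λ e → ℕP.1+n≢n (trans (sym (bump-sum {γ = γ} b)) (cong ∣_∣ₘ (sym e)))
  where
  refl-≤ : ∀ {k} (γ : Vec ℕ k) → Pointwise ℕ._≤_ γ γ
  refl-≤ []      = []
  refl-≤ (x ∷ γ) = ≤-refl ∷ refl-≤ γ
  pointwise : ∀ {m r} {α β : Vec ℕ r} → Bump m α β → Pointwise ℕ._≤_ (α Vec.++ γ) (β Vec.++ γ)
  pointwise (here {α = α}) = ℕP.n≤1+n _ ∷ refl-≤ (α Vec.++ γ)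
  pointwise (there b)      = ≤-refl ∷ pointwise b

drop-head : ∀ c (xs : List ℕ) → c < List.length xs → ∃ λ u → List.drop c xs ≡ u ∷ List.drop (suc c) xs
drop-head zero    (x ∷ xs) _        = x , refl
drop-head (suc c) (x ∷ xs) (s≤s lt) = drop-head c xs lt

lowSum-≤-* : ∀ {p} c xs {u rest} → Ascending p xs → List.drop c xs ≡ u ∷ rest → lowSum c xs ≤ c ℕ.* u
lowSum-≤-* zero    xs            _         _ = z≤n
lowSum-≤-* (suc c) (x ∷ xs) (_ ∷ asc) e = +-mono-≤ (below c asc e) (lowSum-≤-* c xs asc e)
  where
  below : ∀ {x xs u rest} c → Ascending x xs → List.drop c xs ≡ u ∷ rest → x ≤ u
  below zero    (x≤ ∷ _)   refl = x≤
  below (suc c) (x≤ ∷ asc) e    = ≤-trans x≤ (below c asc e)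

sumN-complement : ∀ {r} I (α : Vec ℕ r) → sumN (replicate r true) α ≡ sumN I α + sumN (complement I) α
sumN-complement []          []      = refl
sumN-complement (true ∷ I)  (a ∷ α) = trans (cong (a +_) (sumN-complement I α)) (sym (+-assoc a _ _))
sumN-complement (false ∷ I) (a ∷ α) = trans (cong (a +_) (sumN-complement I α)) (lemma a (sumN I α) (sumN (complement I) α))
  where
  lemma : ∀ a x y → a + (x + y) ≡ x + (a + y)
  lemma = ℕS.solve-∀

-- If raising the minimum m broke the bound of I, the bound of I would be tight with last increment at most m,
-- and the coordinates outside I, all at least m, would already exhaust the bound on the total.
bump-upper : ∀ {r us m} {α β : Vec ℕ r} → Ascending 0 us → List.length us ≡ r → Bump m α β →
             (∀ J → count J ℕ.* m ≤ sumN J α) → (∀ I → sumN I α ≤ highSum (count I) us) →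
             sumN (replicate r true) α < sum us → ∀ I → sumN I β ≤ highSum (count I) us
bump-upper {r} {us} {m} {α} {β} asc len b least upper below I with bump-sumN b I
... | inj₁ e = subst (_≤ highSum (count I) us) (sym e) (upper I)
... | inj₂ (e , I′ , c , e′) with ℕP.<-≤-connex (sumN I α) (highSum (count I) us)
...   | inj₁ lt    = subst (_≤ highSum (count I) us) (sym e) lt
...   | inj₂ tight = ⊥-elim (ℕP.<⇒≱ below exhausted)
  where
  open ℕP.≤-Reasoning
  d = count (complement I)
  total-count : d + count I ≡ List.length us
  total-count = trans (+-comm d (count I)) (trans (count-complement I) (sym len))
  d< : d < List.length us
  d< = ≤-trans (m≤m+n (suc d) (count I′)) (≤-reflexive
    (trans (sym (+-suc d (count I′))) (trans (cong (d +_) (sym c)) total-count)))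
  u = proj₁ (drop-head d us d<)
  drop≡ : List.drop d us ≡ u ∷ List.drop (suc d) us
  drop≡ = proj₂ (drop-head d us d<)
  high≡ : highSum (count I) us ≡ u + highSum (count I′) us
  high≡ = trans (highSum-drop d (count I) us total-count) (trans (cong sum drop≡) (cong (u +_)
    (sym (highSum-drop (suc d) (count I′) us (trans (sym (+-suc d (count I′))) (trans (cong (d +_) (sym c)) total-count))))))
  u≤m : u ≤ m
  u≤m = ℕP.+-cancelʳ-≤ (highSum (count I′) us) u m (begin
    u + highSum (count I′) us  ≡⟨ high≡ ⟨
    highSum (count I) us       ≤⟨ tight ⟩
    sumN I α                   ≡⟨ e′ ⟩
    m + sumN I′ α              ≤⟨ +-monoʳ-≤ m (upper I′) ⟩
    m + highSum (count I′) us  ∎)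
  exhausted : sum us ≤ sumN (replicate r true) α
  exhausted = begin
    sum us                                ≡⟨ sum-split d us ⟩
    lowSum d us + sum (List.drop d us)    ≡⟨ cong (lowSum d us +_) (highSum-drop d (count I) us total-count) ⟨
    lowSum d us + highSum (count I) us    ≤⟨ +-mono-≤ (≤-trans (lowSum-≤-* d us asc drop≡)
                                               (≤-trans (ℕP.*-monoʳ-≤ d u≤m) (least (complement I)))) tight ⟩
    sumN (complement I) α + sumN I α      ≡⟨ +-comm (sumN (complement I) α) (sumN I α) ⟩
    sumN I α + sumN (complement I) α      ≡⟨ sumN-complement I α ⟨
    sumN (replicate r true) α             ∎

sum-padded : ∀ {r} k (α : Vec ℕ r) → ∣ α Vec.++ replicate k 0 ∣ₘ ≡ sumN (replicate r true) α
sum-padded k []      = sum-replicate-0 k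
sum-padded k (a ∷ α) = cong (a +_) (sum-padded k α)

map-+-injective : ∀ {r} (α γ : Vec ℕ r) → Vec.map ℤ.+_ α ≡ Vec.map ℤ.+_ γ → α ≡ γ
map-+-injective []      []      _ = refl
map-+-injective (a ∷ α) (c ∷ γ) e = cong₂ _∷_ (ℤP.+-injective (VecP.∷-injectiveˡ e)) (map-+-injective α γ (VecP.∷-injectiveʳ e))

-- Lower bounds survive an increase and `bump-upper` guards the upper ones, so the raised vector is
-- a lattice point within all bounds and `lattice-SL` applies.
raise-SL : ∀ {r ℓ} → Ascending 0 ℓ → List.length ℓ ≡ r → (α : Vec ℕ r) → SL ℓ α →
           sumN (replicate r true) α < sum (caps ℓ) → ∃ λ m → ∃ λ β → Bump m α β × SL ℓ β
raise-SL {zero} {[]} asc len [] sl ()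
raise-SL {suc r} {ℓ} asc len α sl below with bump-minimum α
... | m , β , b , least with lattice-SL asc len (Vec.map ℤ.+_ β) bounded
  where
  us = caps ℓ
  raised : ∀ I → sumN I α ≤ sumN I β
  raised I with bump-sumN b I
  ... | inj₁ e       = ≤-reflexive (sym e)
  ... | inj₂ (e , _) = ≤-trans (ℕP.n≤1+n _) (≤-reflexive (sym e))
  bounded : Mℤ.Bounded ℓ us (Vec.map ℤ.+_ β)
  bounded I = subst (λ s → (ℤ.+ lowSum (count I) ℓ ℤ.≤ s) × (s ℤ.≤ ℤ.+ highSum (count I) us)) (sym (Pℤ.sumOn-ι I β))
    (ℤ.+≤+ (≤-trans (SL-lower sl I) (raised I)) ,
     ℤ.+≤+ (bump-upper (caps-ascending asc) (trans (length-caps ℓ) len) b least (SL-upper sl) below I))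
...   | γ , e , slγ = m , β , b , subst (SL ℓ) (sym (map-+-injective β γ e)) slγ

module Support {r k : ℕ} {ℓ : List ℕ} (asc : Ascending 0 ℓ) (len : List.length ℓ ≡ r) (f : Poly (r + k))
  (support : ∀ α → InSupp f α ⇔ (∃ λ (α₁ : Vec ℕ r) → SL ℓ α₁ × α ≡ α₁ Vec.++ replicate k 0)) where

  private
    us = caps ℓ
    us-length : List.length us ≡ r
    us-length = trans (length-caps ℓ) len

    SL-supp : ∀ {α₁} → SL ℓ α₁ → InSupp f (α₁ Vec.++ replicate k 0)
    SL-supp sl = proj₂ (support _) (_ , sl , refl)

    bounds : ∀ {α₁ : Vec ℕ r} → SL ℓ α₁ → ∀ I → lowSum (count I) ℓ ≤ sumN I α₁ × sumN I α₁ ≤ highSum (count I) us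
    bounds sl I = SL-lower sl I , SL-upper sl I

    supp-swapAt : ∀ {j} → suc j < r → ∀ α → InSupp f α → InSupp f (swapAt j α)
    supp-swapAt {j} j<r α h with proj₁ (support α) h
    ... | α₁ , sl , refl = subst (InSupp f) (sym (swapAt-++ j α₁ (replicate k 0) j<r)) (SL-supp (SL-swap j asc sl))

    toℚ-padded : ∀ (α₁ : Vec ℕ r) → toℚ (α₁ Vec.++ replicate k 0) ≡ toℚ α₁ Vec.++ replicate k ℚ.0ℚ
    toℚ-padded α₁ = trans (VecP.map-++ ℕtoℚ α₁ (replicate k 0)) (cong (toℚ α₁ Vec.++_) (VecP.map-replicate ℕtoℚ 0 k))

    InHull : Vec ℚ r → Set
    InHull v = Hull f (v Vec.++ replicate k ℚ.0ℚ)

    SL-hull : ∀ {α₁} → SL ℓ α₁ → InHull (toℚ α₁)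
    SL-hull {α₁} sl = subst (Hull f) (toℚ-padded α₁) (hull-point (SL-supp sl))

    hull-closed : Mℚ.Closed InHull
    hull-closed {v} {v′} m h with move-mix m
    ... | j , s , t , j<r , 0≤s , 0≤t , e , eq = subst (Hull f)
      (trans (cong (mix s t (v Vec.++ replicate k ℚ.0ℚ)) (swapAt-++ j v (replicate k ℚ.0ℚ) j<r))
        (trans (mix-++ s t v (swapAt j v) (replicate k ℚ.0ℚ) e) (cong (Vec._++ replicate k ℚ.0ℚ) eq)))
      (hull-mix 0≤s 0≤t e h (hull-swapAt j (supp-swapAt j<r) h))

    hull-thresholds : ∀ ν → Mℚ.Threshold ℓ us ν → InHull ν
    hull-thresholds ν thr with threshold-mix asc thr
    ... | s , t , α , γ , 0≤s , 0≤t , e , b , b′ , refl = subst (Hull f) (mix-++ s t (toℚ α) (toℚ γ) (replicate k ℚ.0ℚ) e)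
          (hull-mix 0≤s 0≤t e (SL-hull (box-SL asc b)) (SL-hull (box-SL asc b′)))

  constraints⇒hull : ∀ t → Pℚ.Constraints {r} {k} ℓ us t → Hull f t
  constraints⇒hull t h with Vec.splitAt r t
  ... | t₁ , t₂ , refl with Pℚ.constraints-tail ℓ us t₁ t₂ h
  ...   | refl = Mℚ.bounded-closed ℓ us len us-length InHull hull-closed hull-thresholds t₁
                   (Pℚ.constraints-head ℓ us t₁ (replicate k ℚ.0ℚ) h)

  supp-constraints : ∀ α → InSupp f α → Pℚ.Constraints {r} {k} ℓ us (toℚ α)
  supp-constraints α h with proj₁ (support α) h
  ... | α₁ , sl , refl = Pℚ.point-constraints ℓ us (bounds sl) ℕtoℚ-mono-≤

  hull⇒constraints : ∀ t → Hull f t → Pℚ.Constraints {r} {k} ℓ us t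
  hull⇒constraints t h I = hull-lower I (ℕtoℚ (lowSum (countFirst r I) ℓ)) (λ α hα → proj₁ (supp-constraints α hα I)) h ,
                           hull-upper I (ℕtoℚ (highSum (countFirst r I) us)) (λ α hα → proj₂ (supp-constraints α hα I)) h

  generalizedPolymatroid : IsGeneralizedPolymatroid (InNewton f)
  generalizedPolymatroid = lower , upper , paramodular , λ t →
    (λ h I → let (l , u) = hull⇒constraints t (newton⇒hull h) I in
       subst (lower I ℚ.≤_) (sym (sumOver-sumOn I t)) l , subst (ℚ._≤ upper I) (sym (sumOver-sumOn I t)) u) ,
    (λ h → hull⇒newton (constraints⇒hull t (λ I → let (l , u) = h I in
       subst (lower I ℚ.≤_) (sumOver-sumOn I t) l , subst (ℚ._≤ upper I) (sumOver-sumOn I t) u)))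
    where open Paramodularity r asc len

  private
    sumOn-intToℚ : ∀ {n} (I : Vec Bool n) t → Mℚ.sumOn I (Vec.map intToℚ t) ≡ intToℚ (Mℤ.sumOn I t)
    sumOn-intToℚ []          []      = refl
    sumOn-intToℚ (true ∷ I)  (x ∷ t) = trans (cong (intToℚ x ℚ.+_) (sumOn-intToℚ I t)) (sym (intToℚ-+ x _))
    sumOn-intToℚ (false ∷ I) (x ∷ t) = sumOn-intToℚ I t

  saturated : SaturatedNewton f
  saturated t = to , from
    where
    constraints : InNewton f (Vec.map intToℚ t) → Pℤ.Constraints {r} {k} ℓ us t
    constraints h I with hull⇒constraints (Vec.map intToℚ t) (newton⇒hull h) I
    ... | l , u = intToℚ-cancel-≤ (subst (ℕtoℚ (lowSum (countFirst r I) ℓ) ℚ.≤_) (sumOn-intToℚ I t) l) ,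
                  intToℚ-cancel-≤ (subst (ℚ._≤ ℕtoℚ (highSum (countFirst r I) us)) (sumOn-intToℚ I t) u)
    lattice : ∀ t → Pℤ.Constraints {r} {k} ℓ us t → Σ (Mono (r + k)) λ α → InSupp f α × toℤ α ≡ t
    lattice t h with Vec.splitAt r t
    ... | t₁ , t₂ , refl with Pℤ.constraints-tail ℓ us t₁ t₂ h
    ...   | refl with lattice-SL asc len t₁ (Pℤ.constraints-head ℓ us t₁ (replicate k 0ℤ) h)
    ...     | α , refl , sl = α Vec.++ replicate k 0 , SL-supp sl ,
              trans (VecP.map-++ ℤ.+_ α (replicate k 0)) (cong (Vec.map ℤ.+_ α Vec.++_) (VecP.map-replicate ℤ.+_ 0 k))
    to : InNewton f (Vec.map intToℚ t) → Σ (Mono (r + k)) λ α → InSupp f α × toℤ α ≡ t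
    to h = lattice t (constraints h)
    from : (Σ (Mono (r + k)) λ α → InSupp f α × toℤ α ≡ t) → InNewton f (Vec.map intToℚ t)
    from (α , h , refl) = hull⇒newton (subst (Hull f) (VecP.map-∘ intToℚ ℤ.+_ α) (hull-point h))

  raise : ∀ d → IsDegree f d → ∀ α → InSupp f α → ∣ α ∣ₘ < d →
          Σ (Mono (r + k)) λ β → InSupp f β × α <ₘ β × ∣ β ∣ₘ ≡ suc ∣ α ∣ₘ
  raise d ((γ , hγ , γ-degree) , _) α hα α<d with proj₁ (support α) hα | proj₁ (support γ) hγ
  -- The degree is attained at `γ₁`, which obeys the upper bound for the full set, so `α₁` has total
  -- strictly below the sum of the caps.
  ... | α₁ , sl , refl | γ₁ , slγ , refl with raise-SL asc len α₁ sl (ℕP.<-≤-trans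
        (subst (_< d) (sum-padded k α₁) α<d) (≤-trans (≤-reflexive (trans (sym γ-degree) (sum-padded k γ₁)))
        (≤-trans (SL-upper slγ (replicate r true)) (≤-reflexive (highSum-all _ us (trans (count-true r) (sym us-length)))))))
  ...   | m , β , b , slβ = β Vec.++ replicate k 0 , SL-supp slβ , bump-< b , bump-sum b

-- The support of a Grassmannian Grothendieck polynomial

padded-≡ : ∀ {r k} {α₁ : Vec ℕ r} {α : Mono (r + k)} → Padded α₁ α → α ≡ α₁ Vec.++ replicate k 0
padded-≡ {α₁ = []}     []      = refl
padded-≡ {α₁ = a ∷ α₁} (a ∷ p) = cong (a ∷_) (padded-≡ p)

padded-++ : ∀ {r} k (α₁ : Vec ℕ r) → Padded α₁ (α₁ Vec.++ replicate k 0)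
padded-++ k []       = []
padded-++ k (a ∷ α₁) = a ∷ padded-++ k α₁

grassmannian-support : ∀ {n} {w : Vec ℕ n} {f} (β : Vec Bool n) → toList w ≡ word 1 β → Grothendieck n w f →
                       ∀ α → InSupp f α ⇔ S β α
grassmannian-support {zero} {[]} [] e G [] =
  (λ _ → none refl) , (λ _ z → 1≢0 (trans (sym (grothendieck-𝔉 G [])) z))
  where
  1≢0 : ¬ 1ℤ ≡ 0ℤ
  1≢0 ()
grassmannian-support {suc n} {w} {f} β e G α =
  (λ h → proj₁ (𝔉ᴮ-S β α) (λ z → h (trans f≡ z))) , (λ s z → proj₂ (𝔉ᴮ-S β α) s (trans (sym f≡) z))
  where
  f≡ : f α ≡ 𝔉ᴮ β α
  f≡ = trans (grothendieck-𝔉 G α) (𝔉-𝔉ᴮ w β (subst Unique (sym e) (word-unique β)) e α)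

padded-support : ∀ {n} r k (e : n ≡ r + k) (β : Vec Bool n) → List.length (parts β) ≡ r → ∀ α →
                 S β α ⇔ (∃ λ (α₁ : Vec ℕ r) → SL (parts β) α₁ × subst (Vec ℕ) e α ≡ α₁ Vec.++ replicate k 0)
padded-support r k refl β len α = to , λ { (α₁ , sl , refl) → SL-S β refl sl (padded-++ k α₁) }
  where
  to : S β α → ∃ λ (α₁ : Vec ℕ r) → SL (parts β) α₁ × α ≡ α₁ Vec.++ replicate k 0
  to s with S-SL s
  ... | r′ , α₁ , sl , p with trans (sym (SL-length sl)) len
  ...   | refl = α₁ , sl , padded-≡ p

-- The hypothesis on the support ranges over all `e`, so that it can be taken at `refl` once the
-- shape equation has been matched.
theorem-for-shape : ∀ {n} r k → n ≡ r + k → ∀ {ℓ} → Ascending 0 ℓ → List.length ℓ ≡ r → (f : Poly n) →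
  (∀ (e : n ≡ r + k) α → InSupp f α ⇔ (∃ λ (α₁ : Vec ℕ r) → SL ℓ α₁ × subst (Vec ℕ) e α ≡ α₁ Vec.++ replicate k 0)) →
    (∀ (d : ℕ) → IsDegree f d → ∀ (α : Mono n) → InSupp f α → ∣ α ∣ₘ < d →
       Σ (Mono n) λ β → InSupp f β × α <ₘ β × ∣ β ∣ₘ ≡ suc ∣ α ∣ₘ)
  × SaturatedNewton f
  × IsGeneralizedPolymatroid (InNewton f)
theorem-for-shape r k refl asc len f support = raise , saturated , generalizedPolymatroid
  where open Support {r} {k} asc len f (support refl)

theorem3p19 : ∀ (n : ℕ) (w : Vec ℕ n) → IsPermutation w → Grassmannian w →
    ∀ (𝔊 : Poly n) → Grothendieck n w 𝔊 →
      (∀ (d : ℕ) → IsDegree 𝔊 d → ∀ (α : Mono n) → InSupp 𝔊 α → ∣ α ∣ₘ < d →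
         Σ (Mono n) λ β → InSupp 𝔊 β × α <ₘ β × ∣ β ∣ₘ ≡ suc ∣ α ∣ₘ)
    × SaturatedNewton 𝔊
    × IsGeneralizedPolymatroid (InNewton 𝔊)
theorem3p19 n w perm grass 𝔊 G with grassmannian-word w perm grass
... | β , e = theorem-for-shape r (n ∸ r) (sym (ℕP.m+[n∸m]≡n (parts-length β))) (parts-ascending β) refl 𝔊
      (λ e′ α → (λ h → proj₁ (padded-support r (n ∸ r) e′ β refl α) (proj₁ (grassmannian-support β e G α) h)) ,
                (λ p → proj₂ (grassmannian-support β e G α) (proj₂ (padded-support r (n ∸ r) e′ β refl α) p)))
  where
  r = List.length (parts β)
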